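{- Let $K$ be a local field of characteristic $p>0$, and let $L$ be any totally ramified and purely inseparable extension of $K$ of degree $p^n$. Let $b$ be an integer with $0<b<p^n$ and $\gcd(b,p)=1$. Then there is an action of $\mathcal{A}(n)$ on $L$ which makes $L$ into an $\mathcal{A}(n)$-Hopf Galois extension of $K$, and which admits an $\mathcal{A}(n)$-scaffold on $L$ with all shift parameters equal to $b$ (i.e. $b_1=\dots=b_n=b$) and with tolerance $\mathfrak{T}=\infty$.
   Context: A local field here is a field complete with respect to a discrete valuation whose residue field has characteristic $p$; $v_K,v_L$ are normalized valuations, $\mathfrak{O}_K$ the valuation ring of $K$, $\mathfrak{P}_L$ the maximal ideal of $\mathfrak{O}_L$. The divided power $K$-Hopf algebra $\mathcal{A}(n)$ is the $K$-vector space with basis $t_0,\dots,t_{p^n-1}$, multiplication $t_it_j=\binom{i+j}{j}t_{i+j}$ if $i+j<p^n$ and $0$ otherwise, $t_0$ the identity, comultiplication $\Delta(t_r)=\sum_{j=0}^r t_j\otimes t_{r-j}$, counit $\epsilon(t_r)=\delta_{0,r}$, antipode $t_r\mapsto(-1)^rt_r$. For a $K$-Hopf algebra $H$, $L$ is an $H$-module algebra if $H$ acts $K$-linearly on $L$ with $h(st)=\mu(\Delta(h)(s\otimes t))$ ($\mu$ the multiplication of $L$) and $h\cdot1=\epsilon(h)1$; $L/K$ is $H$-Hopf Galois if moreover the map $L\otimes_K H\to\mathrm{End}_K(L)$, $(s\otimes h)\mapsto(x\mapsto s\,h(x))$, is bijective. Scaffolds: let $\mathbb{S}_{p^n}=\{0,\dots,p^n-1\}$,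 $s=\sum_{i=1}^n s_{(n-i)}p^{n-i}$ with digits in $\{0,\dots,p-1\}$; for integers $b_1,\dots,b_n$ prime to $p$, $\mathfrak{b}(s)=\sum_i s_{(n-i)}p^{n-i}b_i$ and $\mathfrak{a}(t)\in\mathbb{S}_{p^n}$ ($t\in\mathbb{Z}$) is the unique element with $\mathfrak{b}(\mathfrak{a}(t))\equiv-t\pmod{p^n}$. For a $K$-algebra $A$ of dimension $p^n$ acting $K$-linearly on $L$ (with $[L:K]=p^n$ totally ramified), an $A$-scaffold of tolerance $\infty$ with shift parameters $b_1,\dots,b_n$ consists of (i) $\lambda_t\in L$ ($t\in\mathbb{Z}$) with $v_L(\lambda_t)=t$ and $\lambda_{t_1}\lambda_{t_2}^{ -1}\in K$ whenever $t_1\equiv t_2\pmod{p^n}$, and (ii) $\Psi_1,\dots,\Psi_n\in A$ with $\Psi_i\cdot1=0$ such that for each $i,t$ there is $u_{i,t}\in\mathfrak{O}_K^\times$ with $\Psi_i\cdot\lambda_t=u_{i,t}\lambda_{t+p^{n-i}b_i}$ if $\mathfrak{a}(t)_{(n-i)}\ge1$ and $\Psi_i\cdot\lambda_t=0$ if $\mathfrak{a}(t)_{(n-i)}=0$. -}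

module Defs where

open import Algebra.Bundles using (CommutativeRing; AbelianGroup)
open import Algebra.Module.Bundles using (LeftModule)
open import Algebra.Module.Morphism.Structures using (module LeftModuleMorphisms)
open import Algebra.Morphism.Structures using (module RingMorphisms)
import Algebra.Definitions.RawMonoid as RawMonoidDefs
import Algebra.Properties.AbelianGroup as AbelianGroupProps
import Algebra.Properties.CommutativeMonoid.Sum as SumProps
import Algebra.Properties.Ring as RingProps
open import Data.Bool.Base using (if_then_else_)
open import Data.Fin.Base using (Fin; toℕ)
open import Data.Integer.Base as ℤ using (ℤ; +_; 0ℤ; 1ℤ)
open import Data.Integer.Coprimality using (Coprime)
import Data.Integer.Divisibility as ℤ using (_∣_)
import Data.Integer.Properties as ℤ
open import Data.Nat.Base as ℕ using (ℕ; zero; suc; _∸_; _≡ᵇ_)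
open import Data.Nat.Combinatorics using (_C_)
open import Data.Nat.Divisibility using (_∣_)
open import Data.Nat.DivMod using (_/_; _%_)
open import Data.Nat.Primality using (Prime; prime⇒nonZero)
open import Data.Nat.Properties using (m^n≢0)
open import Data.Product.Base using (Σ; _×_; ∃; ∃-syntax; _,_)
open import Data.Vec.Functional using (Vector)
open import Function.Bundles using (_⇔_)
open import Function.Definitions using (Bijective)
open import Level using (Level; _⊔_) renaming (suc to lsuc)
open import Relation.Binary.Construct.Add.Supremum.NonStrict ℤ._≤_ using (_≤⁺_)
open import Relation.Binary.PropositionalEquality.Core using (_≡_)
open import Relation.Nullary.Construct.Add.Supremum using (_⁺; [_]; ⊤⁺)

private
  variable
    c ℓ c′ ℓ′ r ℓr m₁ ℓ₁ m₂ ℓ₂ g ℓg : Level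

-- The value of the inverse at 0# is left unspecified.
record Field c ℓ : Set (lsuc (c ⊔ ℓ)) where
  infix 8 _⁻¹
  field
    commutativeRing : CommutativeRing c ℓ
  open CommutativeRing commutativeRing public
  field
    _⁻¹      : Carrier → Carrier
    1≉0      : 1# ≉ 0#
    inverseʳ : ∀ x → x ≉ 0# → x * x ⁻¹ ≈ 1#

HasCharacteristic : Field c ℓ → ℕ → Set ℓ
HasCharacteristic F p = ∀ m → (m ×ᶠ 1# ≈ 0#) ⇔ (p ∣ m)
  where
  open Field F
  open RawMonoidDefs +-rawMonoid using () renaming (_×_ to infixr 8 _×ᶠ_)

-- ℤ ⁺ is ℤ ∪ {∞}.
infixl 6 _+⁺_ _⊓⁺_

_+⁺_ : ℤ ⁺ → ℤ ⁺ → ℤ ⁺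
[ i ] +⁺ [ j ] = [ i ℤ.+ j ]
[ _ ] +⁺ ⊤⁺    = ⊤⁺
⊤⁺    +⁺ _     = ⊤⁺

_⊓⁺_ : ℤ ⁺ → ℤ ⁺ → ℤ ⁺
[ i ] ⊓⁺ [ j ] = [ i ℤ.⊓ j ]
[ i ] ⊓⁺ ⊤⁺    = [ i ]
⊤⁺    ⊓⁺ y     = y

-- Used only for a positive multiplier, so that e · ∞ = ∞.
_·⁺_ : ℕ → ℤ ⁺ → ℤ ⁺
e ·⁺ [ i ] = [ + e ℤ.* i ]
e ·⁺ ⊤⁺    = ⊤⁺

record NormalizedValuation (F : Field c ℓ) : Set (c ⊔ ℓ) where
  open Field F
  field
    v           : Carrier → ℤ ⁺
    v-cong      : ∀ {x y} → x ≈ y → v x ≡ v y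
    v-∞         : ∀ x → (v x ≡ ⊤⁺) ⇔ (x ≈ 0#)
    v-*         : ∀ x y → v (x * y) ≡ v x +⁺ v y
    v-+         : ∀ x y → v x ⊓⁺ v y ≤⁺ v (x + y)
    uniformizer : ∃[ π ] v π ≡ [ 1ℤ ]

  InValuationRing : Carrier → Set
  InValuationRing x = [ 0ℤ ] ≤⁺ v x

  InMaximalIdeal : Carrier → Set
  InMaximalIdeal x = [ 1ℤ ] ≤⁺ v x

  IsUnitOfValuationRing : Carrier → Set (c ⊔ ℓ)
  IsUnitOfValuationRing x =
    InValuationRing x × ∃[ y ] InValuationRing y × x * y ≈ 1#

  IsCauchy : (ℕ → Carrier) → Set
  IsCauchy x = ∀ M → ∃[ N ] ∀ i j → N ℕ.≤ i → N ℕ.≤ j → [ M ] ≤⁺ v (x i - x j)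

  _ConvergesTo_ : (ℕ → Carrier) → Carrier → Set
  x ConvergesTo y = ∀ M → ∃[ N ] ∀ i → N ℕ.≤ i → [ M ] ≤⁺ v (x i - y)

  IsComplete : Set c
  IsComplete = ∀ x → IsCauchy x → ∃[ y ] x ConvergesTo y

  -- An integer m vanishes in the residue field iff m · 1 lies in the
  -- maximal ideal of the valuation ring.
  HasResidueCharacteristic : ℕ → Set
  HasResidueCharacteristic p = ∀ m → InMaximalIdeal (m ×ᶠ 1#) ⇔ (p ∣ m)
    where open RawMonoidDefs +-rawMonoid using () renaming (_×_ to _×ᶠ_)

record LocalField (p : ℕ) c ℓ : Set (lsuc (c ⊔ ℓ)) where
  field
    asField   : Field c ℓ
    valuation : NormalizedValuation asField
  open Field asField public
  open NormalizedValuation valuation public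
  field
    complete              : IsComplete
    residueCharacteristic : HasResidueCharacteristic p

module _ {K : Field c ℓ} (V : LeftModule (Field.ring K) m₁ ℓ₁) where
  open LeftModule V
  open SumProps +ᴹ-commutativeMonoid using (sum)

  record IsBasis {d} (e : Vector Carrierᴹ d) : Set (c ⊔ ℓ ⊔ m₁ ⊔ ℓ₁) where
    open Field K using (Carrier; _≈_; 0#)
    field
      independent : ∀ (a : Vector Carrier d) →
                    sum (λ i → a i *ₗ e i) ≈ᴹ 0ᴹ → ∀ i → a i ≈ 0#
      spanning    : ∀ x → Σ (Vector Carrier d) λ a → x ≈ᴹ sum (λ i → a i *ₗ e i)

  HasDimension : ℕ → Set (c ⊔ ℓ ⊔ m₁ ⊔ ℓ₁)
  HasDimension d = ∃ (IsBasis {d})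

record Extension (K : Field c ℓ) (L : Field c′ ℓ′) : Set (c ⊔ ℓ ⊔ c′ ⊔ ℓ′) where
  private
    module K = Field K
    module L = Field L
  open RingMorphisms K.rawRing L.rawRing using (IsRingHomomorphism)
  field
    ι     : K.Carrier → L.Carrier
    isHom : IsRingHomomorphism ι
  open IsRingHomomorphism isHom

  asModule : LeftModule K.ring c′ ℓ′
  asModule = record
    { Carrierᴹ = L.Carrier
    ; _≈ᴹ_ = L._≈_
    ; _+ᴹ_ = L._+_
    ; _*ₗ_ = λ k x → ι k L.* x
    ; 0ᴹ = L.0#
    ; -ᴹ_ = L.-_
    ; isLeftModule = record
      { isLeftSemimodule = record
        { +ᴹ-isCommutativeMonoid = L.+-isCommutativeMonoid
        ; isPreleftSemimodule = record
          { *ₗ-cong = λ k≈ x≈ → L.*-cong (⟦⟧-cong k≈) x≈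
          ; *ₗ-zeroˡ = λ x → L.trans (L.*-congʳ 0#-homo) (L.zeroˡ x)
          ; *ₗ-distribʳ = λ x j k →
              L.trans (L.*-congʳ (+-homo j k)) (L.distribʳ x (ι j) (ι k))
          ; *ₗ-identityˡ = λ x → L.trans (L.*-congʳ 1#-homo) (L.*-identityˡ x)
          ; *ₗ-assoc = λ j k x →
              L.trans (L.*-congʳ (*-homo j k)) (L.*-assoc (ι j) (ι k) x)
          ; *ₗ-zeroʳ = λ k → L.zeroʳ (ι k)
          ; *ₗ-distribˡ = λ k x y → L.distribˡ (ι k) x y
          }
        }
      ; -ᴹ‿cong = L.-‿cong
      ; -ᴹ‿inverse = L.-‿inverse
      }
    }

  HasDegree : ℕ → Set (c ⊔ ℓ ⊔ c′ ⊔ ℓ′)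
  HasDegree d = HasDimension {K = K} asModule d

  InBase : L.Carrier → Set (c ⊔ ℓ′)
  InBase x = ∃[ k ] x L.≈ ι k

  -- For fields of characteristic p: every element of L has a pᵏ-th
  -- power in K.
  IsPurelyInseparable : ℕ → Set (c ⊔ c′ ⊔ ℓ′)
  IsPurelyInseparable p = ∀ x → ∃[ k ] InBase (x ^ (p ℕ.^ k))
    where open RawMonoidDefs L.*-rawMonoid using () renaming (_×_ to _×*_)
          _^_ : L.Carrier → ℕ → L.Carrier
          x ^ m = m ×* x

  module _ (vK : NormalizedValuation K) (vL : NormalizedValuation L) where
    private
      module vK = NormalizedValuation vK
      module vL = NormalizedValuation vL

    HasRamificationIndex : ℕ → Set c
    HasRamificationIndex e = ∀ k → vL.v (ι k) ≡ e ·⁺ vK.v k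

    IsTotallyRamifiedOfDegree : ℕ → Set (c ⊔ ℓ ⊔ c′ ⊔ ℓ′)
    IsTotallyRamifiedOfDegree d = HasDegree d × HasRamificationIndex d

-- The tensor product over R, as the abelian group generated by the symbols
-- x ⊗ y subject to bilinearity; quotients being unavailable, it is a setoid.
module Tensor {R : CommutativeRing r ℓr}
              (M : LeftModule (CommutativeRing.ring R) m₁ ℓ₁)
              (N : LeftModule (CommutativeRing.ring R) m₂ ℓ₂) where
  private
    module R = CommutativeRing R
    module M = LeftModule M
    module N = LeftModule N

  infixl 6 _⊕_
  infixl 7 _⊗_
  infix  4 _≈⊗_

  data Tensors : Set (m₁ ⊔ m₂) where
    _⊗_ : M.Carrierᴹ → N.Carrierᴹ → Tensors
    _⊕_ : Tensors → Tensors → Tensors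
    𝟎   : Tensors
    ⊖_  : Tensors → Tensors

  data _≈⊗_ : Tensors → Tensors → Set (r ⊔ m₁ ⊔ m₂ ⊔ ℓ₁ ⊔ ℓ₂) where
    ≈-refl      : ∀ {z} → z ≈⊗ z
    ≈-sym       : ∀ {z w} → z ≈⊗ w → w ≈⊗ z
    ≈-trans     : ∀ {z w u} → z ≈⊗ w → w ≈⊗ u → z ≈⊗ u
    ⊕-cong      : ∀ {z z′ w w′} → z ≈⊗ z′ → w ≈⊗ w′ → z ⊕ w ≈⊗ z′ ⊕ w′
    ⊖-cong      : ∀ {z w} → z ≈⊗ w → ⊖ z ≈⊗ ⊖ w
    ⊕-assoc     : ∀ z w u → (z ⊕ w) ⊕ u ≈⊗ z ⊕ (w ⊕ u)
    ⊕-comm      : ∀ z w → z ⊕ w ≈⊗ w ⊕ z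
    ⊕-identityˡ : ∀ z → 𝟎 ⊕ z ≈⊗ z
    ⊖-inverseˡ  : ∀ z → (⊖ z) ⊕ z ≈⊗ 𝟎
    ⊗-cong      : ∀ {x x′ y y′} → x M.≈ᴹ x′ → y N.≈ᴹ y′ → x ⊗ y ≈⊗ x′ ⊗ y′
    ⊗-distribʳ  : ∀ x x′ y → (x M.+ᴹ x′) ⊗ y ≈⊗ x ⊗ y ⊕ x′ ⊗ y
    ⊗-distribˡ  : ∀ x y y′ → x ⊗ (y N.+ᴹ y′) ≈⊗ x ⊗ y ⊕ x ⊗ y′
    ⊗-balanced  : ∀ k x y → (k M.*ₗ x) ⊗ y ≈⊗ x ⊗ (k N.*ₗ y)

  abelianGroup : AbelianGroup (m₁ ⊔ m₂) (r ⊔ m₁ ⊔ m₂ ⊔ ℓ₁ ⊔ ℓ₂)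
  abelianGroup = record
    { Carrier = Tensors
    ; _≈_ = _≈⊗_
    ; _∙_ = _⊕_
    ; ε = 𝟎
    ; _⁻¹ = ⊖_
    ; isAbelianGroup = record
      { isGroup = record
        { isMonoid = record
          { isSemigroup = record
            { isMagma = record
              { isEquivalence = record
                { refl = ≈-refl ; sym = ≈-sym ; trans = ≈-trans }
              ; ∙-cong = ⊕-cong
              }
            ; assoc = ⊕-assoc
            }
          ; identity = ⊕-identityˡ ,
              λ z → ≈-trans (⊕-comm z 𝟎) (⊕-identityˡ z)
          }
        ; inverse = ⊖-inverseˡ ,
            λ z → ≈-trans (⊕-comm z (⊖ z)) (⊖-inverseˡ z)
        ; ⁻¹-cong = ⊖-cong
        }
      ; comm = ⊕-comm
      }
    }

  -- The additive map x ⊗ y ↦ f x y; it respects _≈⊗_ when f is bilinear.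
  module _ (G : AbelianGroup g ℓg) where
    private module G = AbelianGroup G

    extend : (M.Carrierᴹ → N.Carrierᴹ → G.Carrier) → Tensors → G.Carrier
    extend f (x ⊗ y) = f x y
    extend f (z ⊕ w) = extend f z G.∙ extend f w
    extend f 𝟎       = G.ε
    extend f (⊖ z)   = extend f z G.⁻¹

-- The operations of a K-Hopf algebra; its axioms play no role in the
-- definitions of actions, module algebras and Hopf Galois extensions.
record RawHopfAlgebra (K : Field c ℓ) m ℓm : Set (lsuc (c ⊔ ℓ ⊔ m ⊔ ℓm)) where
  private module K = Field K
  field
    space : LeftModule K.ring m ℓm
  open LeftModule space public
    renaming (Carrierᴹ to Carrier; _≈ᴹ_ to _≈_; _+ᴹ_ to _+_; 0ᴹ to 0#)
    using (_*ₗ_)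
  open Tensor {R = K.commutativeRing} space space using (Tensors)
  infixl 7 _*_
  field
    _*_ : Carrier → Carrier → Carrier
    1#  : Carrier
    Δ   : Carrier → Tensors
    ε   : Carrier → K.Carrier
    S   : Carrier → Carrier

module _ (K : Field c ℓ) where
  private module K = Field K

  coordinateSpace : ℕ → LeftModule K.ring c ℓ
  coordinateSpace d = record
    { Carrierᴹ = Vector K.Carrier d
    ; _≈ᴹ_ = λ a b → ∀ i → a i K.≈ b i
    ; _+ᴹ_ = λ a b i → a i K.+ b i
    ; _*ₗ_ = λ k a i → k K.* a i
    ; 0ᴹ = λ _ → K.0#
    ; -ᴹ_ = λ a i → K.- a i
    ; isLeftModule = record
      { isLeftSemimodule = record
        { +ᴹ-isCommutativeMonoid = record
          { isMonoid = record
            { isSemigroup = record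
              { isMagma = record
                { isEquivalence = record
                  { refl = λ _ → K.refl
                  ; sym = λ p i → K.sym (p i)
                  ; trans = λ p q i → K.trans (p i) (q i)
                  }
                ; ∙-cong = λ p q i → K.+-cong (p i) (q i)
                }
              ; assoc = λ a b d i → K.+-assoc (a i) (b i) (d i)
              }
            ; identity = (λ a i → K.+-identityˡ (a i))
                       , (λ a i → K.+-identityʳ (a i))
            }
          ; comm = λ a b i → K.+-comm (a i) (b i)
          }
        ; isPreleftSemimodule = record
          { *ₗ-cong = λ p q i → K.*-cong p (q i)
          ; *ₗ-zeroˡ = λ a i → K.zeroˡ (a i)
          ; *ₗ-distribʳ = λ a j k i → K.distribʳ (a i) j k
          ; *ₗ-identityˡ = λ a i → K.*-identityˡ (a i)
          ; *ₗ-assoc = λ j k a i → K.*-assoc j k (a i)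
          ; *ₗ-zeroʳ = λ k i → K.zeroʳ k
          ; *ₗ-distribˡ = λ k a b i → K.distribˡ k (a i) (b i)
          }
        }
      ; -ᴹ‿cong = λ p i → K.-‿cong (p i)
      ; -ᴹ‿inverse = (λ a i → K.-‿inverseˡ (a i))
                   , (λ a i → K.-‿inverseʳ (a i))
      }
    }

  -- A vector a stands for Σ_r a_r t_r, and all the operations are extended
  -- linearly from the basis t_0, …, t_{pⁿ-1}.
  module DividedPower (p n : ℕ) where
    private
      q = p ℕ.^ n
      module H = LeftModule (coordinateSpace q)
      module ⊗ = Tensor {R = K.commutativeRing} (coordinateSpace q) (coordinateSpace q)
      open ⊗ using (Tensors; _⊗_)
      open RawMonoidDefs H.+ᴹ-rawMonoid using () renaming (_×_ to _×ᴴ_)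
      open SumProps H.+ᴹ-commutativeMonoid using () renaming (sum to sumᴴ)
      open SumProps (AbelianGroup.commutativeMonoid ⊗.abelianGroup)
        using () renaming (sum to sum⊗)
      open SumProps K.+-commutativeMonoid using () renaming (sum to sumᴷ)

    sign : ℕ → K.Carrier
    sign zero    = K.1#
    sign (suc r) = K.- sign r

    δ : ℕ → ℕ → K.Carrier
    δ i j = if i ≡ᵇ j then K.1# else K.0#

    -- For r ≥ pⁿ this is the zero vector, so that the formula
    -- t_i t_j = binom(i+j, j) t_{i+j} includes the case i + j ≥ pⁿ.
    t : ℕ → H.Carrierᴹ
    t r k = δ (toℕ k) r

    _*ᴴ_ : H.Carrierᴹ → H.Carrierᴹ → H.Carrierᴹ
    a *ᴴ b = sumᴴ λ i → sumᴴ λ j →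
      (a i K.* b j) H.*ₗ (((toℕ i ℕ.+ toℕ j) C toℕ j) ×ᴴ t (toℕ i ℕ.+ toℕ j))

    comultiplication : H.Carrierᴹ → Tensors
    comultiplication a = sum⊗ λ r → sum⊗ λ (j : Fin (suc (toℕ r))) →
      (a r H.*ₗ t (toℕ j)) ⊗ t (toℕ r ∸ toℕ j)

    counit : H.Carrierᴹ → K.Carrier
    counit a = sumᴷ λ r → a r K.* δ 0 (toℕ r)

    antipode : H.Carrierᴹ → H.Carrierᴹ
    antipode a = sumᴴ λ r → (a r K.* sign (toℕ r)) H.*ₗ t (toℕ r)

    𝒜 : RawHopfAlgebra K c ℓ
    𝒜 = record
      { space = coordinateSpace q
      ; _*_ = _*ᴴ_
      ; 1# = t 0
      ; Δ = comultiplication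
      ; ε = counit
      ; S = antipode
      }

open DividedPower public using (𝒜)

module _ {K : Field c ℓ} {L : Field c′ ℓ′} (E : Extension K L) where
  open Extension E using (asModule)
  private
    module K = Field K
    module L = Field L
    module V = LeftModule asModule
    module L⊗L = Tensor {R = K.commutativeRing} asModule asModule

  open LeftModuleMorphisms V.rawLeftModule V.rawLeftModule
    using (IsLeftModuleHomomorphism)

  End : Set (c ⊔ c′ ⊔ ℓ′)
  End = Σ (L.Carrier → L.Carrier) IsLeftModuleHomomorphism

  _≈End_ : End → End → Set (c′ ⊔ ℓ′)
  (f , _) ≈End (g , _) = ∀ x → f x L.≈ g x

  μ : L⊗L.Tensors → L.Carrier
  μ = L⊗L.extend L.+-abelianGroup L._*_

  module _ {m ℓm} (H : RawHopfAlgebra K m ℓm) where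
    private
      module H = RawHopfAlgebra H
      module H⊗H = Tensor {R = K.commutativeRing} H.space H.space
      module L⊗H = Tensor {R = K.commutativeRing} asModule H.space

    record Action : Set (c ⊔ c′ ⊔ ℓ′ ⊔ m ⊔ ℓm) where
      infixr 8 _·_
      field
        _·_      : H.Carrier → L.Carrier → L.Carrier
        ·-cong   : ∀ {h h′ x x′} → h H.≈ h′ → x L.≈ x′ → h · x L.≈ h′ · x′
        ·-addˡ   : ∀ h h′ x → (h H.+ h′) · x L.≈ h · x L.+ h′ · x
        ·-scaleˡ : ∀ k h x → (k H.*ₗ h) · x L.≈ k V.*ₗ (h · x)
        ·-addʳ   : ∀ h x x′ → h · (x L.+ x′) L.≈ h · x L.+ h · x′
        ·-scaleʳ : ∀ k h x → h · (k V.*ₗ x) L.≈ k V.*ₗ (h · x)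
        ·-*      : ∀ h h′ x → (h H.* h′) · x L.≈ h · (h′ · x)
        ·-1      : ∀ x → H.1# · x L.≈ x

      act⊗ : H⊗H.Tensors → L.Carrier → L.Carrier → L⊗L.Tensors
      act⊗ z s t = H⊗H.extend L⊗L.abelianGroup (λ h₁ h₂ → (h₁ · s) L⊗L.⊗ (h₂ · t)) z

      evaluate : L⊗H.Tensors → L.Carrier → L.Carrier
      evaluate z x = L⊗H.extend L.+-abelianGroup (λ s h → s L.* (h · x)) z

      private
        open AbelianGroupProps L.+-abelianGroup using (⁻¹-∙-comm; inverseʳ-unique)
        open import Algebra.Properties.CommutativeSemigroup L.*-commutativeSemigroup
          using (x∙yz≈y∙xz)
        open import Algebra.Properties.CommutativeSemigroup
          (AbelianGroup.commutativeSemigroup L.+-abelianGroup)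
          using () renaming (interchange to +-interchange)
        open RingProps L.ring using (-‿distribʳ-*)
        open Extension E using (ι; isHom)

        evaluate-cong : ∀ z {x y} → x L.≈ y → evaluate z x L.≈ evaluate z y
        evaluate-cong (s L⊗H.⊗ h) e = L.*-congˡ (·-cong (LeftModule.≈ᴹ-refl H.space) e)
        evaluate-cong (z L⊗H.⊕ w) e = L.+-cong (evaluate-cong z e) (evaluate-cong w e)
        evaluate-cong L⊗H.𝟎       e = L.refl
        evaluate-cong (L⊗H.⊖ z)   e = L.-‿cong (evaluate-cong z e)

        evaluate-add : ∀ z x y → evaluate z (x L.+ y) L.≈ evaluate z x L.+ evaluate z y
        evaluate-add (s L⊗H.⊗ h) x y =
          L.trans (L.*-congˡ (·-addʳ h x y)) (L.distribˡ s (h · x) (h · y))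
        evaluate-add (z L⊗H.⊕ w) x y =
          L.trans (L.+-cong (evaluate-add z x y) (evaluate-add w x y)) (+-interchange _ _ _ _)
        evaluate-add L⊗H.𝟎 x y = L.sym (L.+-identityˡ L.0#)
        evaluate-add (L⊗H.⊖ z) x y =
          L.trans (L.-‿cong (evaluate-add z x y)) (L.sym (⁻¹-∙-comm _ _))

        evaluate-scale : ∀ z k x → evaluate z (k V.*ₗ x) L.≈ k V.*ₗ evaluate z x
        evaluate-scale (s L⊗H.⊗ h) k x =
          L.trans (L.*-congˡ (·-scaleʳ k h x)) (x∙yz≈y∙xz s (ι k) (h · x))
        evaluate-scale (z L⊗H.⊕ w) k x =
          L.trans (L.+-cong (evaluate-scale z k x) (evaluate-scale w k x))
                  (L.sym (L.distribˡ _ _ _))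
        evaluate-scale L⊗H.𝟎 k x = L.sym (L.zeroʳ _)
        evaluate-scale (L⊗H.⊖ z) k x =
          L.trans (L.-‿cong (evaluate-scale z k x)) (-‿distribʳ-* _ _)

        evaluate-zero : ∀ z → evaluate z L.0# L.≈ L.0#
        evaluate-zero z =
          L.trans (evaluate-cong z (L.sym (L.zeroˡ L.0#)))
          (L.trans (evaluate-cong z (L.*-congʳ (L.sym 0#-homo)))
          (L.trans (evaluate-scale z K.0# L.0#)
          (L.trans (L.*-congʳ 0#-homo) (L.zeroˡ _))))
          where open RingMorphisms.IsRingHomomorphism isHom using (0#-homo)

        evaluate-neg : ∀ z x → evaluate z (L.- x) L.≈ L.- evaluate z x
        evaluate-neg z x = inverseʳ-unique _ _
          (L.trans (L.sym (evaluate-add z x (L.- x)))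
          (L.trans (evaluate-cong z (L.-‿inverseʳ x)) (evaluate-zero z)))

      canonicalMap : L⊗H.Tensors → End
      canonicalMap z = evaluate z , record
        { +ᴹ-isGroupHomomorphism = record
          { isMonoidHomomorphism = record
            { isMagmaHomomorphism = record
              { isRelHomomorphism = record { cong = evaluate-cong z }
              ; homo = evaluate-add z
              }
            ; ε-homo = evaluate-zero z
            }
          ; ⁻¹-homo = evaluate-neg z
          }
        ; *ₗ-homo = evaluate-scale z
        }

      record IsModuleAlgebra : Set (c ⊔ c′ ⊔ ℓ′ ⊔ m) where
        field
          act-* : ∀ h s t → h · (s L.* t) L.≈ μ (act⊗ (H.Δ h) s t)
          act-1 : ∀ h → h · L.1# L.≈ H.ε h V.*ₗ L.1#

      record IsHopfGalois : Set (c ⊔ c′ ⊔ ℓ′ ⊔ m ⊔ ℓm) where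
        field
          isModuleAlgebra : IsModuleAlgebra
          bijective       : Bijective L⊗H._≈⊗_ _≈End_ canonicalMap

_≡_[mod_] : ℤ → ℤ → ℕ → Set
x ≡ y [mod m ] = + m ℤ.∣ (x ℤ.- y)

-- The index i ∈ {1, …, n} is represented by the element of Fin n whose
-- value is i - 1, so that n - i becomes place i.
place : ∀ {n} → Fin n → ℕ
place {n} i = n ∸ suc (toℕ i)

module _ {p : ℕ} (p-prime : Prime p) where
  private instance
    p≢0 = prime⇒nonZero p-prime

  -- The coefficient of p ^ j in the base p expansion of s.
  digit : ℕ → ℕ → ℕ
  digit j s = (s / p ℕ.^ j) % p
    where instance p^j≢0 = m^n≢0 p j

  𝔟 : ∀ {n} → Vector ℤ n → ℕ → ℤ
  𝔟 b s = sum λ i → + (digit (place i) s ℕ.* p ℕ.^ place i) ℤ.* b i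
    where open SumProps ℤ.+-0-commutativeMonoid using (sum)

  module _ {K : Field c ℓ} {L : Field c′ ℓ′}
           (vK : NormalizedValuation K) (vL : NormalizedValuation L)
           {E : Extension K L} {m ℓm} {A : RawHopfAlgebra K m ℓm}
           (action : Action E A) where
    private
      module K  = Field K
      module L  = Field L
      module A  = RawHopfAlgebra A
      module vK = NormalizedValuation vK
      module vL = NormalizedValuation vL
    open Extension E using (ι; InBase)
    open Action action using (_·_)

    record Scaffold∞ {n : ℕ} (b : Vector ℤ n) : Set (c ⊔ ℓ ⊔ c′ ⊔ ℓ′ ⊔ m) where
      field
        b-coprime : ∀ i → Coprime (b i) (+ p)
        -- No choice is involved in 𝔞: as the b i are prime to p, the map 𝔟
        -- is a bijection from {0, …, pⁿ-1} onto the residues modulo pⁿ.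
        𝔞         : ℤ → Fin (p ℕ.^ n)
        𝔟𝔞        : ∀ t → 𝔟 b (toℕ (𝔞 t)) ≡ ℤ.- t [mod p ℕ.^ n ]
        λ′        : ℤ → L.Carrier
        v-λ       : ∀ t → vL.v (λ′ t) ≡ [ t ]
        λ-ratio   : ∀ t₁ t₂ → t₁ ≡ t₂ [mod p ℕ.^ n ] →
                    InBase (λ′ t₁ L.* (λ′ t₂) L.⁻¹)
        Ψ         : Fin n → A.Carrier
        Ψ-1       : ∀ i → Ψ i · L.1# L.≈ L.0#
        Ψ-λ       : ∀ i t → ∃[ u ] vK.IsUnitOfValuationRing u ×
                    (1 ℕ.≤ digit (place i) (toℕ (𝔞 t)) →
                       Ψ i · λ′ t L.≈ ι u L.* λ′ (t ℤ.+ + (p ℕ.^ place i) ℤ.* b i)) ×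
                    (digit (place i) (toℕ (𝔞 t)) ≡ 0 →
                       Ψ i · λ′ t L.≈ L.0#)

{-# OPTIONS --safe #-}
-- Take x in L with v(x) = -b and write q = pⁿ.  The powers x^k, k < q, have valuations distinct
-- modulo q, hence form a K-basis of L.  If x^q lies in K, the Hasse derivatives
-- D_r(x^s) = binom(s, r) x^{s-r}, r < q, are well defined on L, and letting t_r act as D_r makes L
-- an 𝒜(n)-module algebra; it is Hopf Galois because the matrix (D_r(x^k)) is unitriangular.
-- Taking Ψ_i = t_{p^{n-i}} and λ_t = π^f x^{𝔞(t)}, where q f - b 𝔞(t) = t, the congruence
-- binom(s, p^j) ≡ ⌊s / p^j⌋ ≡ s_{(j)} (mod p) gives the scaffold.
--
-- That x^q lies in K is shown by valuations.  By induction on i ≤ n, every nonzero element of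
-- K[x^{p^i}] has valuation divisible by p^i.  Otherwise some z in K[x^{p^{i+1}}] has valuation p^i u
-- with p ∤ u, so the x^r z^h (r < p^i, h < p^{n-i}) form a basis, and expanding x^{p^i} in it gives
-- x^{p^i} ∈ K[z] ⊆ K[x^{p^{i+1}}]; applying Frobenius repeatedly, x^{p^i} ∈ K[x^{p^m}] = K for m
-- large, contradicting v(x^{p^i}) = -b p^i.  For i = n, the expansion of x^q in the basis x^k must
-- then reduce to its constant term.
module Submission where

open import Defs
open import Algebra.Bundles using (AbelianGroup; CommutativeMonoid; CommutativeRing)
open import Algebra.Module.Bundles using (LeftModule)
open import Algebra.Module.Morphism.Structures using (module LeftModuleMorphisms)
open import Algebra.Morphism.Structures using (module RingMorphisms)
import Algebra.Properties.AbelianGroup as AbelianGroupProps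
import Algebra.Properties.CommutativeMonoid.Mult as CommutativeMonoidMult
import Algebra.Properties.CommutativeMonoid.Sum as CommutativeMonoidSum
import Algebra.Properties.CommutativeSemigroup as CommutativeSemigroupProps
import Algebra.Properties.CommutativeSemiring.Binomial as BinomialTheorem
import Algebra.Properties.Group as GroupProps
import Algebra.Properties.Ring as RingProps
import Algebra.Properties.Semiring.Exp as ExpProps
import Algebra.Properties.Semiring.Mult as MultProps
import Algebra.Properties.Semiring.Sum as SemiringSum
open import Data.Fin.Base using (Fin; toℕ; fromℕ<; zero; suc; punchIn)
import Data.Fin.Properties as Fin
open import Data.Fin.Properties
  using (any?; suc-injective; toℕ-injective; toℕ<n; toℕ-inject₁; toℕ-fromℕ; toℕ-fromℕ<)
open import Data.Integer.Base as ℤ using (ℤ; +_; -[1+_]; 0ℤ; 1ℤ)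
import Data.Integer.Coprimality as ℤ
import Data.Integer.Divisibility as ℤ
import Data.Integer.Divisibility.Signed as Signed
open import Data.Integer.DivMod using (_/ℕ_; _%ℕ_; n%ℕd<d; a≡a%ℕn+[a/ℕn]*n)
import Data.Integer.Properties as ℤ
open import Data.Integer.Tactic.RingSolver using () renaming (solve-∀ to ℤ-solve-∀)
open import Data.Nat.Base as ℕ using (ℕ; zero; suc; NonZero; _∸_)
open import Data.Nat.Combinatorics
  using (_C_; k>n⇒nCk≡0; nCk≡n!/k![n-k]!; k![n∸k]!∣n!; nCk≡nC[n∸k]; nCn≡1; nCk+nC[k+1]≡[n+1]C[k+1])
open import Data.Nat.Coprimality as ℕ using (Coprime; coprime-divisor)
open import Data.Nat.DivMod
  using (_/_; _%_; /-congʳ; n/1≡n; m%n<n; m≡m%n+[m/n]*n; m<n*o⇒m/o<n; m/n*n≡m; m<n⇒m/n≡0; m<n⇒m%n≡m; m/n/o≡m/[n*o])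
open import Data.Nat.Divisibility as ℕ using (_∣_)
open import Data.Nat.GCD using (gcd; module Bézout)
open import Data.Nat.Primality using (Prime; prime⇒nonZero; prime⇒nonTrivial; prime⇒irreducible)
open import Data.Nat.Properties as ℕ using (m^n≢0)
open import Data.Nat.Tactic.RingSolver using () renaming (solve-∀ to ℕ-solve-∀)
open import Data.Product.Base using (Σ; _×_; ∃-syntax; _,_; proj₁; proj₂)
open import Data.Sum.Base using (_⊎_; inj₁; inj₂)
open import Data.Vec.Functional using (Vector; insertAt)
open import Data.Vec.Functional.Properties using (insertAt-lookup; insertAt-punchIn)
open import Function.Base using (_∘_)
open import Function.Bundles using (module Equivalence)
open import Level using (_⊔_)
open import Relation.Binary.Construct.Add.Supremum.NonStrict ℤ._≤_ using (_≤⁺_; [_]; _≤⊤⁺; ≤⁺-trans)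
open import Relation.Binary.Definitions using (tri<; tri≈; tri>)
open import Relation.Binary.PropositionalEquality as ≡ using (_≡_; _≢_; cong; cong₂; subst; subst₂)
import Relation.Binary.Reasoning.Setoid as SetoidReasoning
open import Relation.Nullary using (¬_; ¬?; Dec; yes; no; contradiction; decidable-stable)
open import Relation.Nullary.Construct.Add.Supremum using (_⁺; [_]; ⊤⁺)

-- Binomial coefficients, congruences and digits

-- The classical reason for x^q ∈ K is that x generates L, so that its minimal polynomial is X^q -
-- c. Here a subring K[y] is only an inductively generated set of elements, with no dimension or
-- minimal polynomial attached, and valuations modulo powers of p take over from degrees: as the
-- ramification index is q, scalars from K contribute only multiples of q, so elements with
-- valuations distinct modulo q are independent, and q of them form a basis. In the key step the
-- coefficients of x^r, r < p^i, lie in K[z], which is contained in K[x^(p^i)], so by induction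
-- their valuations are multiples of p^i; the valuations of the x^r are distinct modulo p^i, and
-- only r = 0 can occur in the expansion of x^(p^i). The sign in v(x) = -b comes from D_r, which
-- lowers the exponent of x by r: the valuation of a term rises by r b whenever its binomial
-- coefficient is a unit, as the shift parameters demand.

module Arithmetic where
  open import Data.Nat.Base using (_<_; _≤_; _^_; _!)
  open ≡ using (refl; sym; trans)

  coprime-*ʳ : ∀ {m n o} → Coprime m n → Coprime m o → Coprime m (n ℕ.* o)
  coprime-*ʳ {n = n} c c′ (d∣m , d∣no) =
    c′ (d∣m , coprime-divisor {n = n} (λ (e∣d , e∣n) → c (ℕ.∣-trans e∣d d∣m , e∣n)) d∣no)

  coprime-^ʳ : ∀ {m n} k → Coprime m n → Coprime m (n ^ k)
  coprime-^ʳ zero    c (_ , d∣1) = ℕ.∣1⇒≡1 d∣1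
  coprime-^ʳ (suc k) c = coprime-*ʳ c (coprime-^ʳ k c)

  prime∤⇒coprime : ∀ {p} m → Prime p → ¬ p ∣ m → Coprime m p
  prime∤⇒coprime m p-prime p∤m (d∣m , d∣p) with prime⇒irreducible p-prime d∣p
  ... | inj₁ d≡1  = d≡1
  ... | inj₂ refl = contradiction d∣m p∤m

  choose-zero : ∀ n → n C 0 ≡ 1
  choose-zero n = trans (nCk≡nC[n∸k] {0} {n} ℕ.z≤n) (nCn≡1 n)

  choose-factorial : ∀ {n k} → k ≤ n → (n C k) ℕ.* (k ! ℕ.* (n ∸ k) !) ≡ n !
  choose-factorial {n} {k} k≤n =
    trans (cong (ℕ._* (k ! ℕ.* (n ∸ k) !)) (nCk≡n!/k![n-k]! k≤n)) (m/n*n≡m (k![n∸k]!∣n! k≤n))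
    where instance _ = k ℕ.!* (n ∸ k) !≢0

  -- Multiplied by k! (n-k)!, both sides become (n+1)!. This absorption identity is the input to the
  -- divisibility of `(p ^ m) C k` by p.
  [1+k]*choose[1+n,1+k] : ∀ n k → suc k ℕ.* (suc n C suc k) ≡ suc n ℕ.* (n C k)
  [1+k]*choose[1+n,1+k] n k with k ℕ.≤? n
  ... | no k≰n = begin
      suc k ℕ.* (suc n C suc k) ≡⟨ cong (suc k ℕ.*_) (k>n⇒nCk≡0 (ℕ.s<s (ℕ.≰⇒> k≰n))) ⟩
      suc k ℕ.* 0               ≡⟨ ℕ.*-zeroʳ k ⟩
      0                         ≡⟨ ℕ.*-zeroʳ n ⟨
      suc n ℕ.* 0               ≡⟨ cong (suc n ℕ.*_) (k>n⇒nCk≡0 (ℕ.≰⇒> k≰n)) ⟨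
      suc n ℕ.* (n C k)         ∎
      where open ≡.≡-Reasoning
  ... | yes k≤n = ℕ.*-cancelʳ-≡ _ _ (k ! ℕ.* (n ∸ k) !) (begin
      suc k ℕ.* (suc n C suc k) ℕ.* (k ! ℕ.* (n ∸ k) !)
        ≡⟨ rearrange (suc k) (suc n C suc k) (k !) ((n ∸ k) !) ⟩
      (suc n C suc k) ℕ.* ((suc k) ! ℕ.* (n ∸ k) !)
        ≡⟨ choose-factorial (ℕ.s≤s k≤n) ⟩
      suc n ℕ.* n !
        ≡⟨ cong (suc n ℕ.*_) (choose-factorial k≤n) ⟨
      suc n ℕ.* ((n C k) ℕ.* (k ! ℕ.* (n ∸ k) !))
        ≡⟨ ℕ.*-assoc (suc n) (n C k) _ ⟨
      suc n ℕ.* (n C k) ℕ.* (k ! ℕ.* (n ∸ k) !) ∎)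
    where
    instance _ = k ℕ.!* (n ∸ k) !≢0
    open ≡.≡-Reasoning
    rearrange : ∀ a b c d → a ℕ.* b ℕ.* (c ℕ.* d) ≡ b ℕ.* (a ℕ.* c ℕ.* d)
    rearrange = ℕ-solve-∀

  -- Both sides are s! / (j! i! (s-i-j)!), and both vanish for i + j > s, where the truncated
  -- subtraction does no harm. This is the coefficient identity behind the composition of Hasse
  -- derivatives.
  choose-choose : ∀ s i j →
    (s C j) ℕ.* ((s ∸ j) C i) ≡ ((i ℕ.+ j) C j) ℕ.* (s C (i ℕ.+ j))
  choose-choose s i j with i ℕ.+ j ℕ.≤? s
  ... | no i+j≰s = trans (left (j ℕ.≤? s)) (sym right)
    where
    s<i+j = ℕ.≰⇒> i+j≰s
    right : ((i ℕ.+ j) C j) ℕ.* (s C (i ℕ.+ j)) ≡ 0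
    right = trans (cong (((i ℕ.+ j) C j) ℕ.*_) (k>n⇒nCk≡0 s<i+j)) (ℕ.*-zeroʳ ((i ℕ.+ j) C j))
    left : Dec (j ≤ s) → (s C j) ℕ.* ((s ∸ j) C i) ≡ 0
    left (no j≰s)  = cong (ℕ._* ((s ∸ j) C i)) (k>n⇒nCk≡0 (ℕ.≰⇒> j≰s))
    left (yes j≤s) = trans (cong ((s C j) ℕ.*_) (k>n⇒nCk≡0 (ℕ.+-cancelʳ-< j (s ∸ j) i
      (subst (_< i ℕ.+ j) (sym (ℕ.m∸n+n≡m j≤s)) s<i+j)))) (ℕ.*-zeroʳ (s C j))
  ... | yes i+j≤s = ℕ.*-cancelʳ-≡ _ _ (j ! ℕ.* (i ! ℕ.* r !)) (begin
      (s C j) ℕ.* ((s ∸ j) C i) ℕ.* (j ! ℕ.* (i ! ℕ.* r !))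
        ≡⟨ rearrange₁ (s C j) ((s ∸ j) C i) (j !) (i !) (r !) ⟩
      (s C j) ℕ.* (j ! ℕ.* (((s ∸ j) C i) ℕ.* (i ! ℕ.* r !)))
        ≡⟨ cong (λ z → (s C j) ℕ.* (j ! ℕ.* (((s ∸ j) C i) ℕ.* (i ! ℕ.* z !)))) r≡ ⟩
      (s C j) ℕ.* (j ! ℕ.* (((s ∸ j) C i) ℕ.* (i ! ℕ.* (s ∸ j ∸ i) !)))
        ≡⟨ cong (λ z → (s C j) ℕ.* (j ! ℕ.* z)) (choose-factorial i≤s∸j) ⟩
      (s C j) ℕ.* (j ! ℕ.* (s ∸ j) !)
        ≡⟨ choose-factorial (ℕ.≤-trans (ℕ.m≤n+m j i) i+j≤s) ⟩
      s !
        ≡⟨ choose-factorial i+j≤s ⟨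
      (s C (i ℕ.+ j)) ℕ.* ((i ℕ.+ j) ! ℕ.* r !)
        ≡⟨ cong (λ z → (s C (i ℕ.+ j)) ℕ.* (z ℕ.* r !)) (choose-factorial (ℕ.m≤n+m j i)) ⟨
      (s C (i ℕ.+ j)) ℕ.* (((i ℕ.+ j) C j) ℕ.* (j ! ℕ.* (i ℕ.+ j ∸ j) !) ℕ.* r !)
        ≡⟨ cong (λ z → (s C (i ℕ.+ j)) ℕ.* (((i ℕ.+ j) C j) ℕ.* (j ! ℕ.* z !) ℕ.* r !)) (ℕ.m+n∸n≡m i j) ⟩
      (s C (i ℕ.+ j)) ℕ.* (((i ℕ.+ j) C j) ℕ.* (j ! ℕ.* i !) ℕ.* r !)
        ≡⟨ rearrange₂ (s C (i ℕ.+ j)) ((i ℕ.+ j) C j) (j !) (i !) (r !) ⟩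
      ((i ℕ.+ j) C j) ℕ.* (s C (i ℕ.+ j)) ℕ.* (j ! ℕ.* (i ! ℕ.* r !)) ∎)
    where
    r = s ∸ (i ℕ.+ j)
    r≡ : r ≡ s ∸ j ∸ i
    r≡ = trans (cong (s ∸_) (ℕ.+-comm i j)) (sym (ℕ.∸-+-assoc s j i))
    i≤s∸j : i ≤ s ∸ j
    i≤s∸j = ℕ.m+n≤o⇒m≤o∸n i i+j≤s
    instance _ = ℕ.m*n≢0 (j !) (i ! ℕ.* r !) {{j ℕ.!≢0}} {{i ℕ.!* r !≢0}}
    open ≡.≡-Reasoning
    rearrange₁ : ∀ a b c d e → a ℕ.* b ℕ.* (c ℕ.* (d ℕ.* e)) ≡ a ℕ.* (c ℕ.* (b ℕ.* (d ℕ.* e)))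
    rearrange₁ = ℕ-solve-∀
    rearrange₂ : ∀ a b c d e → a ℕ.* (b ℕ.* (c ℕ.* d) ℕ.* e) ≡ b ℕ.* a ℕ.* (c ℕ.* (d ℕ.* e))
    rearrange₂ = ℕ-solve-∀

  -- By absorption, `p ^ m` divides k times the binomial coefficient. Were the latter prime to p,
  -- `p ^ m` would divide k, which is positive and smaller.
  prime-power∣choose : ∀ {p} → Prime p → ∀ m k → 0 < k → k < p ^ m → p ∣ (p ^ m) C k
  prime-power∣choose {p} p-prime m (suc k) _ k<pᵐ with p ℕ.∣? ((p ^ m) C suc k)
  ... | yes p∣choose = p∣choose
  ... | no  p∤choose = contradiction
      (coprime-divisor {n = (p ^ m) C suc k}
        (ℕ.sym (coprime-^ʳ m (prime∤⇒coprime _ p-prime p∤choose)))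
        (subst (p ^ m ∣_) (ℕ.*-comm (suc k) _) (pᵐ∣ (p ^ m) k<pᵐ)))
      (ℕ.>⇒∤ k<pᵐ)
    where
    pᵐ∣ : ∀ q → suc k < q → q ∣ suc k ℕ.* (q C suc k)
    pᵐ∣ (suc q) _ = subst (suc q ∣_) (sym ([1+k]*choose[1+n,1+k] q k)) (ℕ.m∣m*n (q C k))

  ∣-⇒≡ : ∀ {m} h k → h < m → k < m → + m ℤ.∣ + h ℤ.- + k → h ≡ k
  ∣-⇒≡ {m} h k h<m k<m m∣ = by-order (ℕ.≤-total k h)
    where
    ordered : ∀ h k → h < m → k ≤ h → + m ℤ.∣ + h ℤ.- + k → h ≡ k
    ordered h k h<m k≤h m∣ with h ∸ k in eq
    ... | zero  = ℕ.≤-antisym (ℕ.m∸n≡0⇒m≤n eq) k≤h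
    ... | suc d = contradiction
      (subst (m ∣_) (trans (cong ℤ.∣_∣ (trans (ℤ.m-n≡m⊖n h k) (ℤ.⊖-≥ k≤h))) eq) m∣)
      (ℕ.>⇒∤ (ℕ.≤-<-trans (subst (_≤ h) eq (ℕ.m∸n≤m h k)) h<m))
    by-order : k ≤ h ⊎ h ≤ k → h ≡ k
    by-order (inj₁ k≤h) = ordered h k h<m k≤h m∣
    by-order (inj₂ h≤k) =
      sym (ordered k h k<m h≤k (subst (m ∣_) (ℤ.∣i-j∣≡∣j-i∣ (+ h) (+ k)) m∣))

  coprime-∣-⇒≡ : ∀ {m} u h k → ℤ.Coprime (+ m) u → h < m → k < m →
                 + m ℤ.∣ u ℤ.* + h ℤ.- u ℤ.* + k → h ≡ k
  coprime-∣-⇒≡ {m} u h k m⊥u h<m k<m m∣ = ∣-⇒≡ h k h<m k<m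
    (ℤ.coprime-divisor (+ m) u (+ h ℤ.- + k) m⊥u (subst (+ m ℤ.∣_) (factor u (+ h) (+ k)) m∣))
    where
    factor : ∀ u h k → u ℤ.* h ℤ.- u ℤ.* k ≡ u ℤ.* (h ℤ.- k)
    factor = ℤ-solve-∀

  -- With v(x) = β and v(z) = P u, this is the valuation of x^(k mod P) z^(k div P): one index k
  -- encodes both exponents by division with remainder.
  weight : (P : ℕ) .{{_ : NonZero P}} (β u : ℤ) → ℕ → ℤ
  weight P β u k = β ℤ.* + (k % P) ℤ.+ + P ℤ.* u ℤ.* + (k / P)

  -- Modulo P only β (k mod P) survives, and β is invertible there, so the remainders agree. What is
  -- left is P u times the difference of the quotients, and cancelling P gives a congruence modulo
  -- Q, where u is invertible.
  weight-injective : ∀ P Q .{{_ : NonZero P}} β u → ℤ.Coprime (+ P) β → ℤ.Coprime (+ Q) u →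
                     ∀ k l → k < P ℕ.* Q → l < P ℕ.* Q →
                     + (P ℕ.* Q) ℤ.∣ weight P β u k ℤ.- weight P β u l → k ≡ l
  weight-injective P Q β u P⊥β Q⊥u k l k<PQ l<PQ PQ∣ = begin
    k                         ≡⟨ m≡m%n+[m/n]*n k P ⟩
    k % P ℕ.+ k / P ℕ.* P     ≡⟨ cong₂ (λ r h → r ℕ.+ h ℕ.* P) r≡ h≡ ⟩
    l % P ℕ.+ l / P ℕ.* P     ≡⟨ m≡m%n+[m/n]*n l P ⟨
    l                         ∎
    where
    open ≡.≡-Reasoning
    expand : ∀ β P u r h r′ h′ → (β ℤ.* r ℤ.+ P ℤ.* u ℤ.* h) ℤ.- (β ℤ.* r′ ℤ.+ P ℤ.* u ℤ.* h′) ≡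
             (β ℤ.* r ℤ.- β ℤ.* r′) ℤ.+ P ℤ.* (u ℤ.* h ℤ.- u ℤ.* h′)
    expand = ℤ-solve-∀
    PQ∣′ : + P ℤ.* + Q Signed.∣ weight P β u k ℤ.- weight P β u l
    PQ∣′ = subst (Signed._∣ (weight P β u k ℤ.- weight P β u l)) (ℤ.pos-* P Q) (Signed.∣ᵤ⇒∣ PQ∣)
    PQ∣″ : + P ℤ.* + Q Signed.∣ (β ℤ.* + (k % P) ℤ.- β ℤ.* + (l % P)) ℤ.+
                      + P ℤ.* (u ℤ.* + (k / P) ℤ.- u ℤ.* + (l / P))
    PQ∣″ = subst (+ P ℤ.* + Q Signed.∣_) (expand β (+ P) u (+ (k % P)) (+ (k / P)) (+ (l % P)) (+ (l / P))) PQ∣′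
    r≡ : k % P ≡ l % P
    r≡ = coprime-∣-⇒≡ β (k % P) (l % P) P⊥β (m%n<n k P) (m%n<n l P)
      (Signed.∣⇒∣ᵤ (Signed.∣m+n∣n⇒∣m {m = β ℤ.* + (k % P) ℤ.- β ℤ.* + (l % P)} {n = + P ℤ.* (u ℤ.* + (k / P) ℤ.- u ℤ.* + (l / P))}
        (Signed.∣-trans (Signed.∣m⇒∣m*n {m = + P} (+ Q) Signed.∣-refl) PQ∣″)
        (Signed.∣m⇒∣m*n {m = + P} (u ℤ.* + (k / P) ℤ.- u ℤ.* + (l / P)) Signed.∣-refl)))
    PQ∣h : + P ℤ.* + Q Signed.∣ + P ℤ.* (u ℤ.* + (k / P) ℤ.- u ℤ.* + (l / P))
    PQ∣h = Signed.∣m+n∣m⇒∣n {m = β ℤ.* + (k % P) ℤ.- β ℤ.* + (l % P)} PQ∣″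
      (subst (+ P ℤ.* + Q Signed.∣_)
        (sym (trans (cong (λ r → β ℤ.* + r ℤ.- β ℤ.* + (l % P)) r≡) (ℤ.i≡j⇒i-j≡0 {β ℤ.* + (l % P)} refl)))
        (Signed.∣ᵤ⇒∣ (_ ℕ.∣0)))
    h≡ : k / P ≡ l / P
    h≡ = coprime-∣-⇒≡ u (k / P) (l / P) Q⊥u (m<n*o⇒m/o<n (subst (k <_) (ℕ.*-comm P Q) k<PQ)) (m<n*o⇒m/o<n (subst (l <_) (ℕ.*-comm P Q) l<PQ))
      (ℤ.*-cancelˡ-∣ (+ P) {+ Q} (Signed.∣⇒∣ᵤ PQ∣h))

  inverse-mod : ∀ b m → Coprime b m → ∃[ β ] + m Signed.∣ + b ℤ.* β ℤ.- 1ℤ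
  inverse-mod b m b⊥m with ℕ.coprime-Bézout b⊥m
  ... | Bézout.+- x y eq = + x , Signed.divides (+ y) (begin
      + b ℤ.* + x ℤ.- 1ℤ           ≡⟨ cong (ℤ._- 1ℤ) (ℤ.pos-* b x) ⟨
      + (b ℕ.* x) ℤ.- 1ℤ           ≡⟨ cong (λ z → + z ℤ.- 1ℤ) (trans (ℕ.*-comm b x) (sym eq)) ⟩
      + (1 ℕ.+ y ℕ.* m) ℤ.- 1ℤ     ≡⟨⟩
      + (y ℕ.* m)                  ≡⟨ ℤ.pos-* y m ⟩
      + y ℤ.* + m                  ∎)
    where open ≡.≡-Reasoning
  ... | Bézout.-+ x y eq = ℤ.- + x , Signed.divides (ℤ.- + y) (begin
      + b ℤ.* (ℤ.- + x) ℤ.- 1ℤ     ≡⟨ rearrange (+ b) (+ x) ⟩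
      ℤ.- (1ℤ ℤ.+ + x ℤ.* + b)     ≡⟨ cong (λ z → ℤ.- (1ℤ ℤ.+ z)) (ℤ.pos-* x b) ⟨
      ℤ.- (+ (1 ℕ.+ x ℕ.* b))      ≡⟨ cong (λ z → ℤ.- (+ z)) eq ⟩
      ℤ.- (+ (y ℕ.* m))            ≡⟨ cong ℤ.-_ (ℤ.pos-* y m) ⟩
      ℤ.- (+ y ℤ.* + m)            ≡⟨ ℤ.neg-distribˡ-* (+ y) (+ m) ⟩
      ℤ.- + y ℤ.* + m              ∎)
    where
    open ≡.≡-Reasoning
    rearrange : ∀ b x → b ℤ.* (ℤ.- x) ℤ.- 1ℤ ≡ ℤ.- (1ℤ ℤ.+ x ℤ.* b)
    rearrange = ℤ-solve-∀

  module _ {p : ℕ} (p-prime : Prime p) where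
    private
      instance
        p≢0 = prime⇒nonZero p-prime

      _^≢0 : ∀ n → NonZero (p ^ n)
      n ^≢0 = m^n≢0 p n

    floor-step : ∀ n s → digit p-prime n s ℕ.* p ^ n ℕ.+ (s / p ^ suc n) {{suc n ^≢0}} ℕ.* p ^ suc n ≡
                 (s / p ^ n) {{n ^≢0}} ℕ.* p ^ n
    floor-step n s = begin
      t % p ℕ.* p ^ n ℕ.+ (s / p ^ suc n) ℕ.* p ^ suc n  ≡⟨ cong (λ z → t % p ℕ.* p ^ n ℕ.+ z ℕ.* p ^ suc n) t/p≡ ⟨
      t % p ℕ.* p ^ n ℕ.+ t / p ℕ.* (p ℕ.* p ^ n)        ≡⟨ rearrange (t % p) (p ^ n) (t / p) p ⟩
      (t % p ℕ.+ t / p ℕ.* p) ℕ.* p ^ n                  ≡⟨ cong (ℕ._* p ^ n) (m≡m%n+[m/n]*n t p) ⟨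
      t ℕ.* p ^ n                                        ∎
      where
      open ≡.≡-Reasoning
      instance
        _ = n ^≢0
        _ = suc n ^≢0
        _ = ℕ.m*n≢0 (p ^ n) p
      t = s / p ^ n
      t/p≡ : t / p ≡ s / p ^ suc n
      t/p≡ = trans (m/n/o≡m/[n*o] s (p ^ n) p) (/-congʳ (ℕ.*-comm (p ^ n) p))
      rearrange : ∀ a q c p → a ℕ.* q ℕ.+ c ℕ.* (p ℕ.* q) ≡ (a ℕ.+ c ℕ.* p) ℕ.* q
      rearrange = ℕ-solve-∀

    -- The part of s above the lowest n digits is kept as a second summand, so that the claim holds
    -- for every s and the induction on n can trade one digit between the two; for s < p^n that part
    -- is zero.
    𝔟-const-+ : ∀ n b s → 𝔟 p-prime {n} (λ _ → b) s ℤ.+ + ((s / p ^ n) {{n ^≢0}} ℕ.* p ^ n) ℤ.* b ≡ + s ℤ.* b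
    𝔟-const-+ zero b s = trans (ℤ.+-identityˡ _) (cong (λ z → + z ℤ.* b) (trans (ℕ.*-identityʳ (s / 1)) (n/1≡n s)))
    𝔟-const-+ (suc n) b s = begin
      + d ℤ.* b ℤ.+ 𝔟 p-prime {n} (λ _ → b) s ℤ.+ + e ℤ.* b
        ≡⟨ rearrange (+ d) b (𝔟 p-prime {n} (λ _ → b) s) (+ e) ⟩
      𝔟 p-prime {n} (λ _ → b) s ℤ.+ + (d ℕ.+ e) ℤ.* b
        ≡⟨ cong (λ z → 𝔟 p-prime {n} (λ _ → b) s ℤ.+ + z ℤ.* b) (floor-step n s) ⟩
      𝔟 p-prime {n} (λ _ → b) s ℤ.+ + ((s / p ^ n) {{n ^≢0}} ℕ.* p ^ n) ℤ.* b
        ≡⟨ 𝔟-const-+ n b s ⟩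
      + s ℤ.* b ∎
      where
      open ≡.≡-Reasoning
      d = digit p-prime n s ℕ.* p ^ n
      e = (s / p ^ suc n) {{suc n ^≢0}} ℕ.* p ^ suc n
      rearrange : ∀ d b z e → d ℤ.* b ℤ.+ z ℤ.+ e ℤ.* b ≡ z ℤ.+ (d ℤ.+ e) ℤ.* b
      rearrange = ℤ-solve-∀

    𝔟-const : ∀ n b s → s < p ^ n → 𝔟 p-prime {n} (λ _ → b) s ≡ + s ℤ.* b
    𝔟-const n b s s<pⁿ = begin
      𝔟 p-prime {n} (λ _ → b) s
        ≡⟨ ℤ.+-identityʳ _ ⟨
      𝔟 p-prime {n} (λ _ → b) s ℤ.+ + 0 ℤ.* b
        ≡⟨ cong (λ z → 𝔟 p-prime {n} (λ _ → b) s ℤ.+ + (z ℕ.* p ^ n) ℤ.* b) (m<n⇒m/n≡0 {{n ^≢0}} s<pⁿ) ⟨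
      𝔟 p-prime {n} (λ _ → b) s ℤ.+ + ((s / p ^ n) {{n ^≢0}} ℕ.* p ^ n) ℤ.* b
        ≡⟨ 𝔟-const-+ n b s ⟩
      + s ℤ.* b ∎
      where open ≡.≡-Reasoning

    digit≡0 : ∀ j s → s < p ^ j → digit p-prime j s ≡ 0
    digit≡0 j s s<pʲ = trans (cong (_% p) (m<n⇒m/n≡0 {{j ^≢0}} s<pʲ)) (m<n⇒m%n≡m (ℕ.>-nonZero⁻¹ p))

  *-+-≡⇒≡[mod] : ∀ q i j x y → + q ℤ.* i ℤ.+ x ≡ + q ℤ.* j ℤ.+ y → x ≡ y [mod q ]
  *-+-≡⇒≡[mod] q i j x y same = Signed.∣⇒∣ᵤ (Signed.divides (j ℤ.- i) (begin
    x ℤ.- y                                                           ≡⟨ split (+ q) i j x y ⟩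
    (+ q ℤ.* i ℤ.+ x) ℤ.- (+ q ℤ.* j ℤ.+ y) ℤ.+ (j ℤ.- i) ℤ.* + q     ≡⟨ cong (ℤ._+ (j ℤ.- i) ℤ.* + q) (ℤ.i≡j⇒i-j≡0 same) ⟩
    0ℤ ℤ.+ (j ℤ.- i) ℤ.* + q                                          ≡⟨ ℤ.+-identityˡ _ ⟩
    (j ℤ.- i) ℤ.* + q                                                 ∎))
    where
    open ≡.≡-Reasoning
    split : ∀ q i j x y → x ℤ.- y ≡ (q ℤ.* i ℤ.+ x) ℤ.- (q ℤ.* j ℤ.+ y) ℤ.+ (j ℤ.- i) ℤ.* q
    split = ℤ-solve-∀

  ℤ-quotient-unique : ∀ q .{{_ : NonZero q}} k k′ {i i′} → i ≡ k ℤ.* + q → i′ ≡ k′ ℤ.* + q → i ≡ i′ → k ≡ k′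
  ℤ-quotient-unique q k k′ i≡ i′≡ i≡i′ = ℤ.*-cancelʳ-≡ k k′ (+ q) (≡.trans (≡.sym i≡) (≡.trans i≡i′ i′≡))

  -- The solution is -τ γ reduced modulo q, with γ an inverse of b modulo q. As 𝔟(s) = s b for equal
  -- shift parameters, this computes 𝔞(τ). The signed divisibility also carries the quotient, which
  -- becomes the exponent of the uniformizer in λ_τ.
  solve-congruence : ∀ b q .{{_ : NonZero q}} → Coprime b q → ∀ τ →
                     Σ (Fin q) λ a → + q Signed.∣ + b ℤ.* + toℕ a ℤ.+ τ
  solve-congruence b q b⊥q τ = fromℕ< r<q , subst (λ a → + q Signed.∣ + b ℤ.* + a ℤ.+ τ) (≡.sym (toℕ-fromℕ< r<q)) q∣
    where
    γ : ℤ
    γ = proj₁ (inverse-mod b q b⊥q)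
    r : ℕ
    r = (ℤ.- τ ℤ.* γ) %ℕ q
    Q : ℤ
    Q = (ℤ.- τ ℤ.* γ) /ℕ q
    r<q : r ℕ.< q
    r<q = n%ℕd<d (ℤ.- τ ℤ.* γ) q
    substitute : ∀ b γ τ r Q q → ℤ.- τ ℤ.* γ ≡ r ℤ.+ Q ℤ.* q →
                 ℤ.- τ ℤ.* (b ℤ.* γ ℤ.- 1ℤ) ℤ.- b ℤ.* Q ℤ.* q ≡ b ℤ.* r ℤ.+ τ
    substitute b γ τ r Q q eq = begin
      ℤ.- τ ℤ.* (b ℤ.* γ ℤ.- 1ℤ) ℤ.- b ℤ.* Q ℤ.* q     ≡⟨ regroup b γ τ Q q ⟩
      b ℤ.* (ℤ.- τ ℤ.* γ) ℤ.- b ℤ.* Q ℤ.* q ℤ.+ τ      ≡⟨ cong (λ z → b ℤ.* z ℤ.- b ℤ.* Q ℤ.* q ℤ.+ τ) eq ⟩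
      b ℤ.* (r ℤ.+ Q ℤ.* q) ℤ.- b ℤ.* Q ℤ.* q ℤ.+ τ    ≡⟨ cancel b r τ Q q ⟩
      b ℤ.* r ℤ.+ τ                                    ∎
      where
      open ≡.≡-Reasoning
      regroup : ∀ b γ τ Q q →
                ℤ.- τ ℤ.* (b ℤ.* γ ℤ.- 1ℤ) ℤ.- b ℤ.* Q ℤ.* q ≡
                b ℤ.* (ℤ.- τ ℤ.* γ) ℤ.- b ℤ.* Q ℤ.* q ℤ.+ τ
      regroup = ℤ-solve-∀
      cancel : ∀ b r τ Q q → b ℤ.* (r ℤ.+ Q ℤ.* q) ℤ.- b ℤ.* Q ℤ.* q ℤ.+ τ ≡ b ℤ.* r ℤ.+ τ
      cancel = ℤ-solve-∀
    q∣ : + q Signed.∣ + b ℤ.* + r ℤ.+ τ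
    q∣ = subst (+ q Signed.∣_) (substitute (+ b) γ τ (+ r) Q (+ q) (a≡a%ℕn+[a/ℕn]*n (ℤ.- τ ℤ.* γ) q))
      (Signed.∣m∣n⇒∣m-n (Signed.∣n⇒∣m*n (ℤ.- τ) (proj₂ (inverse-mod b q b⊥q))) (Signed.∣n⇒∣m*n (+ b ℤ.* Q) Signed.∣-refl))

open Arithmetic

open GroupProps (AbelianGroup.group ℤ.+-0-abelianGroup) using () renaming (∙-cancelˡ to ℤ-+-cancelˡ)

-- Fields and valuations

module FieldProps {c ℓ} (F : Field c ℓ) where
  open Field F hiding (zero)
  open SetoidReasoning setoid

  inverseˡ : ∀ x → x ≉ 0# → x ⁻¹ * x ≈ 1#
  inverseˡ x x≉0 = trans (*-comm (x ⁻¹) x) (inverseʳ x x≉0)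

  x⁻¹≉0 : ∀ {x} → x ≉ 0# → x ⁻¹ ≉ 0#
  x⁻¹≉0 {x} x≉0 x⁻¹≈0 = 1≉0 (trans (sym (inverseʳ x x≉0)) (trans (*-congˡ x⁻¹≈0) (zeroʳ x)))

module LinearAlgebra {c ℓ} (F : Field c ℓ) (_≟0 : ∀ x → Dec (Field._≈_ F x (Field.0# F))) where
  open Field F hiding (zero)
  open FieldProps F
  open SemiringSum semiring using (sum; sum-cong-≋; sum-remove; ∑-distrib-+; *-distribˡ-sum; sum-replicate-zero)
  open RingProps ring using (-‿distribʳ-*; -‿distribˡ-*)
  open SetoidReasoning setoid

  private
    -- A zero row is covered as well: any column serves as the pivot, with all multipliers zero. The
    -- elimination then needs no case distinction on the row.
    dependent-on-pivot : ∀ {d} (a : Vector Carrier (suc d)) →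
      ∃[ j ] Σ (Vector Carrier d) λ m → ∀ l → a (punchIn j l) ≈ m l * a j
    dependent-on-pivot a with any? (λ j → ¬? (a j ≟0))
    ... | yes (j , aj≉0) = j , (λ l → a (punchIn j l) * a j ⁻¹) , λ l →
      sym (trans (*-assoc _ _ _) (trans (*-congˡ (inverseˡ (a j) aj≉0)) (*-identityʳ _)))
    ... | no all-zero = zero , (λ _ → 0#) , λ l →
      trans (decidable-stable (a (suc l) ≟0) (λ al≉0 → all-zero (suc l , al≉0)))
            (sym (zeroˡ _))

    eliminate : ∀ {d} a (m c x : Vector Carrier d) →
      a * (- sum (λ l → m l * x l)) + sum (λ l → c l * x l) ≈
      sum (λ l → (c l - m l * a) * x l)
    eliminate a m c x = begin
      a * (- sum (λ l → m l * x l)) + sum (λ l → c l * x l)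
        ≈⟨ +-congʳ (trans (sym (-‿distribʳ-* _ _)) (-‿distribˡ-* _ _)) ⟩
      (- a) * sum (λ l → m l * x l) + sum (λ l → c l * x l)
        ≈⟨ +-congʳ (*-distribˡ-sum (- a) (λ l → m l * x l)) ⟩
      sum (λ l → (- a) * (m l * x l)) + sum (λ l → c l * x l)
        ≈⟨ ∑-distrib-+ (λ l → (- a) * (m l * x l)) (λ l → c l * x l) ⟨
      sum (λ l → (- a) * (m l * x l) + c l * x l)
        ≈⟨ sum-cong-≋ (λ l → rearrange a (m l) (c l) (x l)) ⟩
      sum (λ l → (c l - m l * a) * x l) ∎
      where
      rearrange : ∀ a m c x → (- a) * (m * x) + c * x ≈ (c - m * a) * x
      rearrange a m c x = begin
        (- a) * (m * x) + c * x  ≈⟨ +-comm _ _ ⟩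
        c * x + (- a) * (m * x)  ≈⟨ +-congˡ (*-assoc (- a) m x) ⟨
        c * x + (- a) * m * x    ≈⟨ distribʳ x c ((- a) * m) ⟨
        (c + (- a) * m) * x      ≈⟨ *-congʳ (+-congˡ (trans (sym (-‿distribˡ-* a m)) (-‿cong (*-comm a m)))) ⟩
        (c - m * a) * x          ∎

  -- Column operations: subtracting multiples of the pivot column clears the first row away from the
  -- pivot, and the other rows form a smaller system. The value inserted at the pivot undoes the
  -- operations, and the nonzero entry found recursively survives.
  nontrivial-solution : ∀ d (A : Fin d → Vector Carrier (suc d)) →
    Σ (Vector Carrier (suc d)) λ x → (∃[ i ] x i ≉ 0#) × (∀ r → sum (λ l → A r l * x l) ≈ 0#)
  nontrivial-solution zero    A = (λ _ → 1#) , (zero , 1≉0) , λ ()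
  nontrivial-solution (suc d) A =
    let j , m , Aj-pivot = dependent-on-pivot (A zero)
        x , (i , xi≉0) , Bx≈0 = nontrivial-solution d λ r l → A (suc r) (punchIn j l) - m l * A (suc r) j
        xj = - sum (λ l → m l * x l)
        row : ∀ r → sum (λ l → A r l * insertAt x j xj l) ≈ sum (λ l → (A r (punchIn j l) - m l * A r j) * x l)
        row r = begin
          sum (λ l → A r l * insertAt x j xj l)
            ≈⟨ sum-remove {i = j} (λ l → A r l * insertAt x j xj l) ⟩
          A r j * insertAt x j xj j + sum (λ l → A r (punchIn j l) * insertAt x j xj (punchIn j l))
            ≈⟨ +-cong (*-congˡ (reflexive (insertAt-lookup x j xj)))
                 (sum-cong-≋ λ l → *-congˡ {A r (punchIn j l)} (reflexive (insertAt-punchIn x j xj l))) ⟩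
          A r j * xj + sum (λ l → A r (punchIn j l) * x l)
            ≈⟨ eliminate (A r j) m (λ l → A r (punchIn j l)) x ⟩
          sum (λ l → (A r (punchIn j l) - m l * A r j) * x l) ∎
    in insertAt x j xj
     , (punchIn j i , λ eq → xi≉0 (trans (reflexive (≡.sym (insertAt-punchIn x j xj i))) eq))
     , λ { zero → trans (row zero) (trans
             (sum-cong-≋ λ l → trans (*-congʳ (trans (+-congʳ (Aj-pivot l)) (-‿inverseʳ _))) (zeroˡ (x l)))
             (sum-replicate-zero (suc d)))
         ; (suc r) → trans (row (suc r)) (Bx≈0 r) }

module ValuationProps {c ℓ} {F : Field c ℓ} (V : NormalizedValuation F) where
  open Field F hiding (zero)
  open NormalizedValuation V
  open FieldProps F
  open ExpProps semiring using (_^_)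
  open SemiringSum semiring using (sum; sum-cong-≋; sum-replicate-zero)
  open GroupProps +-group using (⁻¹-involutive; ε⁻¹≈ε)
  open RingProps ring using (-1*x≈-x)

  v0 : v 0# ≡ ⊤⁺
  v0 = Equivalence.from (v-∞ 0#) refl

  -- The valuation is a zero test, being either an integer or ∞. The case distinctions on
  -- coefficients, and with them the linear algebra, rest on it.
  _≟0 : ∀ x → Dec (x ≈ 0#)
  x ≟0 with v x in eq
  ... | ⊤⁺    = yes (Equivalence.to (v-∞ x) eq)
  ... | [ i ] = no λ x≈0 → contradiction (≡.trans (≡.sym eq) (Equivalence.from (v-∞ x) x≈0)) λ ()

  v-finite : ∀ {x} → x ≉ 0# → ∃[ i ] v x ≡ [ i ]
  v-finite {x} x≉0 with v x in eq
  ... | ⊤⁺    = contradiction (Equivalence.to (v-∞ x) eq) x≉0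
  ... | [ i ] = i , ≡.refl

  finite⇒≉0 : ∀ {x i} → v x ≡ [ i ] → x ≉ 0#
  finite⇒≉0 {x} vx x≈0 = contradiction (≡.trans (≡.sym vx) (Equivalence.from (v-∞ x) x≈0)) λ ()

  []-injective : ∀ {i j : ℤ} → _≡_ {A = ℤ ⁺} [ i ] [ j ] → i ≡ j
  []-injective ≡.refl = ≡.refl

  v-*-finite : ∀ {x y i j} → v x ≡ [ i ] → v y ≡ [ j ] → v (x * y) ≡ [ i ℤ.+ j ]
  v-*-finite {x} {y} vx vy = ≡.trans (v-* x y) (cong₂ _+⁺_ vx vy)

  v1 : v 1# ≡ [ 0ℤ ]
  v1 with v-finite 1≉0
  ... | i , vi = ≡.trans vi (cong [_] (ℤ-+-cancelˡ i i 0ℤ (≡.trans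
    ([]-injective (≡.trans (≡.sym (v-*-finite vi vi)) (≡.trans (v-cong (*-identityˡ 1#)) vi)))
    (≡.sym (ℤ.+-identityʳ i)))))

  v-⁻¹ : ∀ {x i} → v x ≡ [ i ] → v (x ⁻¹) ≡ [ ℤ.- i ]
  v-⁻¹ {x} {i} vx with v-finite (x⁻¹≉0 (finite⇒≉0 vx))
  ... | j , vj = ≡.trans vj (cong [_] (ℤ-+-cancelˡ i j (ℤ.- i) (≡.trans
    ([]-injective (≡.trans (≡.sym (v-*-finite vx vj)) (≡.trans (v-cong (inverseʳ x (finite⇒≉0 vx))) v1)))
    (≡.sym (ℤ.+-inverseʳ i)))))

  v-^ : ∀ {x i} m → v x ≡ [ i ] → v (x ^ m) ≡ [ i ℤ.* + m ]
  v-^ {x} {i} zero    vx = ≡.trans v1 (cong [_] (≡.sym (ℤ.*-zeroʳ i)))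
  v-^ {x} {i} (suc m) vx = ≡.trans (v-*-finite vx (v-^ m vx)) (cong [_] (step i (+ m)))
    where
    step : ∀ i m → i ℤ.+ i ℤ.* m ≡ i ℤ.* (1ℤ ℤ.+ m)
    step = ℤ-solve-∀

  -- From (-1)² = 1 one gets 2 v(-1) = 0.
  v-neg : ∀ x → v (- x) ≡ v x
  v-neg x with v-finite -1≉0
    where
    -1≉0 : - 1# ≉ 0#
    -1≉0 -1≈0 = 1≉0 (trans (sym (⁻¹-involutive 1#)) (trans (-‿cong -1≈0) ε⁻¹≈ε))
  ... | i , v-1 = ≡.trans (v-cong (sym (-1*x≈-x x))) (≡.trans (v-* (- 1#) x)
    (≡.trans (cong (_+⁺ v x) (≡.trans v-1 (cong [_] i≡0))) (0+⁺ (v x))))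
    where
    [-1]²≈1 : - 1# * - 1# ≈ 1#
    [-1]²≈1 = trans (-1*x≈-x (- 1#)) (⁻¹-involutive 1#)
    double : ∀ i → + 2 ℤ.* i ≡ i ℤ.+ i
    double = ℤ-solve-∀
    i≡0 : i ≡ 0ℤ
    i≡0 = ℤ.*-cancelˡ-≡ (+ 2) i 0ℤ (≡.trans (double i)
      ([]-injective (≡.trans (≡.sym (v-*-finite v-1 v-1)) (≡.trans (v-cong [-1]²≈1) v1))))
    0+⁺ : ∀ z → [ 0ℤ ] +⁺ z ≡ z
    0+⁺ [ j ] = cong [_] (ℤ.+-identityˡ j)
    0+⁺ ⊤⁺    = ≡.refl

  -- The ultrametric inequality for x + y gives the lower bound. Applied to x = (x + y) - y it gives
  -- the upper one, because the minimum there cannot be attained at j > i.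
  v-+-dominant : ∀ {x y i j} → v x ≡ [ i ] → v y ≡ [ j ] → i ℤ.< j → v (x + y) ≡ [ i ]
  v-+-dominant {x} {y} {i} {j} vx vy i<j = squeeze (v (x + y))
    (subst (_≤⁺ v (x + y)) (≡.trans (cong₂ _⊓⁺_ vx vy) (cong [_] (ℤ.i≤j⇒i⊓j≡i (ℤ.<⇒≤ i<j)))) (v-+ x y))
    (subst₂ _≤⁺_ (cong (v (x + y) ⊓⁺_) (≡.trans (v-neg y) vy)) (≡.trans (v-cong x+y-y≈x) vx)
      (v-+ (x + y) (- y)))
    where
    x+y-y≈x : x + y - y ≈ x
    x+y-y≈x = trans (+-assoc x y (- y)) (trans (+-congˡ (-‿inverseʳ y)) (+-identityʳ x))
    squeeze : ∀ w → [ i ] ≤⁺ w → w ⊓⁺ [ j ] ≤⁺ [ i ] → w ≡ [ i ]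
    squeeze ⊤⁺    _         [ j≤i ] = contradiction j≤i (ℤ.<⇒≱ i<j)
    squeeze [ k ] [ i≤k ] [ k⊓j≤i ] with ℤ.⊓-sel k j
    ... | inj₁ k⊓j≡k = cong [_] (ℤ.≤-antisym (subst (ℤ._≤ i) k⊓j≡k k⊓j≤i) i≤k)
    ... | inj₂ k⊓j≡j = contradiction (subst (ℤ._≤ i) k⊓j≡j k⊓j≤i) (ℤ.<⇒≱ i<j)

  -- Injectivity is asked only for finite valuations, so several terms may be zero. The tail sum
  -- inherits the valuation of one of its own terms, hence never ties with a nonzero head.
  v-sum-dominant : ∀ {d} (y : Vector Carrier d) →
    (∀ i j {m} → v (y i) ≡ [ m ] → v (y j) ≡ [ m ] → i ≡ j) →
    (∀ i → y i ≈ 0#) ⊎ (∃[ j ] y j ≉ 0# × v (sum y) ≡ v (y j))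
  v-sum-dominant {zero}  y _        = inj₁ λ ()
  v-sum-dominant {suc d} y distinct
    with v-sum-dominant (λ i → y (suc i)) (λ i j vi vj → suc-injective (distinct (suc i) (suc j) vi vj)) | y zero ≟0
  ... | inj₁ tail≈0 | yes y₀≈0 = inj₁ λ { zero → y₀≈0 ; (suc i) → tail≈0 i }
  ... | inj₁ tail≈0 | no  y₀≉0 = inj₂ (zero , y₀≉0 , v-cong
          (trans (+-congˡ (trans (sum-cong-≋ tail≈0) (sum-replicate-zero d))) (+-identityʳ (y zero))))
  ... | inj₂ (j , yⱼ≉0 , v-tail) | yes y₀≈0 =
          inj₂ (suc j , yⱼ≉0 , ≡.trans (v-cong (trans (+-congʳ y₀≈0) (+-identityˡ _))) v-tail)
  ... | inj₂ (j , yⱼ≉0 , v-tail) | no y₀≉0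
    with v-finite y₀≉0 | v-finite yⱼ≉0
  ... | k , v₀ | m , vⱼ with ℤ.<-cmp k m
  ... | tri< k<m _ _ = inj₂ (zero , y₀≉0 , ≡.trans (v-+-dominant v₀ (≡.trans v-tail vⱼ) k<m) (≡.sym v₀))
  ... | tri> _ _ m<k = inj₂ (suc j , yⱼ≉0 , ≡.trans (v-cong (+-comm _ _))
          (≡.trans (v-+-dominant (≡.trans v-tail vⱼ) v₀ m<k) (≡.sym vⱼ)))
  ... | tri≈ _ ≡.refl _ with () ← distinct zero (suc j) v₀ vⱼ

module IntegerUnits {c ℓ} {K : Field c ℓ} (vK : NormalizedValuation K) where
  open Field K hiding (zero)
  open NormalizedValuation vK
  open ValuationProps vK
  open FieldProps K
  open ExpProps semiring using (_^_)
  open MultProps semiring using () renaming (_×_ to _×ᴺ_)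

  InValuationRing-× : ∀ m → InValuationRing (m ×ᴺ 1#)
  InValuationRing-× zero    = subst ([ 0ℤ ] ≤⁺_) (≡.sym v0) ([ 0ℤ ] ≤⊤⁺)
  InValuationRing-× (suc m) = ≤⁺-trans ℤ.≤-trans
    (subst (λ z → [ 0ℤ ] ≤⁺ z ⊓⁺ v (m ×ᴺ 1#)) (≡.sym v1) (0≤0⊓ (InValuationRing-× m))) (v-+ 1# (m ×ᴺ 1#))
    where
    0≤0⊓ : ∀ {z} → [ 0ℤ ] ≤⁺ z → [ 0ℤ ] ≤⁺ [ 0ℤ ] ⊓⁺ z
    0≤0⊓ ([ 0≤i ]) = [ ℤ.≤-reflexive (≡.sym (ℤ.i≤j⇒i⊓j≡i 0≤i)) ]
    0≤0⊓ (_ ≤⊤⁺)  = [ ℤ.≤-refl ]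

  v≡0⇒unit : ∀ {x} → v x ≡ [ 0ℤ ] → IsUnitOfValuationRing x
  v≡0⇒unit {x} vx = subst ([ 0ℤ ] ≤⁺_) (≡.sym vx) [ ℤ.≤-refl ] ,
    x ⁻¹ , subst ([ 0ℤ ] ≤⁺_) (≡.sym (v-⁻¹ vx)) [ ℤ.≤-refl ] , inverseʳ x (finite⇒≉0 vx)

  -- m · 1 is integral and, by the residue characteristic, outside the maximal ideal, so its
  -- valuation is exactly 0. This turns nonzero base p digits into units.
  ∤⇒unit : ∀ {p m} → HasResidueCharacteristic p → ¬ p ∣ m → IsUnitOfValuationRing (m ×ᴺ 1#)
  ∤⇒unit {p} {m} residue p∤m = v≡0⇒unit (squeeze (v (m ×ᴺ 1#)) (InValuationRing-× m) (p∤m ∘ Equivalence.to (residue m)))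
    where
    squeeze : ∀ z → [ 0ℤ ] ≤⁺ z → ¬ [ 1ℤ ] ≤⁺ z → z ≡ [ 0ℤ ]
    squeeze ⊤⁺    _         ¬1≤ = contradiction ([ 1ℤ ] ≤⊤⁺) ¬1≤
    squeeze [ i ] ([ 0≤i ]) ¬1≤ = cong [_] (ℤ.≤-antisym (ℤ.i<j⇒i≤pred[j] {i} {1ℤ} (ℤ.≰⇒> (¬1≤ ∘ [_]))) 0≤i)

  π : Carrier
  π = proj₁ uniformizer

  π^ : ℤ → Carrier
  π^ (+ m)    = π ^ m
  π^ -[1+ m ] = (π ⁻¹) ^ suc m

  v-π^ : ∀ i → v (π^ i) ≡ [ i ]
  v-π^ (+ m)    = ≡.trans (v-^ m (proj₂ uniformizer)) (cong [_] (ℤ.*-identityˡ (+ m)))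
  v-π^ -[1+ m ] = ≡.trans (v-^ (suc m) (v-⁻¹ (proj₂ uniformizer))) (cong [_] (ℤ.-1*i≡-i (+ suc m)))

-- Bases of totally ramified extensions

module ExtensionProps {c ℓ c′ ℓ′} {K : Field c ℓ} {L : Field c′ ℓ′} (E : Extension K L) where
  module K where
    open Field K public
    open MultProps semiring public using () renaming (_×_ to _×ᴺ_)
    open SemiringSum semiring public using (sum)
  module L where
    open Field L public
    open ExpProps semiring public
    open MultProps semiring public renaming (_×_ to _×ᴺ_)
    open SemiringSum semiring public
    open RingProps ring public
    open SetoidReasoning setoid public
    open CommutativeSemigroupProps *-commutativeSemigroup public using (x∙yz≈y∙xz)
  open Extension E public using (ι; isHom; InBase)
  open RingMorphisms.IsRingHomomorphism isHom public
    using (+-homo; *-homo; 0#-homo; 1#-homo; -‿homo) renaming (⟦⟧-cong to ι-cong)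
  open L using (_≈_; _*_; _+_)

  ι≈0 : ∀ {k} → k K.≈ K.0# → ι k ≈ L.0#
  ι≈0 k≈0 = L.trans (ι-cong k≈0) 0#-homo

  ι-sum : ∀ {d} (a : Vector K.Carrier d) → ι (K.sum a) ≈ L.sum (ι ∘ a)
  ι-sum {zero}  a = 0#-homo
  ι-sum {suc d} a = L.trans (+-homo _ _) (L.+-congˡ (ι-sum (a ∘ suc)))

  ι-× : ∀ m → ι (m K.×ᴺ K.1#) ≈ m L.×ᴺ L.1#
  ι-× zero    = 0#-homo
  ι-× (suc m) = L.trans (+-homo _ _) (L.+-cong 1#-homo (ι-× m))

  lincomb : ∀ {d} → Vector K.Carrier d → Vector L.Carrier d → L.Carrier
  lincomb a e = L.sum λ k → ι (a k) * e k

  Independent Spanning : ∀ {d} → Vector L.Carrier d → Set _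
  Independent e = ∀ a → lincomb a e ≈ L.0# → ∀ k → a k K.≈ K.0#
  Spanning e = ∀ y → Σ (Vector K.Carrier _) λ a → y ≈ lincomb a e

  -- Exchange argument: written in the given basis, y and the `e k` are d + 1 columns of height d,
  -- hence linearly related. Independence of e forces the coefficient of y in the relation to be
  -- nonzero, and dividing by it expresses y.
  independent⇒spanning : (∀ k → Dec (k K.≈ K.0#)) → ∀ {d} → Extension.HasDegree E d →
                         (e : Vector L.Carrier d) → Independent e → Spanning e
  independent⇒spanning _≟0 {d} (f , f-basis) e e-independent y = solution nontrivial
    where
    open IsBasis f-basis
    open FieldProps K using (inverseˡ)
    open LinearAlgebra K _≟0
    ye : Vector L.Carrier (suc d)
    ye zero    = y
    ye (suc k) = e k
    M : Fin (suc d) → Vector K.Carrier d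
    M l = proj₁ (spanning (ye l))
    nontrivial = nontrivial-solution d (λ r l → M l r)

    relation : ∀ x → (∀ r → K.sum (λ l → M l r K.* x l) K.≈ K.0#) → lincomb x ye ≈ L.0#
    relation x Mx≈0 = begin
      L.sum (λ l → ι (x l) * ye l)
        ≈⟨ L.sum-cong-≋ (λ l → L.*-congˡ {ι (x l)} (proj₂ (spanning (ye l)))) ⟩
      L.sum (λ l → ι (x l) * lincomb (M l) f)
        ≈⟨ L.sum-cong-≋ (λ l → L.*-distribˡ-sum (ι (x l)) (λ r → ι (M l r) * f r)) ⟩
      L.sum (λ l → L.sum (λ r → ι (x l) * (ι (M l r) * f r)))
        ≈⟨ L.∑-comm (λ l r → ι (x l) * (ι (M l r) * f r)) ⟩
      L.sum (λ r → L.sum (λ l → ι (x l) * (ι (M l r) * f r)))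
        ≈⟨ L.sum-cong-≋ (λ r → L.sum-cong-≋ (λ l → regroup (x l) (M l r) (f r))) ⟩
      L.sum (λ r → L.sum (λ l → ι (M l r K.* x l) * f r))
        ≈⟨ L.sum-cong-≋ (λ r → L.*-distribʳ-sum (f r) (λ l → ι (M l r K.* x l))) ⟨
      L.sum (λ r → L.sum (λ l → ι (M l r K.* x l)) * f r)
        ≈⟨ L.sum-cong-≋ (λ r → L.*-congʳ (ι-sum (λ l → M l r K.* x l))) ⟨
      L.sum (λ r → ι (K.sum (λ l → M l r K.* x l)) * f r)
        ≈⟨ L.sum-cong-≋ (λ r → L.trans (L.*-congʳ (ι≈0 (Mx≈0 r))) (L.zeroˡ (f r))) ⟩
      L.sum (λ (r : Fin d) → L.0#)
        ≈⟨ L.sum-replicate-zero d ⟩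
      L.0# ∎
      where
      open L using (begin_; step-≈-⟩; step-≈-⟨; _∎)
      regroup : ∀ x m z → ι x * (ι m * z) ≈ ι (m K.* x) * z
      regroup x m z = L.trans (L.x∙yz≈y∙xz _ _ _) (L.trans (L.sym (L.*-assoc _ _ _)) (L.*-congʳ (L.sym (*-homo m x))))

    solution : (Σ (Vector K.Carrier (suc d)) λ x → (∃[ i ] x i K.≉ K.0#) ×
                 (∀ r → K.sum (λ l → M l r K.* x l) K.≈ K.0#)) →
               Σ (Vector K.Carrier d) λ a → y ≈ lincomb a e
    solution (x , (i , xi≉0) , Mx≈0) with x zero ≟0
    ... | yes x₀≈0 = contradiction (all-zero i) xi≉0
      where
      rest≈0 : lincomb (x ∘ suc) e ≈ L.0#
      rest≈0 = L.trans (L.sym (L.+-identityˡ _)) (L.trans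
        (L.+-congʳ (L.sym (L.trans (L.*-congʳ (ι≈0 x₀≈0)) (L.zeroˡ y)))) (relation x Mx≈0))
      all-zero : ∀ i → x i K.≈ K.0#
      all-zero zero    = x₀≈0
      all-zero (suc k) = e-independent (x ∘ suc) rest≈0 k
    ... | no x₀≉0 = (λ k → m K.* x (suc k)) , (begin
        y                                       ≈⟨ L.*-identityˡ y ⟨
        L.1# * y                                ≈⟨ L.*-congʳ ιm*ιx₀≈-1 ⟨
        L.- (ι m * ι (x zero)) * y              ≈⟨ L.-‿distribˡ-* _ _ ⟨
        L.- (ι m * ι (x zero) * y)              ≈⟨ L.-‿cong (L.*-assoc _ _ _) ⟩
        L.- (ι m * (ι (x zero) * y))            ≈⟨ L.-‿distribʳ-* _ _ ⟩
        ι m * L.- (ι (x zero) * y)              ≈⟨ L.*-congˡ rest≈ ⟨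
        ι m * lincomb (x ∘ suc) e               ≈⟨ L.*-distribˡ-sum (ι m) (λ k → ι (x (suc k)) * e k) ⟩
        L.sum (λ k → ι m * (ι (x (suc k)) * e k))
          ≈⟨ L.sum-cong-≋ (λ k → L.trans (L.*-congʳ (*-homo m (x (suc k)))) (L.*-assoc _ _ _)) ⟨
        lincomb (λ k → m K.* x (suc k)) e       ∎)
      where
      open L using (begin_; step-≈-⟩; step-≈-⟨; _∎)
      m = K.- (x zero K.⁻¹)
      rest≈ : lincomb (x ∘ suc) e ≈ L.- (ι (x zero) * y)
      rest≈ = inverseʳ-unique _ _ (relation x Mx≈0)
        where open GroupProps L.+-group using (inverseʳ-unique)
      ιm*ιx₀≈-1 : L.- (ι m * ι (x zero)) ≈ L.1#
      ιm*ιx₀≈-1 = begin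
        L.- (ι m * ι (x zero))             ≈⟨ L.-‿cong (L.*-congʳ (-‿homo _)) ⟩
        L.- (L.- ι (x zero K.⁻¹) * ι (x zero)) ≈⟨ L.-‿cong (L.-‿distribˡ-* _ _) ⟨
        L.- (L.- (ι (x zero K.⁻¹) * ι (x zero))) ≈⟨ GroupProps.⁻¹-involutive L.+-group _ ⟩
        ι (x zero K.⁻¹) * ι (x zero)       ≈⟨ *-homo _ _ ⟨
        ι (x zero K.⁻¹ K.* x zero)         ≈⟨ ι-cong (inverseˡ (x zero) x₀≉0) ⟩
        ι K.1#                             ≈⟨ 1#-homo ⟩
        L.1#                               ∎

module RamifiedProps {c ℓ c′ ℓ′} {K : Field c ℓ} {L : Field c′ ℓ′} (E : Extension K L)
  (vK : NormalizedValuation K) (vL : NormalizedValuation L) where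
  open ExtensionProps E
  private
    module vK where
      open NormalizedValuation vK public
      open ValuationProps vK public
    module vL where
      open NormalizedValuation vL public
      open ValuationProps vL public
  open L using (_≈_; _*_; _+_)

  DistinctModulo : ℕ → ∀ {d} → Vector ℤ d → Set
  DistinctModulo q w = ∀ k l → w k ≡ w l [mod q ] → k ≡ l

  module _ {q} (ramification : Extension.HasRamificationIndex E vK vL q) where

    v-ι : ∀ {a i} → vK.v a ≡ [ i ] → vL.v (ι a) ≡ [ + q ℤ.* i ]
    v-ι {a} va = ≡.trans (ramification a) (cong (q ·⁺_) va)

    v-term : ∀ {a x i w} → vK.v a ≡ [ i ] → vL.v x ≡ [ w ] → vL.v (ι a * x) ≡ [ + q ℤ.* i ℤ.+ w ]
    v-term va vx = vL.v-*-finite (v-ι va) vx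

    module _ {d} (e : Vector L.Carrier d) (w : Vector ℤ d) (v-e : ∀ k → vL.v (e k) ≡ [ w k ])
             (w-distinct : DistinctModulo q w) where

      private
        coefficient≉0 : ∀ {a k} → ι a * e k L.≉ L.0# → a K.≉ K.0#
        coefficient≉0 t≉0 a≈0 = t≉0 (L.trans (L.*-congʳ (ι≈0 a≈0)) (L.zeroˡ _))

        terms-distinct : ∀ (a : Vector K.Carrier d) k l {m} → vL.v (ι (a k) * e k) ≡ [ m ] → vL.v (ι (a l) * e l) ≡ [ m ] → k ≡ l
        terms-distinct a k l vk vl =
          let i , vi = vK.v-finite {a k} (coefficient≉0 {a k} {k} (vL.finite⇒≉0 vk))
              j , vj = vK.v-finite {a l} (coefficient≉0 {a l} {l} (vL.finite⇒≉0 vl))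
          in w-distinct k l (*-+-≡⇒≡[mod] q i j (w k) (w l) (vL.[]-injective
               (≡.trans (≡.sym (v-term vi (v-e k))) (≡.trans (≡.trans vk (≡.sym vl)) (v-term vj (v-e l))))))

      -- Valuations from K become multiples of q in L, so a nonzero k-th term has valuation
      -- congruent to `w k` modulo q, and two nonzero terms never tie.
      v-lincomb : ∀ a → (∀ k → a k K.≈ K.0#) ⊎
                  (∃[ j ] ∃[ i ] a j K.≉ K.0# × vL.v (lincomb a e) ≡ [ + q ℤ.* i ℤ.+ w j ])
      v-lincomb a = cases (vL.v-sum-dominant (λ k → ι (a k) * e k) (terms-distinct a))
        where
        cases : (∀ k → ι (a k) * e k ≈ L.0#) ⊎
                (∃[ j ] ι (a j) * e j L.≉ L.0# × vL.v (lincomb a e) ≡ vL.v (ι (a j) * e j)) →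
                (∀ k → a k K.≈ K.0#) ⊎
                (∃[ j ] ∃[ i ] a j K.≉ K.0# × vL.v (lincomb a e) ≡ [ + q ℤ.* i ℤ.+ w j ])
        cases (inj₁ all≈0) = inj₁ λ k → decidable-stable (a k vK.≟0) λ ak≉0 →
          vL.finite⇒≉0 (v-term (proj₂ (vK.v-finite ak≉0)) (v-e k)) (all≈0 k)
        cases (inj₂ (j , t≉0 , v-sum)) =
          let aj≉0   = coefficient≉0 {a j} {j} t≉0
              i , vi = vK.v-finite aj≉0
          in inj₂ (j , i , aj≉0 , ≡.trans v-sum (v-term vi (v-e j)))

      distinct⇒independent : Independent e
      distinct⇒independent a ae≈0 = cases (v-lincomb a)
        where
        cases : (∀ k → a k K.≈ K.0#) ⊎
                (∃[ j ] ∃[ i ] a j K.≉ K.0# × vL.v (lincomb a e) ≡ [ + q ℤ.* i ℤ.+ w j ]) →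
                ∀ k → a k K.≈ K.0#
        cases (inj₁ a≈0) = a≈0
        cases (inj₂ (_ , _ , _ , v-ae)) = contradiction ae≈0 (vL.finite⇒≉0 v-ae)

module SumLemmas {c ℓ} (M : CommutativeMonoid c ℓ) where
  open CommutativeMonoid M
  open CommutativeMonoidSum M

  sum-≈ε : ∀ {d} (t : Vector Carrier d) → (∀ i → t i ≈ ε) → sum t ≈ ε
  sum-≈ε {d} t t≈ε = trans (sum-cong-≋ t≈ε) (sum-replicate-zero d)

  sum-single : ∀ {d} (t : Vector Carrier d) i → (∀ j → j ≢ i → t j ≈ ε) → sum t ≈ t i
  sum-single {suc d} t zero    off = trans (∙-congˡ (sum-≈ε (t ∘ suc) λ j → off (suc j) λ ())) (identityʳ _)
  sum-single {suc d} t (suc i) off = trans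
    (∙-cong (off zero λ ()) (sum-single (t ∘ suc) i λ j j≢i → off (suc j) (j≢i ∘ suc-injective)))
    (identityˡ _)

  -- Meant for sums whose inner terms are killed by binomial coefficients divisible by p: the
  -- expansion of (x + y)^p, and the Leibniz sum for a product with x^(p^j).
  sum-ends : ∀ n .{{_ : NonZero n}} (f : ℕ → Carrier) → (∀ k → 0 ℕ.< k → k ℕ.< n → f k ≈ ε) →
             sum {suc n} (f ∘ toℕ) ≈ f 0 ∙ f n
  sum-ends (suc n) f inner = ∙-congˡ (trans (sum-init-last (f ∘ suc ∘ toℕ)) (trans
    (∙-cong (sum-≈ε _ λ i → inner _ ℕ.z<s (ℕ.s<s (subst (ℕ._< n) (≡.sym (toℕ-inject₁ i)) (toℕ<n i))))
            (reflexive (cong (f ∘ suc) (toℕ-fromℕ n))))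
    (identityˡ _)))

CharacteristicDivides : ∀ {c ℓ} → CommutativeRing c ℓ → ℕ → Set ℓ
CharacteristicDivides R p = p ×ᴺ 1# ≈ 0#
  where
  open CommutativeRing R hiding (zero)
  open MultProps semiring using () renaming (_×_ to _×ᴺ_)

module CharacteristicProps {c ℓ} (R : CommutativeRing c ℓ) {p} (p-prime : Prime p)
  (p×1≈0 : CharacteristicDivides R p) where
  open CommutativeRing R hiding (zero)
  open MultProps semiring using () renaming (_×_ to _×ᴺ_)
  open MultProps semiring hiding (_×_)
  open ExpProps semiring
  open SetoidReasoning setoid

  ∣⇒×≈0 : ∀ {m} x → p ∣ m → m ×ᴺ x ≈ 0#
  ∣⇒×≈0 x (ℕ.divides k ≡.refl) = begin
    (k ℕ.* p) ×ᴺ x          ≈⟨ ×-congʳ (k ℕ.* p) (*-identityˡ x) ⟨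
    (k ℕ.* p) ×ᴺ (1# * x)   ≈⟨ ×-assoc-* (k ℕ.* p) 1# x ⟨
    (k ℕ.* p) ×ᴺ 1# * x     ≈⟨ *-congʳ (×1-homo-* k p) ⟩
    k ×ᴺ 1# * p ×ᴺ 1# * x   ≈⟨ *-congʳ (trans (*-congˡ p×1≈0) (zeroʳ _)) ⟩
    0# * x                  ≈⟨ zeroˡ x ⟩
    0#                      ∎

  frobenius-+ : ∀ x y → (x + y) ^ p ≈ x ^ p + y ^ p
  frobenius-+ x y = begin
    (x + y) ^ p          ≈⟨ theorem p x y ⟩
    sum {suc p} (f ∘ toℕ) ≈⟨ sum-ends p f (λ k 0<k k<p →
                              ∣⇒×≈0 _ (subst (λ q → p ∣ q C k) (ℕ.*-identityʳ p)
                                (prime-power∣choose p-prime 1 k 0<k (subst (k ℕ.<_) (≡.sym (ℕ.*-identityʳ p)) k<p)))) ⟩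
    f 0 + f p            ≈⟨ +-cong f0 fp ⟩
    y ^ p + x ^ p        ≈⟨ +-comm _ _ ⟩
    x ^ p + y ^ p        ∎
    where
    instance _ = prime⇒nonZero p-prime
    open SumLemmas +-commutativeMonoid
    open SemiringSum semiring using (sum)
    open BinomialTheorem commutativeSemiring using (theorem)
    f : ℕ → Carrier
    f k = (p C k) ×ᴺ (x ^ k * y ^ (p ∸ k))
    f0 : f 0 ≈ y ^ p
    f0 = trans (×-cong (choose-zero p) (*-identityˡ _)) (×-homo-1 _)
    fp : f p ≈ x ^ p
    fp = trans (×-cong (nCn≡1 p) (trans (*-congˡ (^-congʳ y (ℕ.n∸n≡0 p))) (*-identityʳ _))) (×-homo-1 _)

-- The generator x with x^q in K

module Adjunction {c ℓ c′ ℓ′} {K : Field c ℓ} {L : Field c′ ℓ′} (E : Extension K L) where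
  open ExtensionProps E
  open L using (_≈_; _*_; _+_; _^_)

  -- The K-subalgebra generated by y, given by membership proofs instead of polynomials, so that
  -- properties of its elements go by induction on how they are built. `resp` closes it under the
  -- equality of L.
  data K[_] (y : L.Carrier) : L.Carrier → Set (c ⊔ c′ ⊔ ℓ′) where
    base : ∀ k → K[ y ] (ι k)
    gen  : K[ y ] y
    add  : ∀ {z w} → K[ y ] z → K[ y ] w → K[ y ] (z + w)
    mul  : ∀ {z w} → K[ y ] z → K[ y ] w → K[ y ] (z * w)
    resp : ∀ {z w} → z ≈ w → K[ y ] z → K[ y ] w

  private variable
    y z w : L.Carrier

  K[]-pow : ∀ m → K[ y ] z → K[ y ] (z ^ m)
  K[]-pow zero    _ = resp 1#-homo (base K.1#)
  K[]-pow (suc m) z = mul z (K[]-pow m z)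

  K[]-neg : K[ y ] z → K[ y ] (L.- z)
  K[]-neg {y} {z} zy = resp (L.trans (L.*-congʳ (L.trans (-‿homo _) (L.-‿cong 1#-homo))) (L.-1*x≈-x z)) (mul (base (K.- K.1#)) zy)

  K[]-⊆ : K[ w ] y → K[ y ] z → K[ w ] z
  K[]-⊆ y∈ (base k)     = base k
  K[]-⊆ y∈ gen          = y∈
  K[]-⊆ y∈ (add z z′)   = add (K[]-⊆ y∈ z) (K[]-⊆ y∈ z′)
  K[]-⊆ y∈ (mul z z′)   = mul (K[]-⊆ y∈ z) (K[]-⊆ y∈ z′)
  K[]-⊆ y∈ (resp eq z)  = resp eq (K[]-⊆ y∈ z)

  K[]-base : InBase y → K[ y ] z → InBase z
  K[]-base y∈ (base k) = k , L.refl
  K[]-base y∈ gen      = y∈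
  K[]-base y∈ (add z z′) =
    let k , z≈ = K[]-base y∈ z ; k′ , z′≈ = K[]-base y∈ z′
    in k K.+ k′ , L.trans (L.+-cong z≈ z′≈) (L.sym (+-homo k k′))
  K[]-base y∈ (mul z z′) =
    let k , z≈ = K[]-base y∈ z ; k′ , z′≈ = K[]-base y∈ z′
    in k K.* k′ , L.trans (L.*-cong z≈ z′≈) (L.sym (*-homo k k′))
  K[]-base y∈ (resp eq z) =
    let k , z≈ = K[]-base y∈ z in k , L.trans (L.sym eq) z≈

  module _ {p} (p-prime : Prime p) (p×1≈0 : p L.×ᴺ L.1# ≈ L.0#) where
    open CharacteristicProps L.commutativeRing p-prime p×1≈0

    ^-distrib-* : ∀ m x y → (x * y) ^ m ≈ x ^ m * y ^ m
    ^-distrib-* m x y = CommutativeMonoidMult.×-distrib-+ L.*-commutativeMonoid x y m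

    K[]-frobenius : K[ y ] z → K[ y ^ p ] (z ^ p)
    K[]-frobenius (base k)    = K[]-pow p (base k)
    K[]-frobenius gen         = gen
    K[]-frobenius (add z w)   = resp (L.sym (frobenius-+ _ _)) (add (K[]-frobenius z) (K[]-frobenius w))
    K[]-frobenius (mul z w)   = resp (L.sym (^-distrib-* p _ _)) (mul (K[]-frobenius z) (K[]-frobenius w))
    K[]-frobenius (resp eq z) = resp (L.^-congˡ p eq) (K[]-frobenius z)

    ^-p^suc : ∀ x i → (x ^ (p ℕ.^ i)) ^ p ≈ x ^ (p ℕ.^ suc i)
    ^-p^suc x i = L.trans (L.^-assocʳ x (p ℕ.^ i) p) (L.^-congʳ x (ℕ.*-comm (p ℕ.^ i) p))

    K[x^p^i]-antitone : ∀ x i → K[ x ^ (p ℕ.^ suc i) ] z → K[ x ^ (p ℕ.^ i) ] z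
    K[x^p^i]-antitone x i = K[]-⊆ (resp (^-p^suc x i) (K[]-pow p gen))

    -- The Frobenius propagates K(x^{p^i}) = K(x^{p^{i+1}}) up to the level where x^{p^m} lies in K.
    no-drop⇒InBase : ∀ x i m → K[ x ^ (p ℕ.^ suc i) ] (x ^ (p ℕ.^ i)) → InBase (x ^ (p ℕ.^ (m ℕ.+ i))) →
                     InBase (x ^ (p ℕ.^ i))
    no-drop⇒InBase x i m x∈ x^∈K = K[]-base x^∈K (descend m)
      where
      raise : ∀ m → K[ x ^ (p ℕ.^ suc (m ℕ.+ i)) ] (x ^ (p ℕ.^ (m ℕ.+ i)))
      raise zero    = x∈
      raise (suc m) = K[]-⊆ (resp (L.sym (^-p^suc x (suc (m ℕ.+ i)))) gen)
        (resp (^-p^suc x (m ℕ.+ i)) (K[]-frobenius (raise m)))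
      descend : ∀ m → K[ x ^ (p ℕ.^ (m ℕ.+ i)) ] (x ^ (p ℕ.^ i))
      descend zero    = gen
      descend (suc m) = K[]-⊆ (raise m) (descend m)

module PurelyInseparableGenerator {c ℓ c′ ℓ′} {K : Field c ℓ} {L : Field c′ ℓ′} (E : Extension K L)
  (vK : NormalizedValuation K) (vL : NormalizedValuation L)
  {p} (p-prime : Prime p) (n : ℕ)
  (totally-ramified : Extension.IsTotallyRamifiedOfDegree E vK vL (p ℕ.^ n))
  where
  open ExtensionProps E
  open RamifiedProps E vK vL
  open Adjunction E
  open L using (_≈_; _*_; _+_; _^_)
  private
    module vK where
      open NormalizedValuation vK public
      open ValuationProps vK public
    module vL where
      open NormalizedValuation vL public
      open ValuationProps vL public
    q = p ℕ.^ n
    degree = proj₁ totally-ramified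
    ramification = proj₂ totally-ramified
    instance
      p≢0 = prime⇒nonZero p-prime

  -- The size is a variable with `d ≡ q` because the family in `valuation-drop` is indexed by P · Q,
  -- which equals q only up to a proof.
  distinct⇒spanning : ∀ {d} → d ≡ q → (e : Vector L.Carrier d) (w : Vector ℤ d) →
                      (∀ k → vL.v (e k) ≡ [ w k ]) → DistinctModulo q w → Spanning e
  distinct⇒spanning ≡.refl e w v-e w-distinct =
    independent⇒spanning vK._≟0 degree e (distinct⇒independent ramification e w v-e w-distinct)

  module _ (x : L.Carrier) (β : ℤ) (v-x : vL.v x ≡ [ β ]) where

    -- Only finite valuations are constrained, so 0 qualifies.
    HasValuationsDivisibleBy : ℕ → L.Carrier → Set
    HasValuationsDivisibleBy P z = ∀ {m} → vL.v z ≡ [ m ] → + P Signed.∣ m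

    -- The terms x^r Z_r, r > 0, have valuations outside Pℤ, hence cannot cancel.
    constant-term : ∀ P .{{_ : NonZero P}} → ℤ.Coprime (+ P) β → (Z : Vector L.Carrier P) → ∀ y →
      y ≈ L.sum (λ r → x ^ toℕ r * Z r) →
      (∀ r → HasValuationsDivisibleBy P (Z r)) → (∀ r → HasValuationsDivisibleBy P (Z r + L.- y)) →
      ∃[ r ] y ≈ Z r
    constant-term P@(suc P′) P⊥β Z y y≈ P∣vZ P∣vZ-y =
      zero , L.sym (x∙y⁻¹≈ε⇒x≈y (Z zero) y (L.trans (L.sym (L.*-identityˡ _)) (vanishing (vL.v-sum-dominant t distinct) zero)))
      where
      open GroupProps L.+-group using (x∙y⁻¹≈ε⇒x≈y)
      -- y is absorbed into the term r = 0, so that the terms `t r` sum to zero. Nonzero terms have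
      -- valuations congruent to β r modulo P, hence pairwise distinct, and a zero sum forces every
      -- term to vanish.
      Z′ : Vector L.Carrier P
      Z′ zero    = Z zero + L.- y
      Z′ (suc r) = Z (suc r)
      t : Vector L.Carrier P
      t r = x ^ toℕ r * Z′ r
      P∣vZ′ : ∀ r → HasValuationsDivisibleBy P (Z′ r)
      P∣vZ′ zero    = P∣vZ-y zero
      P∣vZ′ (suc r) = P∣vZ (suc r)
      t≈0 : L.sum t ≈ L.0#
      t≈0 = begin
        L.1# * (Z zero + L.- y) + rest             ≈⟨ L.+-congʳ (L.distribˡ L.1# _ _) ⟩
        L.1# * Z zero + L.1# * (L.- y) + rest      ≈⟨ L.+-assoc _ _ _ ⟩
        L.1# * Z zero + (L.1# * (L.- y) + rest)    ≈⟨ L.+-congˡ (L.+-comm _ _) ⟩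
        L.1# * Z zero + (rest + L.1# * (L.- y))    ≈⟨ L.+-assoc _ _ _ ⟨
        L.1# * Z zero + rest + L.1# * (L.- y)      ≈⟨ L.+-cong (L.sym y≈) (L.*-identityˡ _) ⟩
        y + L.- y                                  ≈⟨ L.-‿inverseʳ y ⟩
        L.0#                                       ∎
        where
        open L using (begin_; step-≈-⟩; step-≈-⟨; _∎)
        rest = L.sum (t ∘ suc)
      valuation : ∀ r {m} → vL.v (t r) ≡ [ m ] → ∃[ i ] m ≡ + P ℤ.* i ℤ.+ β ℤ.* + toℕ r
      valuation r {m} vt =
        let j , vj = vL.v-finite {Z′ r} λ Z≈0 → vL.finite⇒≉0 vt (L.trans (L.*-congˡ Z≈0) (L.zeroʳ _))
            Signed.divides i j≡ = P∣vZ′ r vj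
        in i , vL.[]-injective (≡.trans (≡.sym vt) (≡.trans (vL.v-*-finite (vL.v-^ (toℕ r) v-x) vj)
             (cong [_] (≡.trans (ℤ.+-comm (β ℤ.* + toℕ r) j) (cong (ℤ._+ β ℤ.* + toℕ r) (≡.trans j≡ (ℤ.*-comm i (+ P))))))))
      distinct : ∀ r s {m} → vL.v (t r) ≡ [ m ] → vL.v (t s) ≡ [ m ] → r ≡ s
      distinct r s vr vs =
        let i , m≡ = valuation r vr
            j , m≡′ = valuation s vs
        in toℕ-injective (coprime-∣-⇒≡ β (toℕ r) (toℕ s) P⊥β (toℕ<n r) (toℕ<n s)
             (*-+-≡⇒≡[mod] P i j (β ℤ.* + toℕ r) (β ℤ.* + toℕ s) (≡.trans (≡.sym m≡) m≡′)))
      vanishing : (∀ r → t r ≈ L.0#) ⊎ (∃[ r ] t r L.≉ L.0# × vL.v (L.sum t) ≡ vL.v (t r)) →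
                  ∀ r → t r ≈ L.0#
      vanishing (inj₁ all≈0) = all≈0
      vanishing (inj₂ (r , tr≉0 , v-sum)) =
        let m , vm = vL.v-finite tr≉0
        in contradiction t≈0 (vL.finite⇒≉0 (≡.trans v-sum vm))

    module _ (P : ℕ) .{{_ : NonZero P}} (z : L.Carrier) where
      open SumLemmas L.+-commutativeMonoid using (sum-single; sum-≈ε)

      -- The sum of the K[z] x^r over r < P: a K-linear expansion in the x^r z^h, grouped by powers
      -- of x.
      IsCombination : L.Carrier → Set _
      IsCombination y = Σ (Vector L.Carrier P) λ Z → (∀ r → K[ z ] (Z r)) × y ≈ L.sum (λ r → x ^ toℕ r * Z r)

      combination-0 : IsCombination L.0#
      combination-0 = (λ _ → L.0#) , (λ _ → resp 0#-homo (base K.0#)) , L.sym (sum-≈ε {P} (λ r → x ^ toℕ r * L.0#) λ r → L.zeroʳ (x ^ toℕ r))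

      combination-+ : ∀ {y y′} → IsCombination y → IsCombination y′ → IsCombination (y + y′)
      combination-+ (Z , Z∈ , y≈) (Z′ , Z′∈ , y′≈) =
        (λ r → Z r + Z′ r) , (λ r → add (Z∈ r) (Z′∈ r)) ,
        L.trans (L.+-cong y≈ y′≈) (L.trans (L.sym (L.∑-distrib-+ (λ r → x ^ toℕ r * Z r) (λ r → x ^ toℕ r * Z′ r)))
          (L.sum-cong-≋ {P} λ r → L.sym (L.distribˡ (x ^ toℕ r) (Z r) (Z′ r))))

      combination-term : ∀ r {w} → r ℕ.< P → K[ z ] w → IsCombination (x ^ r * w)
      combination-term r {w} r<P w∈ = (λ s → pick (s Fin.≟ r′)) , (λ s → pick∈ (s Fin.≟ r′)) , L.sym (L.trans
        (sum-single (λ s → x ^ toℕ s * pick (s Fin.≟ r′)) r′ λ s s≢r′ →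
          L.trans (L.*-congˡ (pick-off (s Fin.≟ r′) s≢r′)) (L.zeroʳ (x ^ toℕ s)))
        (L.*-cong (L.^-congʳ x (toℕ-fromℕ< r<P)) (pick-on (r′ Fin.≟ r′))))
        where
        r′ = fromℕ< r<P
        pick : ∀ {s} → Dec (s ≡ r′) → L.Carrier
        pick (yes _) = w
        pick (no _)  = L.0#
        pick∈ : ∀ {s} (d : Dec (s ≡ r′)) → K[ z ] (pick d)
        pick∈ (yes _) = w∈
        pick∈ (no _)  = resp 0#-homo (base K.0#)
        pick-off : ∀ {s} (d : Dec (s ≡ r′)) → s ≢ r′ → pick d ≈ L.0#
        pick-off (yes s≡r′) s≢r′ = contradiction s≡r′ s≢r′
        pick-off (no _)     _    = L.refl
        pick-on : (d : Dec (r′ ≡ r′)) → pick d ≈ w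
        pick-on (yes _) = L.refl
        pick-on (no ≢)  = contradiction ≡.refl ≢

      combination-sum : ∀ {d} (y : Vector L.Carrier d) → (∀ k → IsCombination (y k)) → IsCombination (L.sum y)
      combination-sum {zero}  y y∈ = combination-0
      combination-sum {suc d} y y∈ = combination-+ (y∈ zero) (combination-sum (y ∘ suc) (y∈ ∘ suc))

    -- The x^r z^h span L because their valuations, the values of `weight`, are distinct modulo q.
    -- After grouping by r, the coefficients of x^P and their differences with x^P all lie in
    -- K[x^P], where valuations are multiples of P, so `constant-term` applies.
    valuation-drop : ∀ P Q .{{_ : NonZero P}} → P ℕ.* Q ≡ q → ℤ.Coprime (+ P) β →
      (∀ {z} → K[ x ^ P ] z → HasValuationsDivisibleBy P z) →
      ∀ {z u} → K[ x ^ P ] z → vL.v z ≡ [ u ℤ.* + P ] → ℤ.Coprime (+ Q) u → K[ z ] (x ^ P)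
    valuation-drop P Q PQ≡q P⊥β P∣v {z} {u} z∈ v-z Q⊥u =
      let a , x^P≈ = distinct⇒spanning PQ≡q e w v-e w-distinct (x ^ P)
          Z , Z∈ , sum≈ = combination-sum P z (λ k → ι (a k) * e k) λ k → combination-resp (a k) k
                 (combination-term P z (toℕ k % P) (m%n<n (toℕ k) P) (mul (base (a k)) (K[]-pow (toℕ k / P) gen)))
          r , x^P≈Zr = constant-term P P⊥β Z (x ^ P) (L.trans x^P≈ sum≈)
                 (λ r → P∣v (K[]-⊆ z∈ (Z∈ r)))
                 (λ r → P∣v (add (K[]-⊆ z∈ (Z∈ r)) (K[]-neg gen)))
      in resp (L.sym x^P≈Zr) (Z∈ r)
      where
      e : Vector L.Carrier (P ℕ.* Q)
      e k = x ^ (toℕ k % P) * z ^ (toℕ k / P)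
      w : Vector ℤ (P ℕ.* Q)
      w k = weight P β u (toℕ k)
      v-e : ∀ k → vL.v (e k) ≡ [ w k ]
      v-e k = ≡.trans (vL.v-*-finite (vL.v-^ (toℕ k % P) v-x) (vL.v-^ (toℕ k / P) v-z))
        (cong (λ i → [ β ℤ.* + (toℕ k % P) ℤ.+ i ℤ.* + (toℕ k / P) ]) (ℤ.*-comm u (+ P)))
      w-distinct : DistinctModulo q w
      w-distinct k l = subst (λ q → w k ≡ w l [mod q ] → k ≡ l) PQ≡q λ w≡ →
        toℕ-injective (weight-injective P Q β u P⊥β Q⊥u (toℕ k) (toℕ l) (toℕ<n k) (toℕ<n l) w≡)
      combination-resp : ∀ a k → IsCombination P z (x ^ (toℕ k % P) * (ι a * z ^ (toℕ k / P))) →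
                         IsCombination P z (ι a * e k)
      combination-resp a k (Z , Z∈ , ≈sum) = Z , Z∈ , L.trans (L.x∙yz≈y∙xz _ _ _) ≈sum

    module _ (p⊥β : ℤ.Coprime (+ p) β) (p×1≈0 : p L.×ᴺ L.1# ≈ L.0#)
             (k₀ : ℕ) (x^∈K : InBase (x ^ (p ℕ.^ k₀))) where
      private
        p^⊥β : ∀ i → ℤ.Coprime (+ (p ℕ.^ i)) β
        p^⊥β i = ℕ.sym (coprime-^ʳ i (ℕ.sym p⊥β))

      -- Nonzero elements of K have valuation in qℤ, whereas v(x^(p^i)) = β p^i with β prime to p
      -- and 0 < p^i < q.
      x^p^i∉K : ∀ {i} → i ℕ.< n → ¬ InBase (x ^ (p ℕ.^ i))
      x^p^i∉K {i} i<n (k , x^≈k) = ℕ.>⇒∤ {{m^n≢0 p i}} (ℕ.^-monoʳ-< p 1<p i<n)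
        (ℤ.coprime-divisor (+ q) β (+ (p ℕ.^ i)) (p^⊥β n) (Signed.∣⇒∣ᵤ (Signed.divides j
          (≡.trans (vL.[]-injective (≡.trans (≡.sym v-x^) (≡.trans (vL.v-cong x^≈k) (v-ι ramification vk))))
                   (ℤ.*-comm (+ q) j)))))
        where
        1<p = ℕ.nonTrivial⇒n>1 p {{prime⇒nonTrivial p-prime}}
        v-x^ = vL.v-^ (p ℕ.^ i) v-x
        k-finite = vK.v-finite {k} λ k≈0 → vL.finite⇒≉0 v-x^ (L.trans x^≈k (ι≈0 k≈0))
        j = proj₁ k-finite
        vk = proj₂ k-finite

      K[x^p^i]-valuations : ∀ i → i ℕ.≤ n → ∀ {z} → K[ x ^ (p ℕ.^ i) ] z → HasValuationsDivisibleBy (p ℕ.^ i) z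
      K[x^p^i]-valuations zero    _ z∈ {m} v-z = Signed.divides m (≡.sym (ℤ.*-identityʳ m))
      K[x^p^i]-valuations (suc i) i<n {z} z∈ {m} v-z = cases (p ℕ.∣? ℤ.∣ u ∣)
        where
        z∈K[x^p^i] = K[x^p^i]-antitone p-prime p×1≈0 x i z∈
        pⁱ∣m : + (p ℕ.^ i) Signed.∣ m
        pⁱ∣m = K[x^p^i]-valuations i (ℕ.<⇒≤ i<n) z∈K[x^p^i] v-z
        u = Signed._∣_.quotient pⁱ∣m
        m≡ : m ≡ u ℤ.* + (p ℕ.^ i)
        m≡ = Signed._∣_.equality pⁱ∣m
        pⁱpⁿ⁻ⁱ≡q : p ℕ.^ i ℕ.* p ℕ.^ (n ∸ i) ≡ q
        pⁱpⁿ⁻ⁱ≡q = ≡.trans (≡.sym (ℕ.^-distribˡ-+-* p i (n ∸ i))) (cong (p ℕ.^_) (ℕ.m+[n∸m]≡n (ℕ.<⇒≤ i<n)))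
        -- Nothing relates k₀ to i; raising x^(p^k₀) to the power p^i reaches level k₀ + i, from
        -- which the descent can come down to level i.
        x^p^[k₀+i]∈K : InBase (x ^ (p ℕ.^ (k₀ ℕ.+ i)))
        x^p^[k₀+i]∈K = K[]-base x^∈K (resp
          (L.trans (L.^-assocʳ x (p ℕ.^ k₀) (p ℕ.^ i)) (L.^-congʳ x (≡.sym (ℕ.^-distribˡ-+-* p k₀ i))))
          (K[]-pow (p ℕ.^ i) gen))
        cases : Dec (p ∣ ℤ.∣ u ∣) → + (p ℕ.^ suc i) Signed.∣ m
        cases (yes p∣u) = subst₂ Signed._∣_ (≡.sym (ℤ.pos-* p (p ℕ.^ i))) (≡.sym m≡)
          (Signed.*-monoˡ-∣ (+ (p ℕ.^ i)) {+ p} {u} (Signed.∣ᵤ⇒∣ p∣u))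
        -- `valuation-drop` puts x^(p^i) into K[z], and z lies in K[x^(p^(i+1))]. Passing from level
        -- i to level i + 1 would thus lose nothing, which forces x^(p^i) into K.
        cases (no  p∤u) = contradiction
          (no-drop⇒InBase p-prime p×1≈0 x i k₀
            (K[]-⊆ z∈ (valuation-drop (p ℕ.^ i) (p ℕ.^ (n ∸ i)) {{m^n≢0 p i}} pⁱpⁿ⁻ⁱ≡q (p^⊥β i)
              (K[x^p^i]-valuations i (ℕ.<⇒≤ i<n)) {z} {u} z∈K[x^p^i]
              (≡.trans v-z (cong [_] m≡)) (ℕ.sym (coprime-^ʳ (n ∸ i) (prime∤⇒coprime _ p-prime p∤u)))))
            x^p^[k₀+i]∈K)
          (x^p^i∉K i<n)

      private
        v-powers : ∀ (k : Fin q) → vL.v (x ^ toℕ k) ≡ [ β ℤ.* + toℕ k ]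
        v-powers k = vL.v-^ (toℕ k) v-x

        powers-distinct : DistinctModulo q (λ (k : Fin q) → β ℤ.* + toℕ k)
        powers-distinct k l k≡l =
          toℕ-injective (coprime-∣-⇒≡ β (toℕ k) (toℕ l) (p^⊥β n) (toℕ<n k) (toℕ<n l) k≡l)

      powers-independent : Independent {q} (λ k → x ^ toℕ k)
      powers-independent = distinct⇒independent ramification _ _ v-powers powers-distinct

      powers-spanning : Spanning {q} (λ k → x ^ toℕ k)
      powers-spanning = distinct⇒spanning ≡.refl _ _ v-powers powers-distinct

      x^q∈K : InBase (x ^ q)
      x^q∈K =
        let a , x^q≈ = powers-spanning (x ^ q)
            r , x^q≈ar = constant-term q {{m^n≢0 p n}} (p^⊥β n) (ι ∘ a) (x ^ q)
              (L.trans x^q≈ (L.sum-cong-≋ {q} λ k → L.*-comm (ι (a k)) (x ^ toℕ k)))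
              (λ r → K[x^p^i]-valuations n ℕ.≤-refl (base (a r)))
              (λ r → K[x^p^i]-valuations n ℕ.≤-refl (add (base (a r)) (K[]-neg gen)))
        in a r , x^q≈ar

-- Hasse derivatives, the action and the scaffold

module LinearMaps {c ℓ c′ ℓ′} {K : Field c ℓ} {L : Field c′ ℓ′} (E : Extension K L) where
  open ExtensionProps E
  open L using (_≈_; _*_; _+_)
  open SumLemmas L.+-commutativeMonoid using (sum-≈ε)

  record IsLinear (g : L.Carrier → L.Carrier) : Set (c ⊔ c′ ⊔ ℓ′) where
    field
      g-cong : ∀ {y z} → y ≈ z → g y ≈ g z
      g-+    : ∀ y z → g (y + z) ≈ g y + g z
      g-*    : ∀ k y → g (ι k * y) ≈ ι k * g y

    g-0 : g L.0# ≈ L.0#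
    g-0 = L.trans (g-cong (L.sym (L.trans (L.*-congʳ 0#-homo) (L.zeroˡ L.0#))))
      (L.trans (g-* K.0# L.0#) (L.trans (L.*-congʳ 0#-homo) (L.zeroˡ _)))

    g-lincomb : ∀ {d} a (e : Vector L.Carrier d) → g (lincomb a e) ≈ lincomb a (g ∘ e)
    g-lincomb {zero}  a e = g-0
    g-lincomb {suc d} a e = L.trans (g-+ _ _) (L.+-cong (g-* _ _) (g-lincomb (a ∘ suc) (e ∘ suc)))

    g-× : ∀ m y → g (m L.×ᴺ y) ≈ m L.×ᴺ g y
    g-× zero    y = g-0
    g-× (suc m) y = L.trans (g-+ _ _) (L.+-congˡ (g-× m y))

  open IsLinear public

  id-linear : IsLinear (λ y → y)
  id-linear = record { g-cong = λ eq → eq ; g-+ = λ _ _ → L.refl ; g-* = λ _ _ → L.refl }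

  ∘-linear : ∀ {f g} → IsLinear f → IsLinear g → IsLinear (f ∘ g)
  ∘-linear f g = record
    { g-cong = λ eq → g-cong f (g-cong g eq)
    ; g-+ = λ y z → L.trans (g-cong f (g-+ g y z)) (g-+ f _ _)
    ; g-* = λ k y → L.trans (g-cong f (g-* g k y)) (g-* f k _)
    }

  +-linear : ∀ {f g} → IsLinear f → IsLinear g → IsLinear (λ y → f y + g y)
  +-linear f g = record
    { g-cong = λ eq → L.+-cong (g-cong f eq) (g-cong g eq)
    ; g-+ = λ y z → L.trans (L.+-cong (g-+ f y z) (g-+ g y z)) (+-interchange _ _ _ _)
    ; g-* = λ k y → L.trans (L.+-cong (g-* f k y) (g-* g k y)) (L.sym (L.distribˡ _ _ _))
    }
    where open CommutativeSemigroupProps (CommutativeMonoid.commutativeSemigroup L.+-commutativeMonoid)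
                 using () renaming (interchange to +-interchange)

  0-linear : IsLinear (λ _ → L.0#)
  0-linear = record
    { g-cong = λ _ → L.refl ; g-+ = λ _ _ → L.sym (L.+-identityˡ L.0#) ; g-* = λ _ _ → L.sym (L.zeroʳ _) }

  *ˡ-linear : ∀ z {f} → IsLinear f → IsLinear (λ y → z * f y)
  *ˡ-linear z f = record
    { g-cong = λ eq → L.*-congˡ (g-cong f eq)
    ; g-+ = λ y y′ → L.trans (L.*-congˡ (g-+ f y y′)) (L.distribˡ z _ _)
    ; g-* = λ k y → L.trans (L.*-congˡ (g-* f k y)) (L.x∙yz≈y∙xz z _ _)
    }

  *ʳ-linear : ∀ z {f} → IsLinear f → IsLinear (λ y → f y * z)
  *ʳ-linear z f = record
    { g-cong = λ eq → L.*-congʳ (g-cong f eq)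
    ; g-+ = λ y y′ → L.trans (L.*-congʳ (g-+ f y y′)) (L.distribʳ z _ _)
    ; g-* = λ k y → L.trans (L.*-congʳ (g-* f k y)) (L.*-assoc _ _ z)
    }

  sum-linear : ∀ {d} (f : Fin d → L.Carrier → L.Carrier) → (∀ i → IsLinear (f i)) →
               IsLinear (λ y → L.sum (λ i → f i y))
  sum-linear {zero}  f f-linear = 0-linear
  sum-linear {suc d} f f-linear = +-linear (f-linear zero) (sum-linear (f ∘ suc) (f-linear ∘ suc))

  ×-linear : ∀ m {f} → IsLinear f → IsLinear (λ y → m L.×ᴺ f y)
  ×-linear zero    f = 0-linear
  ×-linear (suc m) f = +-linear f (×-linear m f)

  lincomb-cong : ∀ {d} {a b : Vector K.Carrier d} {e f : Vector L.Carrier d} →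
                 (∀ i → a i K.≈ b i) → (∀ i → e i ≈ f i) → lincomb a e ≈ lincomb b f
  lincomb-cong {d} a≈b e≈f = L.sum-cong-≋ {d} λ i → L.*-cong (ι-cong (a≈b i)) (e≈f i)

  lincomb-+ : ∀ {d} (a b : Vector K.Carrier d) e → lincomb (λ i → a i K.+ b i) e ≈ lincomb a e + lincomb b e
  lincomb-+ {d} a b e = L.trans
    (L.sum-cong-≋ {d} λ i → L.trans (L.*-congʳ (+-homo (a i) (b i))) (L.distribʳ (e i) _ _))
    (L.∑-distrib-+ (λ i → ι (a i) * e i) (λ i → ι (b i) * e i))

  lincomb-* : ∀ {d} k (a : Vector K.Carrier d) e → lincomb (λ i → k K.* a i) e ≈ ι k * lincomb a e
  lincomb-* {d} k a e = L.trans
    (L.sum-cong-≋ {d} λ i → L.trans (L.*-congʳ (*-homo k (a i))) (L.*-assoc _ _ _))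
    (L.sym (L.*-distribˡ-sum (ι k) (λ i → ι (a i) * e i)))

  lincomb-neg : ∀ {d} (a : Vector K.Carrier d) e → lincomb (λ i → K.- a i) e ≈ L.- lincomb a e
  lincomb-neg {d} a e = inverseˡ-unique _ _ (L.trans (L.sym (lincomb-+ (λ i → K.- a i) a e))
    (sum-≈ε (λ i → ι (K.- a i K.+ a i) * e i) λ i →
      L.trans (L.*-congʳ (ι≈0 (K.-‿inverseˡ (a i)))) (L.zeroˡ (e i))))
    where open GroupProps L.+-group using (inverseˡ-unique)

  module Basis {d} (e : Vector L.Carrier d) (e-independent : Independent e) (e-spanning : Spanning e) where

    linear-ext : ∀ {f g} → IsLinear f → IsLinear g → (∀ i → f (e i) ≈ g (e i)) → ∀ y → f y ≈ g y
    linear-ext {f} {g} f-linear g-linear f≈g y =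
      let a , y≈ = e-spanning y in begin
      f y                  ≈⟨ g-cong f-linear y≈ ⟩
      f (lincomb a e)      ≈⟨ g-lincomb f-linear a e ⟩
      lincomb a (f ∘ e)    ≈⟨ lincomb-cong (λ _ → K.refl) f≈g ⟩
      lincomb a (g ∘ e)    ≈⟨ g-lincomb g-linear a e ⟨
      g (lincomb a e)      ≈⟨ g-cong g-linear y≈ ⟨
      g y                  ∎
      where open L using (begin_; step-≈-⟩; step-≈-⟨; _∎)

    extendLinearly : Vector L.Carrier d → L.Carrier → L.Carrier
    extendLinearly f y = lincomb (proj₁ (e-spanning y)) f

    coordinates-unique : ∀ {a b} → lincomb a e ≈ lincomb b e → ∀ i → a i K.≈ b i
    coordinates-unique {a} {b} ae≈be i = x∙y⁻¹≈ε⇒x≈y (a i) (b i) (e-independent (λ i → a i K.- b i)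
      (L.trans (lincomb-+ a (λ i → K.- b i) e)
        (L.trans (L.+-cong ae≈be (lincomb-neg b e)) (L.-‿inverseʳ _))) i)
      where open GroupProps K.+-group using (x∙y⁻¹≈ε⇒x≈y)

    -- `e-spanning` picks coordinates without regard to the equality of L. Their uniqueness makes
    -- the value independent of the choice, and from this come both congruence and linearity.
    extendLinearly-lincomb : ∀ f {y} a → y ≈ lincomb a e → extendLinearly f y ≈ lincomb a f
    extendLinearly-lincomb f {y} a y≈ =
      lincomb-cong (coordinates-unique (L.trans (L.sym (proj₂ (e-spanning y))) y≈)) (λ _ → L.refl)

    extendLinearly-linear : ∀ f → IsLinear (extendLinearly f)
    extendLinearly-linear f = record
      { g-cong = λ {y} {z} y≈z → extendLinearly-lincomb f (proj₁ (e-spanning z)) (L.trans y≈z (proj₂ (e-spanning z)))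
      ; g-+ = λ y z → L.trans
          (extendLinearly-lincomb f _ (L.trans (L.+-cong (proj₂ (e-spanning y)) (proj₂ (e-spanning z)))
            (L.sym (lincomb-+ (proj₁ (e-spanning y)) (proj₁ (e-spanning z)) e))))
          (lincomb-+ (proj₁ (e-spanning y)) (proj₁ (e-spanning z)) f)
      ; g-* = λ k y → L.trans
          (extendLinearly-lincomb f _ (L.trans (L.*-congˡ (proj₂ (e-spanning y)))
            (L.sym (lincomb-* k (proj₁ (e-spanning y)) e))))
          (lincomb-* k (proj₁ (e-spanning y)) f)
      }

    extendLinearly-basis : ∀ f i → extendLinearly f (e i) ≈ f i
    extendLinearly-basis f i = L.trans (extendLinearly-lincomb f (unit i) (L.sym (unit-lincomb i e))) (unit-lincomb i f)
      where
      unit : Fin d → Vector K.Carrier d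
      unit i j with j Fin.≟ i
      ... | yes _ = K.1#
      ... | no  _ = K.0#
      unit-off : ∀ i j → j ≢ i → ι (unit i j) ≈ L.0#
      unit-off i j j≢i with j Fin.≟ i
      ... | yes j≡i = contradiction j≡i j≢i
      ... | no  _   = 0#-homo
      unit-on : ∀ i → ι (unit i i) ≈ L.1#
      unit-on i with i Fin.≟ i
      ... | yes _ = 1#-homo
      ... | no ≢  = contradiction ≡.refl ≢
      open SumLemmas L.+-commutativeMonoid using (sum-single)
      unit-lincomb : ∀ i (f : Vector L.Carrier d) → lincomb (unit i) f ≈ f i
      unit-lincomb i f = L.trans
        (sum-single (λ j → ι (unit i j) * f j) i λ j j≢i → L.trans (L.*-congʳ (unit-off i j j≢i)) (L.zeroˡ (f j)))
        (L.trans (L.*-congʳ (unit-on i)) (L.*-identityˡ (f i)))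

module _ {c ℓ c′ ℓ′} {K : Field c ℓ} {L : Field c′ ℓ′} (E : Extension K L) where
  open ExtensionProps E
  open L using (_≈_; _*_; _+_; _^_; _×ᴺ_; begin_; step-≈-⟩; step-≈-⟨; _∎)

  module HasseDerivatives {p} (p-prime : Prime p) (p×1≈0 : p ×ᴺ L.1# ≈ L.0#) (n : ℕ)
    (x : L.Carrier) (x^q∈K : InBase (x ^ (p ℕ.^ n)))
    (powers-independent : Independent {p ℕ.^ n} (λ k → x ^ toℕ k))
    (powers-spanning : Spanning {p ℕ.^ n} (λ k → x ^ toℕ k))
    where
    open LinearMaps E
    open CharacteristicProps L.commutativeRing p-prime p×1≈0
    open SumLemmas L.+-commutativeMonoid

    private
      q = p ℕ.^ n

    powers : Vector L.Carrier q
    powers k = x ^ toℕ k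

    open Basis powers powers-independent powers-spanning public

    derivative : ℕ → ℕ → L.Carrier
    derivative r s = (s C r) ×ᴺ x ^ (s ∸ r)

    D : ℕ → L.Carrier → L.Carrier
    D r = extendLinearly (λ k → derivative r (toℕ k))

    D-linear : ∀ r → IsLinear (D r)
    D-linear r = extendLinearly-linear (λ k → derivative r (toℕ k))

    D-cong : ∀ r {y z} → y ≈ z → D r y ≈ D r z
    D-cong r = g-cong (D-linear r)

    D-power-< : ∀ r {s} → s ℕ.< q → D r (x ^ s) ≈ derivative r s
    D-power-< r s<q = L.trans (D-cong r (L.^-congʳ x (≡.sym (toℕ-fromℕ< s<q))))
      (L.trans (extendLinearly-basis (λ k → derivative r (toℕ k)) (fromℕ< s<q))
        (L.reflexive (cong (derivative r) (toℕ-fromℕ< s<q))))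

    derivative-0 : ∀ s → derivative 0 s ≈ x ^ s
    derivative-0 s = L.trans (L.×-cong (choose-zero s) L.refl) (L.×-homo-1 (x ^ s))

    derivative-< : ∀ {r s} → s ℕ.< r → derivative r s ≈ L.0#
    derivative-< s<r = L.×-cong (k>n⇒nCk≡0 s<r) L.refl

    derivative-refl : ∀ r → derivative r r ≈ L.1#
    derivative-refl r = L.trans (L.×-cong (nCn≡1 r) (L.^-congʳ x (ℕ.n∸n≡0 r))) (L.×-homo-1 L.1#)

    -- For s ≤ r the truncated exponent s ∸ suc r is harmless because s C suc r vanishes.
    derivative-suc : ∀ r s → derivative (suc r) (suc s) ≈ x * derivative (suc r) s + derivative r s
    derivative-suc r s = begin
      (suc s C suc r) ×ᴺ y                        ≈⟨ L.×-cong (nCk+nC[k+1]≡[n+1]C[k+1] s r) L.refl ⟨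
      (s C r ℕ.+ s C suc r) ×ᴺ y                  ≈⟨ L.×-homo-+ y (s C r) (s C suc r) ⟩
      (s C r) ×ᴺ y + (s C suc r) ×ᴺ y             ≈⟨ L.+-comm _ _ ⟩
      (s C suc r) ×ᴺ y + (s C r) ×ᴺ y             ≈⟨ L.+-congʳ (shift (suc r ℕ.≤? s)) ⟩
      x * derivative (suc r) s + derivative r s   ∎
      where
      y = x ^ (s ∸ r)
      shift : Dec (suc r ℕ.≤ s) → (s C suc r) ×ᴺ y ≈ x * derivative (suc r) s
      shift (yes r<s) = L.trans (L.×-congʳ (s C suc r) (L.^-congʳ x (ℕ.+-∸-assoc 1 r<s))) (L.sym (L.×-comm-* (s C suc r) x (x ^ (s ∸ suc r))))
      shift (no  r≮s) = L.trans (L.×-cong (k>n⇒nCk≡0 (ℕ.≰⇒> r≮s)) L.refl)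
        (L.sym (L.trans (L.*-congˡ (derivative-< (ℕ.≰⇒> r≮s))) (L.zeroʳ x)))

    D-0 : ∀ y → D 0 y ≈ y
    D-0 = linear-ext (D-linear 0) id-linear λ k →
      L.trans (extendLinearly-basis (λ k → derivative 0 (toℕ k)) k) (derivative-0 (toℕ k))

    -- The counterpart of `t r` being the zero vector for r ≥ q; with it the action of `t r` is
    -- `D r` for all r, without a bound.
    D-≥q : ∀ {r} → q ℕ.≤ r → ∀ y → D r y ≈ L.0#
    D-≥q {r} q≤r = linear-ext (D-linear r) 0-linear λ k →
      L.trans (extendLinearly-basis (λ k → derivative r (toℕ k)) k) (derivative-< (ℕ.<-≤-trans (toℕ<n k) q≤r))

    0<q : 0 ℕ.< q
    0<q = ℕ.>-nonZero⁻¹ q {{m^n≢0 p n {{prime⇒nonZero p-prime}}}}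

    D-1 : ∀ r → D (suc r) L.1# ≈ L.0#
    D-1 r = L.trans (D-power-< (suc r) {0} 0<q) (derivative-< {suc r} ℕ.z<s)

    D-base : ∀ r k → D (suc r) (ι k) ≈ L.0#
    D-base r k = L.trans (D-cong (suc r) (L.sym (L.*-identityʳ (ι k)))) (L.trans (g-* (D-linear (suc r)) k L.1#)
      (L.trans (L.*-congˡ (D-1 r)) (L.zeroʳ _)))

    -- At the last basis vector this uses that x^q is a constant and that q C suc r vanishes modulo p.
    D-suc-x* : ∀ r → suc r ℕ.< q → ∀ y → D (suc r) (x * y) ≈ x * D (suc r) y + D r y
    D-suc-x* r r<q = linear-ext (∘-linear (D-linear (suc r)) (*ˡ-linear x id-linear))
      (+-linear (*ˡ-linear x (D-linear (suc r))) (D-linear r)) λ k → on-power (toℕ k) (toℕ<n k)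
      where
      on-power : ∀ s → s ℕ.< q → D (suc r) (x * x ^ s) ≈ x * D (suc r) (x ^ s) + D r (x ^ s)
      on-power s s<q = L.trans (lhs (suc s ℕ.<? q)) (L.trans (derivative-suc r s)
        (L.+-cong (L.*-congˡ (L.sym (D-power-< (suc r) s<q))) (L.sym (D-power-< r s<q))))
        where
        lhs : Dec (suc s ℕ.< q) → D (suc r) (x ^ suc s) ≈ derivative (suc r) (suc s)
        lhs (yes 1+s<q) = D-power-< (suc r) 1+s<q
        lhs (no  1+s≮q) = let k , x^q≈ = x^q∈K in begin
          D (suc r) (x ^ suc s)         ≈⟨ D-cong (suc r) (L.trans (L.^-congʳ x 1+s≡q) x^q≈) ⟩
          D (suc r) (ι k)               ≈⟨ D-base r k ⟩
          L.0#                          ≈⟨ ∣⇒×≈0 (x ^ (suc s ∸ suc r)) (subst (λ q → p ∣ q C suc r) (≡.sym 1+s≡q)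
                                             (prime-power∣choose p-prime n (suc r) ℕ.z<s r<q)) ⟨
          derivative (suc r) (suc s)    ∎
          where
          1+s≡q : suc s ≡ q
          1+s≡q = ℕ.≤-antisym s<q (ℕ.≮⇒≥ 1+s≮q)

    -- Beyond the basis, for s ≥ q, the formula is reached by multiplying with x repeatedly. The
    -- bound on r is essential: D_q is zero, while the formal derivative of x^q of order q is 1.
    D-power : ∀ r → r ℕ.< q → ∀ s → D r (x ^ s) ≈ derivative r s
    D-power zero    _   s = L.trans (D-0 (x ^ s)) (L.sym (derivative-0 s))
    D-power (suc r) r<q zero    = D-power-< (suc r) 0<q
    D-power (suc r) r<q (suc s) = L.trans (D-suc-x* r r<q (x ^ s)) (L.trans
      (L.+-cong (L.*-congˡ (D-power (suc r) r<q s)) (D-power r (ℕ.<-trans (ℕ.n<1+n r) r<q) s))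
      (L.sym (derivative-suc r s)))

    leibnizSum : ℕ → L.Carrier → L.Carrier → L.Carrier
    leibnizSum r s t = L.sum {suc r} (λ j → D (toℕ j) s * D (r ∸ toℕ j) t)

    -- Multiplication by x turns D_(r+1) into x D_(r+1) + D_r, on the product and on each term of
    -- the sum alike. Hence the case (a + 1, r + 1) follows from (a, r + 1) and (a, r); the term j =
    -- 0 is split off because D_0 is the identity.
    leibniz-power : ∀ a r → r ℕ.< q → ∀ t → D r (x ^ a * t) ≈ leibnizSum r (x ^ a) t
    leibniz-power a zero r<q t = L.trans (D-0 _) (L.sym (L.trans (L.+-identityʳ _) (L.*-cong (D-0 _) (D-0 t))))
    leibniz-power zero (suc r) r<q t = L.trans (D-cong (suc r) (L.*-identityˡ t)) (L.sym (L.trans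
      (L.+-cong (L.trans (L.*-congʳ (D-0 L.1#)) (L.*-identityˡ _))
        (sum-≈ε {suc r} (λ j → D (suc (toℕ j)) L.1# * D (r ∸ toℕ j) t) λ j → L.trans (L.*-congʳ (D-1 (toℕ j))) (L.zeroˡ _)))
      (L.+-identityʳ _)))
    leibniz-power (suc a) (suc r) r<q t = begin
      D (suc r) (x * s * t)                                       ≈⟨ D-cong (suc r) (L.*-assoc x s t) ⟩
      D (suc r) (x * (s * t))                                     ≈⟨ D-suc-x* r r<q (s * t) ⟩
      x * D (suc r) (s * t) + D r (s * t)
        ≈⟨ L.+-cong (L.*-congˡ (leibniz-power a (suc r) r<q t)) (leibniz-power a r (ℕ.<-trans (ℕ.n<1+n r) r<q) t) ⟩
      x * (D 0 s * D (suc r) t + rest) + leibnizSum r s t         ≈⟨ L.+-congʳ (L.distribˡ x _ _) ⟩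
      x * (D 0 s * D (suc r) t) + x * rest + leibnizSum r s t     ≈⟨ L.+-assoc _ _ _ ⟩
      x * (D 0 s * D (suc r) t) + (x * rest + leibnizSum r s t)   ≈⟨ L.+-cong head (L.sym tail) ⟩
      D 0 (x * s) * D (suc r) t + L.sum {suc r} (λ j → D (suc (toℕ j)) (x * s) * D (r ∸ toℕ j) t) ∎
      where
      s = x ^ a
      rest = L.sum {suc r} (λ j → D (suc (toℕ j)) s * D (r ∸ toℕ j) t)
      head : x * (D 0 s * D (suc r) t) ≈ D 0 (x * s) * D (suc r) t
      head = L.trans (L.sym (L.*-assoc _ _ _)) (L.*-congʳ (L.trans (L.*-congˡ (D-0 s)) (L.sym (D-0 (x * s)))))
      tail : L.sum {suc r} (λ j → D (suc (toℕ j)) (x * s) * D (r ∸ toℕ j) t) ≈ x * rest + leibnizSum r s t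
      tail = L.trans
        (L.sum-cong-≋ {suc r} λ j → L.trans
          (L.*-congʳ {D (r ∸ toℕ j) t} (D-suc-x* (toℕ j) (ℕ.≤-<-trans (toℕ<n j) r<q) s))
          (L.trans (L.distribʳ _ _ _) (L.+-congʳ (L.*-assoc x _ _))))
        (L.trans (L.∑-distrib-+ {suc r} (λ j → x * (D (suc (toℕ j)) s * D (r ∸ toℕ j) t)) (λ j → D (toℕ j) s * D (r ∸ toℕ j) t))
          (L.+-congʳ (L.sym (L.*-distribˡ-sum {suc r} x (λ j → D (suc (toℕ j)) s * D (r ∸ toℕ j) t)))))

    leibniz : ∀ r → r ℕ.< q → ∀ s t → D r (s * t) ≈ leibnizSum r s t
    leibniz r r<q s t = linear-ext
      (∘-linear (D-linear r) (*ʳ-linear t id-linear))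
      (sum-linear {suc r} (λ j s → D (toℕ j) s * D (r ∸ toℕ j) t) (λ j → *ʳ-linear (D (r ∸ toℕ j) t) (D-linear (toℕ j))))
      (λ k → leibniz-power (toℕ k) r r<q t) s

    -- On x^s with s < q the exponents only decrease, so the basis formula suffices and
    -- `choose-choose` compares the coefficients. For i + j ≥ q both sides are zero, in line with
    -- t_i t_j = 0.
    D-∘ : ∀ i j y → D i (D j y) ≈ ((i ℕ.+ j) C j) ×ᴺ D (i ℕ.+ j) y
    D-∘ i j = linear-ext (∘-linear (D-linear i) (D-linear j)) (×-linear ((i ℕ.+ j) C j) (D-linear (i ℕ.+ j)))
      λ k → on-power (toℕ k) (toℕ<n k)
      where
      on-power : ∀ s → s ℕ.< q → D i (D j (x ^ s)) ≈ ((i ℕ.+ j) C j) ×ᴺ D (i ℕ.+ j) (x ^ s)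
      on-power s s<q = begin
        D i (D j (x ^ s))                           ≈⟨ D-cong i (D-power-< j s<q) ⟩
        D i ((s C j) ×ᴺ x ^ (s ∸ j))                ≈⟨ g-× (D-linear i) (s C j) _ ⟩
        (s C j) ×ᴺ D i (x ^ (s ∸ j))                ≈⟨ L.×-congʳ (s C j) (D-power-< i (ℕ.≤-<-trans (ℕ.m∸n≤m s j) s<q)) ⟩
        (s C j) ×ᴺ ((s ∸ j) C i) ×ᴺ x ^ (s ∸ j ∸ i) ≈⟨ L.×-assocˡ _ (s C j) ((s ∸ j) C i) ⟩
        ((s C j) ℕ.* ((s ∸ j) C i)) ×ᴺ x ^ (s ∸ j ∸ i)
          ≈⟨ L.×-cong (choose-choose s i j) (L.^-congʳ x (≡.trans (ℕ.∸-+-assoc s j i) (cong (s ∸_) (ℕ.+-comm j i)))) ⟩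
        (((i ℕ.+ j) C j) ℕ.* (s C (i ℕ.+ j))) ×ᴺ x ^ (s ∸ (i ℕ.+ j))
          ≈⟨ L.×-assocˡ _ ((i ℕ.+ j) C j) (s C (i ℕ.+ j)) ⟨
        ((i ℕ.+ j) C j) ×ᴺ derivative (i ℕ.+ j) s   ≈⟨ L.×-congʳ ((i ℕ.+ j) C j) (D-power-< (i ℕ.+ j) s<q) ⟨
        ((i ℕ.+ j) C j) ×ᴺ D (i ℕ.+ j) (x ^ s)      ∎

    private instance
      p≢0 = prime⇒nonZero p-prime

    -- Only the two extreme terms of the Leibniz sum for x^P · x^s survive, so adding P to the
    -- exponent adds 1 to the coefficient.
    module _ (j : ℕ) (j<n : j ℕ.< n) where
      private
        P = p ℕ.^ j
        instance
          P≢0 = m^n≢0 p j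
        P<q : P ℕ.< p ℕ.^ n
        P<q = ℕ.^-monoʳ-< p (ℕ.nonTrivial⇒n>1 p {{prime⇒nonTrivial p-prime}}) j<n

        derivative-P-step : ∀ s → derivative P (P ℕ.+ s) ≈ x ^ P * derivative P s + x ^ s
        derivative-P-step s = begin
          derivative P (P ℕ.+ s)                 ≈⟨ D-power P P<q (P ℕ.+ s) ⟨
          D P (x ^ (P ℕ.+ s))                    ≈⟨ D-cong P (L.^-homo-* x P s) ⟩
          D P (x ^ P * x ^ s)                    ≈⟨ leibniz P P<q (x ^ P) (x ^ s) ⟩
          leibnizSum P (x ^ P) (x ^ s)           ≈⟨ sum-ends P (λ k → D k (x ^ P) * D (P ∸ k) (x ^ s)) inner≈0 ⟩
          D 0 (x ^ P) * D P (x ^ s) + D P (x ^ P) * D (P ∸ P) (x ^ s)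
            ≈⟨ L.+-cong (L.*-cong (D-0 _) (D-power P P<q s))
                 (L.*-cong (L.trans (D-power P P<q P) (derivative-refl P))
                   (L.trans (L.reflexive (cong (λ r → D r (x ^ s)) (ℕ.n∸n≡0 P))) (D-0 _))) ⟩
          x ^ P * derivative P s + L.1# * x ^ s  ≈⟨ L.+-congˡ (L.*-identityˡ _) ⟩
          x ^ P * derivative P s + x ^ s         ∎
          where
          inner≈0 : ∀ k → 0 ℕ.< k → k ℕ.< P → D k (x ^ P) * D (P ∸ k) (x ^ s) ≈ L.0#
          inner≈0 k 0<k k<P = L.trans (L.*-congʳ (L.trans (D-power k (ℕ.<-trans k<P P<q) P)
            (∣⇒×≈0 _ (prime-power∣choose p-prime j k 0<k k<P)))) (L.zeroˡ _)

        derivative-multiple : ∀ m r → r ℕ.< P → derivative P (r ℕ.+ m ℕ.* P) ≈ m ×ᴺ x ^ (r ℕ.+ m ℕ.* P ∸ P)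
        derivative-multiple zero    r r<P = derivative-< (subst (ℕ._< P) (≡.sym (ℕ.+-identityʳ r)) r<P)
        derivative-multiple (suc m) r r<P = begin
          derivative P (r ℕ.+ (P ℕ.+ m ℕ.* P))  ≈⟨ L.reflexive (cong (derivative P) r+≡) ⟩
          derivative P (P ℕ.+ s)                ≈⟨ derivative-P-step s ⟩
          x ^ P * derivative P s + x ^ s        ≈⟨ L.+-congʳ (L.*-congˡ (derivative-multiple m r r<P)) ⟩
          x ^ P * m ×ᴺ x ^ (s ∸ P) + x ^ s      ≈⟨ L.+-congʳ (L.×-comm-* m (x ^ P) (x ^ (s ∸ P))) ⟩
          m ×ᴺ (x ^ P * x ^ (s ∸ P)) + x ^ s    ≈⟨ L.+-congʳ (raise m) ⟩
          m ×ᴺ x ^ s + x ^ s                    ≈⟨ L.+-comm _ _ ⟩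
          suc m ×ᴺ x ^ s                        ≈⟨ L.×-congʳ (suc m) (L.^-congʳ x (≡.trans (cong (_∸ P) r+≡) (ℕ.m+n∸m≡n P s))) ⟨
          suc m ×ᴺ x ^ (r ℕ.+ (P ℕ.+ m ℕ.* P) ∸ P) ∎
          where
          s = r ℕ.+ m ℕ.* P
          r+≡ : r ℕ.+ (P ℕ.+ m ℕ.* P) ≡ P ℕ.+ s
          r+≡ = ≡.trans (≡.sym (ℕ.+-assoc r P (m ℕ.* P))) (≡.trans (cong (ℕ._+ m ℕ.* P) (ℕ.+-comm r P)) (ℕ.+-assoc P r (m ℕ.* P)))
          -- The exponents match only when the truncated subtraction is exact. For m = 0 it may fail
          -- to be, but then the multiple is zero; for m > 0 the exponent is at least P.
          raise : ∀ m → m ×ᴺ (x ^ P * x ^ (r ℕ.+ m ℕ.* P ∸ P)) ≈ m ×ᴺ x ^ (r ℕ.+ m ℕ.* P)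
          raise zero    = L.refl
          raise (suc m) = L.×-congʳ (suc m) (L.trans (L.sym (L.^-homo-* x P (r ℕ.+ suc m ℕ.* P ∸ P)))
            (L.^-congʳ x (ℕ.m+[n∸m]≡n (ℕ.≤-trans (ℕ.m≤m+n P (m ℕ.* P)) (ℕ.m≤n+m (suc m ℕ.* P) r)))))

      -- The coefficient ⌊s / P⌋ is reduced modulo p to its lowest digit, so that it is below p and,
      -- when nonzero, prime to p.
      D-prime-power : ∀ s → D P (x ^ s) ≈ digit p-prime j s ×ᴺ x ^ (s ∸ P)
      D-prime-power s = begin
        D P (x ^ s)                        ≈⟨ D-power P P<q s ⟩
        derivative P s                     ≈⟨ subst (λ u → derivative P u ≈ m ×ᴺ x ^ (u ∸ P)) (≡.sym (m≡m%n+[m/n]*n s P))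
                                                (derivative-multiple m (s % P) (m%n<n s P)) ⟩
        m ×ᴺ y                             ≈⟨ L.×-cong (m≡m%n+[m/n]*n m p) L.refl ⟩
        (m % p ℕ.+ m / p ℕ.* p) ×ᴺ y       ≈⟨ L.×-homo-+ y (m % p) (m / p ℕ.* p) ⟩
        (m % p) ×ᴺ y + (m / p ℕ.* p) ×ᴺ y  ≈⟨ L.+-congˡ (∣⇒×≈0 y (ℕ.n∣m*n (m / p))) ⟩
        (m % p) ×ᴺ y + L.0#                ≈⟨ L.+-identityʳ _ ⟩
        (m % p) ×ᴺ y                       ∎
        where
        m = s / P
        y = x ^ (s ∸ P)

    -- The action of 𝒜(n) on L and the module algebra axioms

    private
      module H = RawHopfAlgebra (𝒜 K p n)
      module Hˢ = LeftModule H.space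
      module L⊗H = Tensor {R = Field.commutativeRing K} (Extension.asModule E) H.space
      module L⊗L = Tensor {R = Field.commutativeRing K} (Extension.asModule E) (Extension.asModule E)
      module H⊗H = Tensor {R = Field.commutativeRing K} H.space H.space
    open DividedPower K p n using (t; δ)
    open CommutativeMonoidSum Hˢ.+ᴹ-commutativeMonoid using () renaming (sum to sumᴴ)
    open CommutativeMonoidSum (AbelianGroup.commutativeMonoid H⊗H.abelianGroup) using () renaming (sum to sumᴴᴴ)
    open CommutativeMonoidMult Hˢ.+ᴹ-commutativeMonoid using () renaming (_×_ to _×ᴴ_)

    δ-refl : ∀ i → δ i i K.≈ K.1#
    δ-refl zero    = K.refl
    δ-refl (suc i) = δ-refl i

    δ-≢ : ∀ i j → i ≢ j → δ i j K.≈ K.0#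
    δ-≢ zero    zero    i≢j = contradiction ≡.refl i≢j
    δ-≢ zero    (suc j) _   = K.refl
    δ-≢ (suc i) zero    _   = K.refl
    δ-≢ (suc i) (suc j) i≢j = δ-≢ i j (i≢j ∘ cong suc)

    infixr 8 _·_
    _·_ : H.Carrier → L.Carrier → L.Carrier
    h · y = lincomb h (λ r → D (toℕ r) y)

    ·-linear : ∀ h → IsLinear (h ·_)
    ·-linear h = sum-linear {q} (λ r y → ι (h r) * D (toℕ r) y) (λ r → *ˡ-linear (ι (h r)) (D-linear (toℕ r)))

    t-· : ∀ r y → t r · y ≈ D r y
    t-· r y = cases (r ℕ.<? q)
      where
      cases : Dec (r ℕ.< q) → t r · y ≈ D r y
      cases (yes r<q) = L.trans
        (sum-single {q} (λ k → ι (δ (toℕ k) r) * D (toℕ k) y) (fromℕ< r<q) λ k k≢r → L.trans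
          (L.*-congʳ (ι≈0 (δ-≢ (toℕ k) r λ k≡r → k≢r (toℕ-injective (≡.trans k≡r (≡.sym (toℕ-fromℕ< r<q)))))))
          (L.zeroˡ _))
        (L.trans (L.reflexive (cong (λ k → ι (δ k r) * D k y) (toℕ-fromℕ< r<q)))
          (L.trans (L.*-congʳ (L.trans (ι-cong (δ-refl r)) 1#-homo)) (L.*-identityˡ _)))
      cases (no r≮q) = L.trans
        (sum-≈ε {q} (λ k → ι (δ (toℕ k) r) * D (toℕ k) y) λ k → L.trans
          (L.*-congʳ (ι≈0 (δ-≢ (toℕ k) r λ k≡r → r≮q (subst (ℕ._< q) k≡r (toℕ<n k)))))
          (L.zeroˡ _))
        (L.sym (D-≥q (ℕ.≮⇒≥ r≮q) y))

    +-· : ∀ h h′ y → (h H.+ h′) · y ≈ h · y + h′ · y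
    +-· h h′ y = lincomb-+ h h′ (λ r → D (toℕ r) y)

    *ₗ-· : ∀ k h y → (k H.*ₗ h) · y ≈ ι k * (h · y)
    *ₗ-· k h y = lincomb-* k h (λ r → D (toℕ r) y)

    0-· : ∀ y → H.0# · y ≈ L.0#
    0-· y = sum-≈ε {q} (λ r → ι K.0# * D (toℕ r) y) λ r → L.trans (L.*-congʳ 0#-homo) (L.zeroˡ _)

    sum-· : ∀ {d} (f : Vector H.Carrier d) y → sumᴴ f · y ≈ L.sum (λ i → f i · y)
    sum-· {zero}  f y = 0-· y
    sum-· {suc d} f y = L.trans (+-· (f zero) (sumᴴ (f ∘ suc)) y) (L.+-congˡ (sum-· (f ∘ suc) y))

    ×-· : ∀ m h y → (m ×ᴴ h) · y ≈ m ×ᴺ (h · y)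
    ×-· zero    h y = 0-· y
    ×-· (suc m) h y = L.trans (+-· h (m ×ᴴ h) y) (L.+-congˡ (×-· m h y))

    *-· : ∀ h h′ y → (h H.* h′) · y ≈ h · (h′ · y)
    *-· h h′ y = begin
      (h H.* h′) · y
        ≈⟨ L.trans (sum-· {q} (λ i → sumᴴ {q} (product i)) y) (L.sum-cong-≋ {q} λ i → sum-· {q} (product i) y) ⟩
      L.sum {q} (λ i → L.sum {q} (λ j → product i j · y))
        ≈⟨ L.sum-cong-≋ {q} (λ i → L.sum-cong-≋ {q} (λ j → product-· i j)) ⟩
      L.sum {q} (λ i → L.sum {q} (λ j → ι (h i) * (ι (h′ j) * D (toℕ i) (D (toℕ j) y))))
        ≈⟨ L.sum-cong-≋ {q} (λ i → L.*-distribˡ-sum {q} (ι (h i)) (λ j → ι (h′ j) * D (toℕ i) (D (toℕ j) y))) ⟨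
      L.sum {q} (λ i → ι (h i) * lincomb h′ (λ j → D (toℕ i) (D (toℕ j) y)))
        ≈⟨ L.sum-cong-≋ {q} (λ i → L.*-congˡ {ι (h i)} (g-lincomb (D-linear (toℕ i)) h′ (λ j → D (toℕ j) y))) ⟨
      h · (h′ · y) ∎
      where
      product : Fin q → Fin q → H.Carrier
      product i j = (h i K.* h′ j) H.*ₗ (((toℕ i ℕ.+ toℕ j) C toℕ j) ×ᴴ t (toℕ i ℕ.+ toℕ j))
      product-· : ∀ i j → product i j · y ≈ ι (h i) * (ι (h′ j) * D (toℕ i) (D (toℕ j) y))
      product-· i j = begin
        product i j · y
          ≈⟨ *ₗ-· (h i K.* h′ j) _ y ⟩
        ι (h i K.* h′ j) * ((((toℕ i ℕ.+ toℕ j) C toℕ j) ×ᴴ t (toℕ i ℕ.+ toℕ j)) · y)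
          ≈⟨ L.*-cong (*-homo (h i) (h′ j)) (×-· ((toℕ i ℕ.+ toℕ j) C toℕ j) (t (toℕ i ℕ.+ toℕ j)) y) ⟩
        ι (h i) * ι (h′ j) * ((toℕ i ℕ.+ toℕ j) C toℕ j) ×ᴺ (t (toℕ i ℕ.+ toℕ j) · y)
          ≈⟨ L.*-assoc _ _ _ ⟩
        ι (h i) * (ι (h′ j) * ((toℕ i ℕ.+ toℕ j) C toℕ j) ×ᴺ (t (toℕ i ℕ.+ toℕ j) · y))
          ≈⟨ L.*-congˡ (L.*-congˡ (L.×-congʳ ((toℕ i ℕ.+ toℕ j) C toℕ j) (t-· (toℕ i ℕ.+ toℕ j) y))) ⟩
        ι (h i) * (ι (h′ j) * ((toℕ i ℕ.+ toℕ j) C toℕ j) ×ᴺ D (toℕ i ℕ.+ toℕ j) y)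
          ≈⟨ L.*-congˡ (L.*-congˡ (D-∘ (toℕ i) (toℕ j) y)) ⟨
        ι (h i) * (ι (h′ j) * D (toℕ i) (D (toℕ j) y)) ∎

    action : Action E (𝒜 K p n)
    action = record
      { _·_      = _·_
      ; ·-cong   = λ {h} {h′} h≈h′ y≈y′ → lincomb-cong {q} h≈h′ (λ r → D-cong (toℕ r) y≈y′)
      ; ·-addˡ   = +-·
      ; ·-scaleˡ = *ₗ-·
      ; ·-addʳ   = λ h → g-+ (·-linear h)
      ; ·-scaleʳ = λ k h → g-* (·-linear h) k
      ; ·-*      = *-·
      ; ·-1      = λ y → L.trans (t-· 0 y) (D-0 y)
      }

    open Action action using (act⊗; evaluate; canonicalMap; IsModuleAlgebra; IsHopfGalois)

    isModuleAlgebra : IsModuleAlgebra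
    isModuleAlgebra = record { act-* = act-* ; act-1 = act-1 }
      where
      μ-sum : ∀ {d} (z : Vector H⊗H.Tensors d) y y′ →
              μ E (act⊗ (sumᴴᴴ z) y y′) ≈ L.sum (λ i → μ E (act⊗ (z i) y y′))
      μ-sum {zero}  z y y′ = L.refl
      μ-sum {suc d} z y y′ = L.+-congˡ (μ-sum (z ∘ suc) y y′)

      act-* : ∀ h y y′ → h · (y * y′) ≈ μ E (act⊗ (H.Δ h) y y′)
      act-* h y y′ = L.sym (L.trans (μ-sum {q} (λ r → sumᴴᴴ (terms r)) y y′) (L.sum-cong-≋ {q} on-basis))
        where
        terms : (r : Fin q) → Vector H⊗H.Tensors (suc (toℕ r))
        terms r j = (h r H.*ₗ t (toℕ j)) H⊗H.⊗ t (toℕ r ∸ toℕ j)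
        on-basis : ∀ r → μ E (act⊗ (sumᴴᴴ (terms r)) y y′) ≈ ι (h r) * D (toℕ r) (y * y′)
        on-basis r = begin
          μ E (act⊗ (sumᴴᴴ (terms r)) y y′)
            ≈⟨ μ-sum (terms r) y y′ ⟩
          L.sum {suc (toℕ r)} (λ j → ((h r H.*ₗ t (toℕ j)) · y) * (t (toℕ r ∸ toℕ j) · y′))
            ≈⟨ L.sum-cong-≋ {suc (toℕ r)} (λ j → L.trans
                 (L.*-cong (L.trans (*ₗ-· (h r) (t (toℕ j)) y) (L.*-congˡ (t-· (toℕ j) y))) (t-· (toℕ r ∸ toℕ j) y′))
                 (L.*-assoc _ _ _)) ⟩
          L.sum {suc (toℕ r)} (λ j → ι (h r) * (D (toℕ j) y * D (toℕ r ∸ toℕ j) y′))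
            ≈⟨ L.*-distribˡ-sum {suc (toℕ r)} (ι (h r)) (λ j → D (toℕ j) y * D (toℕ r ∸ toℕ j) y′) ⟨
          ι (h r) * leibnizSum (toℕ r) y y′
            ≈⟨ L.*-congˡ (leibniz (toℕ r) (toℕ<n r) y y′) ⟨
          ι (h r) * D (toℕ r) (y * y′) ∎

      D-1-δ : ∀ r → D r L.1# ≈ ι (δ 0 r)
      D-1-δ zero    = L.trans (D-0 L.1#) (L.sym 1#-homo)
      D-1-δ (suc r) = L.trans (D-1 r) (L.sym 0#-homo)

      act-1 : ∀ h → h · L.1# ≈ ι (H.ε h) * L.1#
      act-1 h = L.trans (L.sum-cong-≋ {q} λ r → L.trans (L.*-congˡ {ι (h r)} (D-1-δ (toℕ r))) (L.sym (*-homo (h r) (δ 0 (toℕ r)))))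
        (L.trans (L.sym (ι-sum {q} (λ r → h r K.* δ 0 (toℕ r)))) (L.sym (L.*-identityʳ _)))

    -- Bijectivity of the map from L ⊗ 𝒜(n) to End(L)

    private
      open L⊗H using (_≈⊗_; _⊗_; _⊕_; 𝟎; ⊖_; ≈-refl; ≈-sym; ≈-trans; ⊕-cong; ⊖-cong; ⊗-cong; ⊗-distribˡ; ⊗-distribʳ; ⊗-balanced)
      module T where
        open AbelianGroup L⊗H.abelianGroup public
        open GroupProps group public
        open AbelianGroupProps L⊗H.abelianGroup public using (⁻¹-∙-comm)
        open CommutativeMonoidSum commutativeMonoid public

    evaluate-linear : ∀ z → IsLinear (evaluate z)
    evaluate-linear z = record { g-cong = ⟦⟧-cong ; g-+ = +ᴹ-homo ; g-* = *ₗ-homo }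
      where
      open LeftModuleMorphisms (LeftModule.rawLeftModule (Extension.asModule E)) (LeftModule.rawLeftModule (Extension.asModule E))
      open IsLeftModuleHomomorphism (proj₂ (canonicalMap z)) using (⟦⟧-cong; +ᴹ-homo; *ₗ-homo)

    evaluate-resp : ∀ {z w} → z ≈⊗ w → ∀ y → evaluate z y ≈ evaluate w y
    evaluate-resp ≈-refl y = L.refl
    evaluate-resp (≈-sym e) y = L.sym (evaluate-resp e y)
    evaluate-resp (≈-trans e e′) y = L.trans (evaluate-resp e y) (evaluate-resp e′ y)
    evaluate-resp (⊕-cong e e′) y = L.+-cong (evaluate-resp e y) (evaluate-resp e′ y)
    evaluate-resp (⊖-cong e) y = L.-‿cong (evaluate-resp e y)
    evaluate-resp (L⊗H.⊕-assoc _ _ _) y = L.+-assoc _ _ _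
    evaluate-resp (L⊗H.⊕-comm _ _) y = L.+-comm _ _
    evaluate-resp (L⊗H.⊕-identityˡ _) y = L.+-identityˡ _
    evaluate-resp (L⊗H.⊖-inverseˡ _) y = L.-‿inverseˡ _
    evaluate-resp (⊗-cong {s} {s′} {h} {h′} s≈s′ h≈h′) y =
      L.*-cong s≈s′ (lincomb-cong {q} {h} {h′} h≈h′ (λ _ → L.refl))
    evaluate-resp (⊗-distribʳ s s′ h) y = L.distribʳ (h · y) s s′
    evaluate-resp (⊗-distribˡ s h h′) y = L.trans (L.*-congˡ (+-· h h′ y)) (L.distribˡ s _ _)
    evaluate-resp (⊗-balanced k s h) y = L.trans (L.*-assoc _ _ _)
      (L.trans (L.x∙yz≈y∙xz (ι k) s (h · y)) (L.*-congˡ (L.sym (*ₗ-· k h y))))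

    -- L ⊗ 𝒜(n) is free over L on the 1 ⊗ t_r. Tensors being mere expressions up to the generated
    -- equality, these representatives are what allows coefficients to be compared.
    normalForm : Vector L.Carrier q → L⊗H.Tensors
    normalForm s = T.sum λ r → s r ⊗ t (toℕ r)

    evaluate-normalForm : ∀ s y → evaluate (normalForm s) y ≈ L.sum {q} (λ r → s r * D (toℕ r) y)
    evaluate-normalForm s y = L.trans (evaluate-sum {q} (λ r → s r ⊗ t (toℕ r)))
      (L.sum-cong-≋ {q} λ r → L.*-congˡ {s r} (t-· (toℕ r) y))
      where
      evaluate-sum : ∀ {d} (z : Vector L⊗H.Tensors d) → evaluate (T.sum z) y ≈ L.sum (λ i → evaluate (z i) y)
      evaluate-sum {zero}  z = L.refl
      evaluate-sum {suc d} z = L.+-congˡ (evaluate-sum (z ∘ suc))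

    ⊗-zeroˡ : ∀ h → L.0# ⊗ h ≈⊗ 𝟎
    ⊗-zeroˡ h = T.identityˡ-unique (L.0# ⊗ h) (L.0# ⊗ h)
      (≈-trans (≈-sym (⊗-distribʳ L.0# L.0# h)) (⊗-cong (L.+-identityˡ L.0#) (λ _ → K.refl)))

    ⊗-zeroʳ : ∀ s → s ⊗ H.0# ≈⊗ 𝟎
    ⊗-zeroʳ s = T.identityˡ-unique (s ⊗ H.0#) (s ⊗ H.0#)
      (≈-trans (≈-sym (⊗-distribˡ s H.0# H.0#)) (⊗-cong L.refl (λ _ → K.+-identityˡ K.0#)))

    ⊗-sum : ∀ {d} s (f : Vector H.Carrier d) → s ⊗ sumᴴ f ≈⊗ T.sum (λ i → s ⊗ f i)
    ⊗-sum {zero}  s f = ⊗-zeroʳ s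
    ⊗-sum {suc d} s f = ≈-trans (⊗-distribˡ s (f zero) (sumᴴ (f ∘ suc))) (⊕-cong ≈-refl (⊗-sum s (f ∘ suc)))

    ⊖-sum : ∀ {d} (z : Vector L⊗H.Tensors d) → ⊖ T.sum z ≈⊗ T.sum (λ i → ⊖ z i)
    ⊖-sum {zero}  z = T.ε⁻¹≈ε
    ⊖-sum {suc d} z = ≈-trans (≈-sym (T.⁻¹-∙-comm (z zero) (T.sum (z ∘ suc)))) (⊕-cong ≈-refl (⊖-sum (z ∘ suc)))

    t-expansion : ∀ (h : H.Carrier) (i : Fin q) → h i K.≈ sumᴴ (λ (r : Fin q) → h r H.*ₗ t (toℕ r)) i
    t-expansion h i = K.sym (K.trans (sumᴴ-lookup {q} (λ r → h r H.*ₗ t (toℕ r)))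
      (K.trans (sum-singleᴷ {q} (λ r → h r K.* δ (toℕ i) (toℕ r)) i λ r r≢i → K.trans
                 (K.*-congˡ (δ-≢ (toℕ i) (toℕ r) λ i≡r → r≢i (toℕ-injective (≡.sym i≡r)))) (K.zeroʳ (h r)))
               (K.trans (K.*-congˡ (δ-refl (toℕ i))) (K.*-identityʳ (h i)))))
      where
      open SumLemmas K.+-commutativeMonoid using () renaming (sum-single to sum-singleᴷ)
      sumᴴ-lookup : ∀ {d} (f : Vector H.Carrier d) → sumᴴ f i K.≈ K.sum (λ r → f r i)
      sumᴴ-lookup {zero}  f = K.refl
      sumᴴ-lookup {suc d} f = K.+-congˡ (sumᴴ-lookup (f ∘ suc))

    coefficients : L⊗H.Tensors → Vector L.Carrier q
    coefficients (s ⊗ h) r = ι (h r) * s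
    coefficients (z ⊕ w) r = coefficients z r + coefficients w r
    coefficients 𝟎       r = L.0#
    coefficients (⊖ z)   r = L.- coefficients z r

    normalise : ∀ z → z ≈⊗ normalForm (coefficients z)
    normalise (s ⊗ h) = ≈-trans (⊗-cong L.refl (t-expansion h))
      (≈-trans (⊗-sum {q} s (λ r → h r H.*ₗ t (toℕ r)))
        (T.sum-cong-≋ {q} λ r → ≈-sym (⊗-balanced (h r) s (t (toℕ r)))))
    normalise (z ⊕ w) = ≈-trans (⊕-cong (normalise z) (normalise w))
      (≈-trans (≈-sym (T.∑-distrib-+ {q} (λ r → coefficients z r ⊗ t (toℕ r)) (λ r → coefficients w r ⊗ t (toℕ r))))
        (T.sum-cong-≋ {q} λ r → ≈-sym (⊗-distribʳ (coefficients z r) (coefficients w r) (t (toℕ r)))))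
    normalise 𝟎 = ≈-sym (SumLemmas.sum-≈ε T.commutativeMonoid {q} (λ r → L.0# ⊗ t (toℕ r)) λ r → ⊗-zeroˡ (t (toℕ r)))
    normalise (⊖ z) = ≈-trans (⊖-cong (normalise z))
      (≈-trans (⊖-sum {q} (λ r → coefficients z r ⊗ t (toℕ r)))
        (T.sum-cong-≋ {q} λ r → ≈-sym (T.inverseˡ-unique _ _
          (≈-trans (≈-sym (⊗-distribʳ (L.- coefficients z r) (coefficients z r) (t (toℕ r))))
            (≈-trans (⊗-cong (L.-‿inverseˡ (coefficients z r)) (λ _ → K.refl)) (⊗-zeroˡ (t (toℕ r))))))))

    -- The matrix (D r (x^k))_{r,k} is unitriangular.
    D-independent : ∀ (s : Vector L.Carrier q) → (∀ y → L.sum {q} (λ r → s r * D (toℕ r) y) ≈ L.0#) →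
                    ∀ r → s r ≈ L.0#
    D-independent s s≈0 r = below (suc (toℕ r)) r ℕ.≤-refl
      where
      below : ∀ m r → toℕ r ℕ.< m → s r ≈ L.0#
      below (suc m) r r≤m = L.trans (L.sym (L.trans
          (L.*-congˡ (L.trans (D-power-< (toℕ r) (toℕ<n r)) (derivative-refl (toℕ r)))) (L.*-identityʳ (s r))))
        (L.trans (L.sym (sum-single {q} (λ i → s i * D (toℕ i) (powers r)) r off-diagonal)) (s≈0 (powers r)))
        where
        off-diagonal : ∀ i → i ≢ r → s i * D (toℕ i) (powers r) ≈ L.0#
        off-diagonal i i≢r with ℕ.<-cmp (toℕ i) (toℕ r)
        ... | tri< i<r _ _ = L.trans (L.*-congʳ (below m i (ℕ.<-≤-trans i<r (ℕ.s≤s⁻¹ r≤m)))) (L.zeroˡ _)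
        ... | tri≈ _ i≡r _ = contradiction (toℕ-injective i≡r) i≢r
        ... | tri> _ _ r<i = L.trans (L.*-congˡ (L.trans (D-power-< (toℕ i) (toℕ<n r)) (derivative-< r<i))) (L.zeroʳ _)

    -- The formal difference of z and w evaluates to zero, so its coefficients vanish by
    -- `D-independent`, and z and w have the same normal form.
    canonicalMap-injective : ∀ {z w} → (∀ y → evaluate z y ≈ evaluate w y) → z ≈⊗ w
    canonicalMap-injective {z} {w} z≈w = ≈-trans (normalise z)
      (≈-trans (T.sum-cong-≋ {q} λ r → ⊗-cong (coefficients≈ r) (λ _ → K.refl)) (≈-sym (normalise w)))
      where
      difference : ∀ y → L.sum {q} (λ r → coefficients (z ⊕ (⊖ w)) r * D (toℕ r) y) ≈ L.0#
      difference y = begin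
        L.sum {q} (λ r → coefficients (z ⊕ (⊖ w)) r * D (toℕ r) y) ≈⟨ evaluate-normalForm (coefficients (z ⊕ (⊖ w))) y ⟨
        evaluate (normalForm (coefficients (z ⊕ (⊖ w)))) y         ≈⟨ evaluate-resp (normalise (z ⊕ (⊖ w))) y ⟨
        evaluate z y L.- evaluate w y                              ≈⟨ L.+-congʳ (z≈w y) ⟩
        evaluate w y L.- evaluate w y                              ≈⟨ L.-‿inverseʳ _ ⟩
        L.0#                                                       ∎
      coefficients≈ : ∀ r → coefficients z r ≈ coefficients w r
      coefficients≈ r = x∙y⁻¹≈ε⇒x≈y _ _ (D-independent (coefficients (z ⊕ (⊖ w))) difference r)
        where open GroupProps L.+-group using (x∙y⁻¹≈ε⇒x≈y)

    -- Forward substitution in the unitriangular system: s ⊗ t_m does not disturb the values at x^k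
    -- for k < m, where D_m is zero, and contributes exactly s at x^m.
    interpolate : (f : L.Carrier → L.Carrier) → ∀ m → m ℕ.≤ q →
                  Σ L⊗H.Tensors λ z → ∀ k → k ℕ.< m → evaluate z (x ^ k) ≈ f (x ^ k)
    interpolate f zero    _   = 𝟎 , λ _ ()
    interpolate f (suc m) m<q = z ⊕ (s ⊗ t m) , λ k k<1+m → agree k k<1+m (k ℕ.≟ m)
      where
      open GroupProps L.+-group using (//-rightDividesˡ)
      previous = interpolate f m (ℕ.<⇒≤ m<q)
      z = proj₁ previous
      s = f (x ^ m) L.- evaluate z (x ^ m)
      agree : ∀ k → k ℕ.< suc m → Dec (k ≡ m) → evaluate z (x ^ k) + s * (t m · x ^ k) ≈ f (x ^ k)
      agree k k<1+m (yes ≡.refl) = L.trans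
        (L.+-congˡ (L.trans (L.*-congˡ (L.trans (t-· m (x ^ m)) (L.trans (D-power-< m m<q) (derivative-refl m)))) (L.*-identityʳ s)))
        (L.trans (L.+-comm _ _) (//-rightDividesˡ (evaluate z (x ^ m)) (f (x ^ m))))
      agree k k<1+m (no k≢m) = L.trans
        (L.+-cong (proj₂ previous k k<m) (L.trans (L.*-congˡ (L.trans (t-· m (x ^ k))
          (L.trans (D-power-< m (ℕ.<-trans k<m m<q)) (derivative-< k<m)))) (L.zeroʳ s)))
        (L.+-identityʳ _)
        where k<m = ℕ.≤∧≢⇒< (ℕ.s≤s⁻¹ k<1+m) k≢m

    isHopfGalois : IsHopfGalois
    isHopfGalois = record
      { isModuleAlgebra = isModuleAlgebra
      ; bijective = (λ {z} {w} → canonicalMap-injective {z} {w}) , surjective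
      }
      where
      surjective : ∀ (f : End E) → Σ L⊗H.Tensors λ z → ∀ {w} → w ≈⊗ z → ∀ y → evaluate w y ≈ proj₁ f y
      surjective (f , f-hom) =
        let z , z≈f = interpolate f q ℕ.≤-refl in z , λ w≈z y → L.trans (evaluate-resp w≈z y)
          (linear-ext (evaluate-linear z) f-linear (λ k → z≈f (toℕ k) (toℕ<n k)) y)
        where
        open LeftModuleMorphisms (LeftModule.rawLeftModule (Extension.asModule E)) (LeftModule.rawLeftModule (Extension.asModule E))
        open IsLeftModuleHomomorphism f-hom using (⟦⟧-cong; +ᴹ-homo; *ₗ-homo)
        f-linear : IsLinear f
        f-linear = record { g-cong = ⟦⟧-cong ; g-+ = +ᴹ-homo ; g-* = *ₗ-homo }

    -- The scaffold of infinite tolerance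

    module Scaffold
      (vK : NormalizedValuation K) (vL : NormalizedValuation L)
      (ramification : Extension.HasRamificationIndex E vK vL (p ℕ.^ n))
      (residue : NormalizedValuation.HasResidueCharacteristic vK p)
      (b : ℕ) (b⊥p : Coprime b p) (v-x : NormalizedValuation.v vL x ≡ [ ℤ.- + b ])
      where
      open RamifiedProps E vK vL
      open IntegerUnits vK
      private
        module vK = NormalizedValuation vK
        module vL where
          open NormalizedValuation vL public
          open ValuationProps vL public
        instance
          q≢0 = m^n≢0 p n
        b⊥q : Coprime b q
        b⊥q = coprime-^ʳ n b⊥p

      -- The solution is sealed: from here on only the congruence and its quotient `f` matter, never
      -- how they were computed.
      abstract
        congruence-solution : ∀ τ → Σ (Fin q) λ a → + q Signed.∣ + b ℤ.* + toℕ a ℤ.+ τ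
        congruence-solution = solve-congruence b q b⊥q

        f : ℤ → ℤ
        f τ = Signed._∣_.quotient (proj₂ (congruence-solution τ))

        f-spec : ∀ τ → + b ℤ.* + toℕ (proj₁ (congruence-solution τ)) ℤ.+ τ ≡ f τ ℤ.* + q
        f-spec τ = Signed._∣_.equality (proj₂ (congruence-solution τ))

      𝔞 : ℤ → Fin q
      𝔞 τ = proj₁ (congruence-solution τ)

      exponent : ℤ → ℕ
      exponent τ = toℕ (𝔞 τ)

      q∣b𝔞+ : ∀ τ → + q Signed.∣ + b ℤ.* + exponent τ ℤ.+ τ
      q∣b𝔞+ τ = proj₂ (congruence-solution τ)

      exponent-unique : ∀ τ a → a ℕ.< q → + q Signed.∣ + b ℤ.* + a ℤ.+ τ → exponent τ ≡ a
      exponent-unique τ a a<q q∣ = coprime-∣-⇒≡ (+ b) (exponent τ) a (ℕ.sym b⊥q) (toℕ<n (𝔞 τ)) a<q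
        (Signed.∣⇒∣ᵤ (subst (+ q Signed.∣_) (cancel (+ b ℤ.* + exponent τ) τ (+ b ℤ.* + a)) (Signed.∣m∣n⇒∣m-n (q∣b𝔞+ τ) q∣)))
        where
        cancel : ∀ x τ y → (x ℤ.+ τ) ℤ.- (y ℤ.+ τ) ≡ x ℤ.- y
        cancel = ℤ-solve-∀

      𝔟𝔞 : ∀ τ → 𝔟 p-prime {n} (λ _ → + b) (exponent τ) ≡ ℤ.- τ [mod q ]
      𝔟𝔞 τ = Signed.∣⇒∣ᵤ (subst (+ q Signed.∣_) (≡.sym (≡.trans
        (cong (ℤ._- (ℤ.- τ)) (𝔟-const p-prime n (+ b) (exponent τ) (toℕ<n (𝔞 τ)))) (rearrange (+ exponent τ) (+ b) τ))) (q∣b𝔞+ τ))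
        where
        rearrange : ∀ a b τ → a ℤ.* b ℤ.- (ℤ.- τ) ≡ b ℤ.* a ℤ.+ τ
        rearrange = ℤ-solve-∀

      λ′ : ℤ → L.Carrier
      λ′ τ = ι (π^ (f τ)) * x ^ exponent τ

      v-λ : ∀ τ → vL.v (λ′ τ) ≡ [ τ ]
      v-λ τ = ≡.trans (v-term ramification (v-π^ (f τ)) (vL.v-^ (exponent τ) v-x)) (cong [_] (≡.trans
          (cong (ℤ._+ (ℤ.- + b) ℤ.* + exponent τ) (≡.trans (ℤ.*-comm (+ q) (f τ)) (≡.sym (f-spec τ))))
          (cancel (+ b) (+ exponent τ) τ)))
        where
        cancel : ∀ b a τ → b ℤ.* a ℤ.+ τ ℤ.+ (ℤ.- b) ℤ.* a ≡ τ
        cancel = ℤ-solve-∀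

      -- Indices congruent modulo q share the exponent of x, so the ratio is one of powers of the
      -- uniformizer of K.
      λ-ratio : ∀ τ₁ τ₂ → τ₁ ≡ τ₂ [mod q ] → InBase (λ′ τ₁ * λ′ τ₂ L.⁻¹)
      λ-ratio τ₁ τ₂ τ₁≡τ₂ = π^ (f τ₁) K.* c₂ K.⁻¹ , (begin
          λ′ τ₁ * λ′ τ₂ L.⁻¹                              ≈⟨ L.*-congʳ λ₁≈ ⟩
          ι (π^ (f τ₁) K.* c₂ K.⁻¹) * λ′ τ₂ * λ′ τ₂ L.⁻¹  ≈⟨ L.*-assoc _ _ _ ⟩
          ι (π^ (f τ₁) K.* c₂ K.⁻¹) * (λ′ τ₂ * λ′ τ₂ L.⁻¹) ≈⟨ L.*-congˡ (L.inverseʳ (λ′ τ₂) (vL.finite⇒≉0 (v-λ τ₂))) ⟩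
          ι (π^ (f τ₁) K.* c₂ K.⁻¹) * L.1#                ≈⟨ L.*-identityʳ _ ⟩
          ι (π^ (f τ₁) K.* c₂ K.⁻¹)                       ∎)
        where
        c₂ = π^ (f τ₂)
        c₂≉0 = ValuationProps.finite⇒≉0 vK (v-π^ (f τ₂))
        regroup : ∀ b a τ₁ τ₂ → (b ℤ.* a ℤ.+ τ₁) ℤ.- (τ₁ ℤ.- τ₂) ≡ b ℤ.* a ℤ.+ τ₂
        regroup = ℤ-solve-∀
        exponent≡ : exponent τ₂ ≡ exponent τ₁
        exponent≡ = exponent-unique τ₂ (exponent τ₁) (toℕ<n (𝔞 τ₁)) (subst (+ q Signed.∣_)
          (regroup (+ b) (+ exponent τ₁) τ₁ τ₂) (Signed.∣m∣n⇒∣m-n (q∣b𝔞+ τ₁) (Signed.∣ᵤ⇒∣ τ₁≡τ₂)))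
        c₁≈ : ι (π^ (f τ₁)) ≈ ι (π^ (f τ₁) K.* c₂ K.⁻¹) * ι c₂
        c₁≈ = L.trans (ι-cong (K.sym (K.trans (K.*-assoc _ _ _) (K.trans (K.*-congˡ
          (FieldProps.inverseˡ K c₂ c₂≉0)) (K.*-identityʳ _))))) (*-homo _ _)
        λ₁≈ : λ′ τ₁ ≈ ι (π^ (f τ₁) K.* c₂ K.⁻¹) * λ′ τ₂
        λ₁≈ = L.trans (L.*-cong c₁≈ (L.^-congʳ x (≡.sym exponent≡))) (L.*-assoc _ _ _)

      Ψ : Fin n → Vector K.Carrier q
      Ψ i = t (p ℕ.^ place i)

      place<n : ∀ (i : Fin n) → place i ℕ.< n
      place<n i = ℕ.∸-monoʳ-< {n} {suc (toℕ i)} {0} ℕ.z<s (toℕ<n i)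

      Ψ-1 : ∀ i → Ψ i · L.1# ≈ L.0#
      Ψ-1 i = L.trans (t-· (p ℕ.^ place i) L.1#) (L.trans (D-power-< (p ℕ.^ place i) {0} 0<q)
        (derivative-< (ℕ.>-nonZero⁻¹ (p ℕ.^ place i) {{m^n≢0 p (place i)}})))

      module _ (i : Fin n) (τ : ℤ) where
        private
          j = place i
          P = p ℕ.^ j
          a = exponent τ
          d = digit p-prime j a

        Ψ·λ : Ψ i · λ′ τ ≈ ι (π^ (f τ)) * (d ×ᴺ x ^ (a ∸ P))
        Ψ·λ = L.trans (t-· P (λ′ τ)) (L.trans (g-* (D-linear P) (π^ (f τ)) (x ^ a)) (L.*-congˡ (D-prime-power j (place<n i) a)))

        module _ (1≤d : 1 ℕ.≤ d) where
          private
            τ′ = τ ℤ.+ + P ℤ.* + b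
            P≤a : P ℕ.≤ a
            P≤a = ℕ.≮⇒≥ λ a<P → ℕ.<⇒≢ 1≤d (≡.sym (digit≡0 p-prime j a a<P))
            shift : ∀ b a P τ → b ℤ.* a ℤ.+ (τ ℤ.+ P ℤ.* b) ≡ b ℤ.* (P ℤ.+ a) ℤ.+ τ
            shift = ℤ-solve-∀
            bτ′≡ : + b ℤ.* + (a ∸ P) ℤ.+ τ′ ≡ + b ℤ.* + a ℤ.+ τ
            bτ′≡ = ≡.trans (shift (+ b) (+ (a ∸ P)) (+ P) τ) (cong (λ z → + b ℤ.* + z ℤ.+ τ) (ℕ.m+[n∸m]≡n P≤a))

          -- Lowering the exponent by P and raising the index by P b leaves b a + τ unchanged. So a
          -- - P solves the congruence for `τ′`, and the quotient `f` stays the same. A nonzero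
          -- digit at place j guarantees P ≤ a.
          exponent-shift : exponent τ′ ≡ a ∸ P
          exponent-shift = exponent-unique τ′ (a ∸ P) (ℕ.≤-<-trans (ℕ.m∸n≤m a P) (toℕ<n (𝔞 τ)))
            (subst (+ q Signed.∣_) (≡.sym bτ′≡) (q∣b𝔞+ τ))

          f-shift : f τ′ ≡ f τ
          f-shift = ℤ-quotient-unique q (f τ′) (f τ) (f-spec τ′) (f-spec τ) b𝔞τ′≡
            where
            b𝔞τ′≡ : + b ℤ.* + exponent τ′ ℤ.+ τ′ ≡ + b ℤ.* + a ℤ.+ τ
            b𝔞τ′≡ = ≡.trans (cong (λ z → + b ℤ.* + z ℤ.+ τ′) exponent-shift) bτ′≡

          Ψ·λ-shift : Ψ i · λ′ τ ≈ ι (d K.×ᴺ K.1#) * λ′ τ′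
          Ψ·λ-shift = begin
            Ψ i · λ′ τ                                    ≈⟨ Ψ·λ ⟩
            ι (π^ (f τ)) * (d ×ᴺ x ^ (a ∸ P))             ≈⟨ L.×-comm-* d _ _ ⟩
            d ×ᴺ (ι (π^ (f τ)) * x ^ (a ∸ P))             ≈⟨ L.×-congʳ d (L.*-cong (ι-cong (K.reflexive (cong π^ f-shift))) (L.^-congʳ x exponent-shift)) ⟨
            d ×ᴺ λ′ τ′                                    ≈⟨ L.×-congʳ d (L.*-identityˡ _) ⟨
            d ×ᴺ (L.1# * λ′ τ′)                           ≈⟨ L.×-assoc-* d _ _ ⟨
            d ×ᴺ L.1# * λ′ τ′                             ≈⟨ L.*-congʳ (ι-× d) ⟨
            ι (d K.×ᴺ K.1#) * λ′ τ′                       ∎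

        Ψ-λ : ∃[ u ] vK.IsUnitOfValuationRing u ×
          (1 ℕ.≤ d → Ψ i · λ′ τ ≈ ι u * λ′ (τ ℤ.+ + P ℤ.* + b)) ×
          (d ≡ 0 → Ψ i · λ′ τ ≈ L.0#)
        Ψ-λ = cases (1 ℕ.≤? d)
          where
          cases : Dec (1 ℕ.≤ d) → ∃[ u ] vK.IsUnitOfValuationRing u ×
            (1 ℕ.≤ d → Ψ i · λ′ τ ≈ ι u * λ′ (τ ℤ.+ + P ℤ.* + b)) × (d ≡ 0 → Ψ i · λ′ τ ≈ L.0#)
          -- The unit is the digit itself: as 0 < d < p, it is prime to p.
          cases (yes 1≤d) = d K.×ᴺ K.1# ,
            ∤⇒unit residue (ℕ.>⇒∤ {{ℕ.>-nonZero 1≤d}} (m%n<n (a / P) p)) ,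
            Ψ·λ-shift ,
            λ d≡0 → contradiction (≡.sym d≡0) (ℕ.<⇒≢ 1≤d)
            where instance _ = m^n≢0 p j
          -- For a zero digit any unit serves, since λ_τ is killed; 1 is the default.
          cases (no 1≰d) = K.1# , v≡0⇒unit (ValuationProps.v1 vK) ,
            (λ 1≤d → contradiction 1≤d 1≰d) ,
            λ d≡0 → L.trans Ψ·λ (L.trans (L.*-congˡ (L.×-cong d≡0 L.refl)) (L.zeroʳ _))

      scaffold : Scaffold∞ p-prime vK vL action {n} (λ _ → + b)
      scaffold = record
        { b-coprime = λ _ → b⊥p
        ; 𝔞 = 𝔞
        ; 𝔟𝔞 = 𝔟𝔞
        ; λ′ = λ′
        ; v-λ = v-λ
        ; λ-ratio = λ-ratio
        ; Ψ = Ψ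
        ; Ψ-1 = Ψ-1
        ; Ψ-λ = Ψ-λ
        }

-- A generator of valuation -b

open import Data.Nat.Base using (_<_; _^_)

theorem5p1 : ∀ {c ℓ c′ ℓ′} (p n : ℕ) (p-prime : Prime p)
    (K : LocalField p c ℓ) → HasCharacteristic (LocalField.asField K) p →
    (L : Field c′ ℓ′) (vL : NormalizedValuation L)
    (E : Extension (LocalField.asField K) L) →
    Extension.IsTotallyRamifiedOfDegree E (LocalField.valuation K) vL (p ^ n) →
    Extension.IsPurelyInseparable E p →
    (b : ℕ) → 0 < b → b < p ^ n → gcd b p ≡ 1 →
    Σ (Action E (𝒜 (LocalField.asField K) p n)) λ action →
    Action.IsHopfGalois action ×
    Scaffold∞ p-prime (LocalField.valuation K) vL action {n} (λ _ → + b)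
theorem5p1 p n p-prime K K-char L vL E totally-ramified purely-inseparable b _ _ gcd≡1 =
  action , isHopfGalois , scaffold
  where
  vK = LocalField.valuation K
  module Ext = ExtensionProps E
  module vL where
    open NormalizedValuation vL public
    open ValuationProps vL public
  module L where
    open Field L public
    open ExpProps semiring public using (_^_)
  b⊥p : Coprime b p
  b⊥p = ℕ.gcd≡1⇒coprime gcd≡1
  p×1≈0 = L.trans (L.sym (Ext.ι-× p)) (Ext.ι≈0 (Equivalence.from (K-char p) ℕ.∣-refl))
  π = vL.uniformizer
  -- The uniformizer of L supplies valuation b, and inversion the sign that makes the operators
  -- raise valuations.
  x = (proj₁ π L.^ b) L.⁻¹
  v-x : vL.v x ≡ [ ℤ.- + b ]
  v-x = ≡.trans (vL.v-⁻¹ (vL.v-^ b (proj₂ π))) (cong (λ i → [ ℤ.- i ]) (ℤ.*-identityˡ (+ b)))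
  p⊥-b : ℤ.Coprime (+ p) (ℤ.- + b)
  p⊥-b = subst (Coprime p) (≡.sym (ℤ.∣-i∣≡∣i∣ (+ b))) (ℕ.sym b⊥p)
  open PurelyInseparableGenerator E vK vL p-prime n totally-ramified
  -- This exponent has no known relation to n; that the p^n-th power of x already lies in K is
  -- extracted from it by `x^q∈K`.
  k₀ = purely-inseparable x
  x^q = x^q∈K x (ℤ.- + b) v-x p⊥-b p×1≈0 (proj₁ k₀) (proj₂ k₀)
  independent = powers-independent x (ℤ.- + b) v-x p⊥-b p×1≈0 (proj₁ k₀) (proj₂ k₀)
  spanning = powers-spanning x (ℤ.- + b) v-x p⊥-b p×1≈0 (proj₁ k₀) (proj₂ k₀)
  open HasseDerivatives E p-prime p×1≈0 n x x^q independent spanning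
  open Scaffold vK vL
    (proj₂ totally-ramified) (LocalField.residueCharacteristic K) b b⊥p v-x
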